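{- Let $G=(V,E)$ be an undirected graph with $n=|V|$, $m=|E|$, non-negative node weights $w_v$, and terminal set $S=\{s_1,\dots,s_k\}$ ($k\ge2$) forming an independent set. There is a randomized algorithm that, given any feasible solution $\mathbf{x}$ of $\textsc{Node-MC-Rel}$, returns a node multiway cut $C\subseteq V\setminus S$ (always feasible) with $\mathbb{E}\big[\sum_{v\in C}w_v\big]\le 2(1-1/k)\sum_{v\in V\setminus S}w_vx_v$, running in $O(m+n\log n)$ time. It can be derandomized to give a deterministic algorithm that returns a node multiway cut of weight at most $2(1-1/k)\sum_{v\in V\setminus S}w_vx_v$ in $O(kn+m+n\log n)$ time.
   Context: A node multiway cut is a set $V'\subseteq V\setminus S$ such that $G-V'$ has no path between $s_i$ and $s_j$ for any $i\neq j$. For $i<j$ let $\mathcal{P}_{ij}$ be the set of paths between $s_i$ and $s_j$ in $G$. $\textsc{Node-MC-Rel}$: minimize $\sum_{v\in V\setminus S}w_vx_v$ subject to $\sum_{v\in p}x_v\ge1$ for all $p\in\mathcal{P}_{ij}$, $i<j$ (sum over all vertices of $p$, including its endpoints), $x_v=0$ for $v\in S$, and $x_v\ge0$ for $v\in V$. Running times are in the RAM model with unit-cost real arithmetic. -}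

module Defs where

open import Algebra.Structures using (IsCommutativeRing)
open import Data.Bool using (Bool; true; false; if_then_else_; not; _∧_)
open import Data.Fin using (Fin; toℕ; fromℕ<)
import Data.Fin as Fin
open import Data.Fin.Properties using (any?; _≟_)
open import Data.Fin.Subset using (Subset; _∉_)
open import Data.Fin.Subset.Properties using (_∈?_)
open import Data.List using (List; []; _∷_; allFin; filter; foldr; head; last; length; lookup)
open import Data.List.Membership.Propositional using (_∈_)
open import Data.List.Relation.Unary.All using (All)
open import Data.List.Relation.Unary.AllPairs using (AllPairs)
open import Data.List.Relation.Unary.Linked using (Linked)
open import Data.List.Relation.Unary.Unique.Propositional using (Unique)
open import Data.Maybe using (just)
open import Data.Nat using (ℕ; zero; suc; _≡ᵇ_; _≤ᵇ_; _<?_)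
import Data.Nat as ℕ
open import Data.Product using (_×_; _,_; proj₁; proj₂; swap; ∃-syntax; Σ-syntax)
open import Data.Sum using (_⊎_)
open import Data.Vec using (Vec; []; _∷_; tabulate; toList)
open import Function.Definitions using (Injective)
open import Level using (Level; _⊔_) renaming (suc to lsuc)
open import Relation.Binary.PropositionalEquality using (_≡_; _≢_)
open import Relation.Binary.Structures using (IsDecTotalOrder)
import Relation.Binary.Construct.NonStrictToStrict as NonStrictToStrict
open import Relation.Nullary using (¬_; Dec; yes; no; does; ¬?)

------------------------------------------------------------------------
-- Scalars

-- The library has no real numbers.  Everything below is stated over an
-- arbitrary linearly ordered field whose order is decidable; the (classical)
-- reals are the intended instance, and decidability of ≤ is the unit-cost
-- comparison of the real RAM.

record OrderedField c ℓ : Set (lsuc (c ⊔ ℓ)) where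
  infix  4 _≤_
  infixl 6 _+_ _-_
  infixl 7 _*_
  infix  8 -_
  infix  9 _⁻¹
  field
    Carrier           : Set c
    _≤_               : Carrier → Carrier → Set ℓ
    _+_ _*_           : Carrier → Carrier → Carrier
    -_                : Carrier → Carrier
    0# 1#             : Carrier
    -- total, with an unspecified value at 0#
    _⁻¹               : Carrier → Carrier
    isCommutativeRing : IsCommutativeRing _≡_ _+_ _*_ -_ 0# 1#
    isDecTotalOrder   : IsDecTotalOrder _≡_ _≤_
    0≢1               : 0# ≢ 1#
    *-inverseʳ        : ∀ x → x ≢ 0# → x * x ⁻¹ ≡ 1#
    +-monoʳ-≤         : ∀ z {x y} → x ≤ y → z + x ≤ z + y
    *-nonNegative     : ∀ {x y} → 0# ≤ x → 0# ≤ y → 0# ≤ x * y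

  open IsDecTotalOrder isDecTotalOrder public using (_≤?_)
  open NonStrictToStrict _≡_ _≤_ public using (_<_)

  _-_ : Carrier → Carrier → Carrier
  x - y = x + - y

  fromℕ : ℕ → Carrier
  fromℕ zero    = 0#
  fromℕ (suc n) = 1# + fromℕ n

  sumOver : ∀ {a} {A : Set a} → List A → (A → Carrier) → Carrier
  sumOver vs f = foldr (λ v s → f v + s) 0# vs

------------------------------------------------------------------------
-- Graphs and node multiway cut

record Graph (n : ℕ) : Set where
  field
    edges      : List (Fin n × Fin n)
    -- simple: no loops, and no edge is listed twice in either orientation
    loopless   : All (λ e → proj₁ e ≢ proj₂ e) edges
    repeatless : AllPairs (λ e f → e ≢ f × e ≢ swap f) edges

  Adj : Fin n → Fin n → Set
  Adj u v = (u , v) ∈ edges ⊎ (v , u) ∈ edges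

  record IsPath (u v : Fin n) (p : List (Fin n)) : Set where
    field
      linked : Linked Adj p
      simple : Unique p
      starts : head p ≡ just u
      ends   : last p ≡ just v

module _ {c ℓ} (R : OrderedField c ℓ) where
  open OrderedField R

  record NodeMC : Set (c ⊔ ℓ) where
    field
      n           : ℕ
      G           : Graph n
      k           : ℕ
      2≤k         : 2 ℕ.≤ k
      s           : Fin k → Fin n
      s-injective : Injective _≡_ _≡_ s
      independent : ∀ i j → ¬ Graph.Adj G (s i) (s j)
      w           : Fin n → Carrier
      w-nonneg    : ∀ v → 0# ≤ w v

    open Graph G public

    m : ℕ
    m = length edges

    IsTerminal : Fin n → Set
    IsTerminal v = ∃[ i ] v ≡ s i

    isTerminal? : ∀ v → Dec (IsTerminal v)
    isTerminal? v = any? λ i → v ≟ s i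

    -- C ⊆ V ∖ S, and every path between distinct terminals meets C
    IsMultiwayCut : Subset n → Set
    IsMultiwayCut C =
      (∀ v → IsTerminal v → v ∉ C) ×
      (∀ i j → i ≢ j → ¬ (∃[ p ] IsPath (s i) (s j) p × All (_∉ C) p))

    weight : Subset n → Carrier
    weight C = sumOver (filter (_∈? C) (allFin n)) w

    record Feasible (x : Fin n → Carrier) : Set (c ⊔ ℓ) where
      field
        covers    : ∀ i j → i Fin.< j → ∀ p → IsPath (s i) (s j) p → 1# ≤ sumOver p x
        terminals : ∀ i → x (s i) ≡ 0#
        nonneg    : ∀ v → 0# ≤ x v

    objective : (Fin n → Carrier) → Carrier
    objective x =
      sumOver (filter (λ v → ¬? (isTerminal? v)) (allFin n)) (λ v → w v * x v)

    2[1-1/k]·_ : Carrier → Carrier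
    2[1-1/k]· a = (1# + 1#) * (1# - fromℕ k ⁻¹) * a

------------------------------------------------------------------------
-- Real RAM

-- Programs are finite syntax: structured code over finitely many named arrays
-- of naturals and, separately, of scalars.  Indices are arbitrary expressions,
-- so this is indirect addressing; a scalar variable is an array used at one
-- index.  On naturals only + and ∸ are primitive, and there is no conversion
-- from scalars to naturals (no floor).

ArrayName : Set
ArrayName = ℕ

data NExp : Set where
  lit       : ℕ → NExp
  get       : ArrayName → NExp → NExp
  _⊕_ _⊖_   : NExp → NExp → NExp

data RExp : Set where
  0ᵣ 1ᵣ             : RExp
  getᵣ              : ArrayName → NExp → RExp
  _⊕ᵣ_ _⊖ᵣ_ _⊗ᵣ_ _⊘ᵣ_ : RExp → RExp → RExp

data BExp : Set where
  _≤ₙ_ _=ₙ_ : NExp → NExp → BExp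
  _≤ᵣ_      : RExp → RExp → BExp
  notᵇ      : BExp → BExp
  _andᵇ_    : BExp → BExp → BExp

infixr 4 _⨾_

data Cmd : Set where
  skip          : Cmd
  set           : ArrayName → NExp → NExp → Cmd
  setᵣ          : ArrayName → NExp → RExp → Cmd
  -- store a fresh uniform sample from [0,1)
  draw          : ArrayName → NExp → Cmd
  _⨾_           : Cmd → Cmd → Cmd
  ifᶜ_then_else_ : BExp → Cmd → Cmd → Cmd
  while_loop_   : BExp → Cmd → Cmd

-- Unit cost per literal, memory access, arithmetic operation and test.

costₙ : NExp → ℕ
costₙ (lit _)   = 1
costₙ (get _ i) = suc (costₙ i)
costₙ (a ⊕ b)   = suc (costₙ a ℕ.+ costₙ b)
costₙ (a ⊖ b)   = suc (costₙ a ℕ.+ costₙ b)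

costᵣ : RExp → ℕ
costᵣ 0ᵣ         = 1
costᵣ 1ᵣ         = 1
costᵣ (getᵣ _ i) = suc (costₙ i)
costᵣ (a ⊕ᵣ b)   = suc (costᵣ a ℕ.+ costᵣ b)
costᵣ (a ⊖ᵣ b)   = suc (costᵣ a ℕ.+ costᵣ b)
costᵣ (a ⊗ᵣ b)   = suc (costᵣ a ℕ.+ costᵣ b)
costᵣ (a ⊘ᵣ b)   = suc (costᵣ a ℕ.+ costᵣ b)

costᵇ : BExp → ℕ
costᵇ (a ≤ₙ b)   = suc (costₙ a ℕ.+ costₙ b)
costᵇ (a =ₙ b)   = suc (costₙ a ℕ.+ costₙ b)
costᵇ (a ≤ᵣ b)   = suc (costᵣ a ℕ.+ costᵣ b)
costᵇ (notᵇ b)   = suc (costᵇ b)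
costᵇ (a andᵇ b) = suc (costᵇ a ℕ.+ costᵇ b)

write : ∀ {a} {A : Set a} → (ArrayName → ℕ → A) → ArrayName → ℕ → A → ArrayName → ℕ → A
write mem x i v y j = if (x ≡ᵇ y) ∧ (i ≡ᵇ j) then v else mem y j

module _ {c ℓ} (R : OrderedField c ℓ) where
  open OrderedField R

  record State : Set c where
    constructor state
    field
      nats    : ArrayName → ℕ → ℕ
      scalars : ArrayName → ℕ → Carrier
      -- the random samples not yet drawn
      tape    : List Carrier

  open State

  module _ (σ : State) where
    evalₙ : NExp → ℕ
    evalₙ (lit q)   = q
    evalₙ (get x i) = nats σ x (evalₙ i)
    evalₙ (a ⊕ b)   = evalₙ a ℕ.+ evalₙ b
    evalₙ (a ⊖ b)   = evalₙ a ℕ.∸ evalₙ b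

    evalᵣ : RExp → Carrier
    evalᵣ 0ᵣ         = 0#
    evalᵣ 1ᵣ         = 1#
    evalᵣ (getᵣ x i) = scalars σ x (evalₙ i)
    evalᵣ (a ⊕ᵣ b)   = evalᵣ a + evalᵣ b
    evalᵣ (a ⊖ᵣ b)   = evalᵣ a - evalᵣ b
    evalᵣ (a ⊗ᵣ b)   = evalᵣ a * evalᵣ b
    evalᵣ (a ⊘ᵣ b)   = evalᵣ a * evalᵣ b ⁻¹

    evalᵇ : BExp → Bool
    evalᵇ (a ≤ₙ b)   = evalₙ a ≤ᵇ evalₙ b
    evalᵇ (a =ₙ b)   = evalₙ a ≡ᵇ evalₙ b
    evalᵇ (a ≤ᵣ b)   = does (evalᵣ a ≤? evalᵣ b)
    evalᵇ (notᵇ b)   = not (evalᵇ b)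
    evalᵇ (a andᵇ b) = evalᵇ a ∧ evalᵇ b

  -- ⟨ P , σ ⟩⇓[ t ] τ : started in σ, P halts in τ after exactly t steps.
  -- A draw from an exhausted tape is stuck, so an execution on the empty tape
  -- is deterministic.

  data ⟨_,_⟩⇓[_]_ : Cmd → State → ℕ → State → Set c where
    ⇓skip : ∀ {σ} → ⟨ skip , σ ⟩⇓[ 1 ] σ
    ⇓set : ∀ {σ x i e} →
      ⟨ set x i e , σ ⟩⇓[ suc (costₙ i ℕ.+ costₙ e) ]
        state (write (nats σ) x (evalₙ σ i) (evalₙ σ e)) (scalars σ) (tape σ)
    ⇓setᵣ : ∀ {σ x i e} →
      ⟨ setᵣ x i e , σ ⟩⇓[ suc (costₙ i ℕ.+ costᵣ e) ]
        state (nats σ) (write (scalars σ) x (evalₙ σ i) (evalᵣ σ e)) (tape σ)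
    ⇓draw : ∀ {σ x i u us} → tape σ ≡ u ∷ us →
      ⟨ draw x i , σ ⟩⇓[ suc (costₙ i) ]
        state (nats σ) (write (scalars σ) x (evalₙ σ i) u) us
    ⇓seq : ∀ {P Q σ τ υ t t′} →
      ⟨ P , σ ⟩⇓[ t ] τ → ⟨ Q , τ ⟩⇓[ t′ ] υ → ⟨ P ⨾ Q , σ ⟩⇓[ t ℕ.+ t′ ] υ
    ⇓then : ∀ {b P Q σ τ t} → evalᵇ σ b ≡ true →
      ⟨ P , σ ⟩⇓[ t ] τ → ⟨ ifᶜ b then P else Q , σ ⟩⇓[ suc (costᵇ b ℕ.+ t) ] τ
    ⇓else : ∀ {b P Q σ τ t} → evalᵇ σ b ≡ false →
      ⟨ Q , σ ⟩⇓[ t ] τ → ⟨ ifᶜ b then P else Q , σ ⟩⇓[ suc (costᵇ b ℕ.+ t) ] τ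
    ⇓stop : ∀ {b P σ} → evalᵇ σ b ≡ false →
      ⟨ while b loop P , σ ⟩⇓[ suc (costᵇ b) ] σ
    ⇓loop : ∀ {b P σ τ υ t t′} → evalᵇ σ b ≡ true →
      ⟨ P , σ ⟩⇓[ t ] τ → ⟨ while b loop P , τ ⟩⇓[ t′ ] υ →
      ⟨ while b loop P , σ ⟩⇓[ suc (costᵇ b ℕ.+ t ℕ.+ t′) ] υ

------------------------------------------------------------------------
-- Input and output conventions

  array : ∀ {a} {A : Set a} {q} → A → (Fin q → A) → ℕ → A
  array {q = q} default f i with i <? q
  ... | yes i<q = f (fromℕ< i<q)
  ... | no  _   = default

  -- Naturals: array 0 holds n, m, k; array 1 the terminals; arrays 2 and 3 the
  -- two endpoints of each edge.  Scalars: array 0 holds w, array 1 holds x.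
  -- All other cells are zero.
  load : (I : NodeMC R) → (Fin (NodeMC.n I) → Carrier) → List Carrier → State
  load I x ω = state nats₀ scalars₀ ω
    where
    open NodeMC I
    nats₀ : ArrayName → ℕ → ℕ
    nats₀ 0 0 = n
    nats₀ 0 1 = m
    nats₀ 0 2 = k
    nats₀ 1 i = array 0 (λ j → toℕ (s j)) i
    nats₀ 2 i = array 0 (λ e → toℕ (proj₁ (lookup edges e))) i
    nats₀ 3 i = array 0 (λ e → toℕ (proj₂ (lookup edges e))) i
    nats₀ _ _ = 0
    scalars₀ : ArrayName → ℕ → Carrier
    scalars₀ 0 i = array 0# w i
    scalars₀ 1 i = array 0# x i
    scalars₀ _ _ = 0#

  -- The returned set is {v | cell v of natural array 4 is nonzero}.
  result : ∀ {n} → State → Subset n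
  result σ = tabulate λ v → not (nats σ 4 (toℕ v) ≡ᵇ 0)

  -- On input (I , x) and random samples ω, P returns C within T steps.
  Returns : Cmd → (I : NodeMC R) → (Fin (NodeMC.n I) → Carrier) → List Carrier →
            ℕ → Subset (NodeMC.n I) → Set c
  Returns P I x ω T C =
    ∃[ t ] ∃[ σ ] (⟨ P , load I x ω ⟩⇓[ t ] σ × t ℕ.≤ T × result σ ≡ C)

------------------------------------------------------------------------
-- Expectation over independent uniform samples from [0,1)

  InUnit : Carrier → Set (c ⊔ ℓ)
  InUnit u = 0# ≤ u × u < 1#

  -- StepIntegral f a b y : f is a step function on [a,b] and ∫ₐᵇ f = y.
  -- Values at the finitely many breakpoints are ignored.
  data StepIntegral (f : Carrier → Carrier) : (a b y : Carrier) → Set (c ⊔ ℓ) where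
    piece : ∀ {a b} y → a ≤ b → (∀ u → a < u → u < b → f u ≡ y) →
            StepIntegral f a b ((b - a) * y)
    join  : ∀ {a b d y z} → StepIntegral f a b y → StepIntegral f b d z →
            StepIntegral f a d (y + z)

  -- IsExpectation F e : for independent uniform u₁, …, u_d in [0,1), the
  -- expectation of F (u₁ , … , u_d) exists as an iterated integral of step
  -- functions, and equals e.
  IsExpectation : ∀ {d} → (Vec Carrier d → Carrier) → Carrier → Set (c ⊔ ℓ)
  IsExpectation {zero}  F e = Level.Lift ℓ (F [] ≡ e)
  IsExpectation {suc d} F e =
    Σ[ g ∈ (Carrier → Carrier) ]
      (∀ u → InUnit u → IsExpectation (λ us → F (u ∷ us)) (g u)) ×
      StepIntegral g 0# 1# e

{-# OPTIONS --safe #-}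
module Submission where

open import Defs
open import Algebra.Bundles using (CommutativeRing; RawRing)
import Algebra.Properties.Ring as RingProperties
open import Algebra.Solver.Ring.AlmostCommutativeRing using (fromCommutativeRing; _-Raw-AlmostCommutative⟶_)
import Data.Bool as Bool
open import Data.Bool using (Bool; true; false; if_then_else_; not; _∧_; _∨_)
open import Data.Bool.Properties using (T-≡; not-injective; ∨-conicalˡ; ∨-conicalʳ; ∧-conicalˡ; ∧-conicalʳ)
import Data.Fin as Fin
open import Data.Fin using (Fin; zero; suc; toℕ; fromℕ<)
import Data.Fin.Properties as Fin
import Data.Fin.Subset as Subset
open import Data.Fin.Subset using (Subset; _∉_)
open import Data.Fin.Subset.Properties using (_∈?_)
import Data.Integer as ℤ
open import Data.Integer using (ℤ; -[1+_])
import Data.Integer.Properties as ℤ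
import Data.List as List
open import Data.List using (List; []; _∷_; head; last; _ʳ++_; tabulate; filter; lookup; drop)
import Data.List.Membership.DecPropositional as DecMembership
open import Data.List.Membership.Propositional using (_∈_)
import Data.List.Relation.Unary.All as All
open import Data.List.Relation.Unary.All using ([]; _∷_)
open import Data.List.Relation.Unary.All.Properties using (¬Any⇒All¬)
open import Data.List.Relation.Unary.AllPairs using ([]; _∷_)
open import Data.List.Relation.Unary.Any using (here; there)
open import Data.List.Relation.Unary.Linked using (Linked; [-]; _∷_)
open import Data.List.Relation.Unary.Unique.Propositional using (Unique)
open import Data.Maybe using (Maybe; just; nothing)
open import Data.Maybe.Properties using (just-injective)
import Data.Nat as ℕ
open import Data.Nat using (ℕ; zero; suc; _≡ᵇ_; _≤ᵇ_; ⌊_/2⌋; z≤n; s≤s; _∸_; _^_)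
open import Data.Nat.Induction using (<-wellFounded; Acc; acc)
open import Data.Nat.Logarithm using (⌊log₂_⌋; ⌊log₂⌋-mono-≤; ⌊log₂[2^n]⌋≡n)
import Data.Nat.Properties as ℕ
open import Data.Nat.Solver using (module +-*-Solver)
open import Algebra.Properties.CommutativeMonoid.Sum ℕ.+-0-commutativeMonoid using (sum; sum-cong-≗; sum-replicate-zero)
open import Data.Product using (_×_; _,_; proj₁; proj₂; ∃-syntax; Σ-syntax)
open import Data.Sum using (_⊎_; inj₁; inj₂)
import Data.Sum as Sum
open import Data.Vec using (Vec; []; toList)
import Data.Vec as Vec
import Data.Vec.Properties as Vec
open import Data.Vec.Properties using (lookup∘tabulate; []=⇒lookup; lookup⇒[]=)
open import Data.Vec.Relation.Unary.All using (All)
open import Function using (_∘_)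
open import Function.Bundles using (Equivalence)
open import Level using (Level; _⊔_; lift)
open import Relation.Binary.Bundles using (TotalOrder)
open import Relation.Binary.Definitions using (tri<; tri≈; tri>)
open import Relation.Binary.PropositionalEquality hiding (J)
open import Relation.Binary.Structures using (IsDecTotalOrder)
open import Relation.Nullary using (¬_; Dec; yes; no; does; contradiction; ¬?)
open import Relation.Nullary.Decidable using (dec-true; dec-false)
open import Relation.Unary using (Decidable)
open State

-- Exclude the terminal q, and let A v be the distance from the other terminals to v without x v,
-- and D v = A v + x v.  For θ in [0 , ½) the vertices with A v ≤ θ < D v form a multiway cut,
-- because an edge between the balls {D ≤ θ} of two terminals would lie on a path of length at
-- most 2θ < 1.  For uniform θ, the vertex v is cut with probability 2 len_q v, where len_q v is
-- the length of [A v , D v) ∩ [0 , ½).  If len v is this length when no terminal is excluded,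
-- then len_q v ≤ len v, and len_q v ≤ x v - len v when q is the terminal nearest to v.
-- Averaging over q gives the factor 2 (1 - 1/k).
--
-- These bounds on len_q involve only the distances and nearest terminals found by one search
-- from all terminals, so the method of conditional expectations finds q in linear time.  A second
-- search, from the terminals other than q, meets the vertices in the order of D: the weight of
-- its frontier is the weight of the cut as θ grows, and the best θ is found along the way.
-- Hence O(m + n log n) time suffices without any random samples (d = 0).  With node weights the
-- key of a vertex is final when it is first discovered, so the queue needs no decrease-key.

-- The bound len_q v ≤ x v - len v rests on gluing: if q is the terminal nearest to v, the walks
-- from v found by the two searches end at different terminals, so together with x v they have
-- length at least 1 = ½ + ½. Compared with w v * len v, the vertex v thus saves w v * (2 len v - x
-- v), and it does so for exactly one q, the label of v. Some q therefore saves at least 1/k of the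
-- total, and that q is the one with the largest profit. The choice of θ uses no integral over
-- thresholds: the sweep maintains that the best weight seen, times t, is at most the integral of
-- the cut weight over [0 , t). At t = ½ this says that the recorded cut is no heavier than the
-- average one. Exact shortest distances are never stated. Every recorded value is the length of an
-- actual walk, and it satisfies the relaxation inequality along edges while it is below ½; these
-- two facts bound it from both sides. Distances are truncated at ½, so 1 can serve as infinity. The
-- excluded terminal is a natural number, and the value k excludes none, so a single verified `pass`
-- covers both searches.

module FieldProperties {c ℓ} (R : OrderedField c ℓ) where
  open OrderedField R public

  commutativeRing : CommutativeRing c c
  commutativeRing = record { isCommutativeRing = isCommutativeRing }

  open CommutativeRing commutativeRing public
    using (+-identityˡ; +-identityʳ; +-comm; +-assoc; *-comm; *-assoc; *-identityˡ; *-identityʳ;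
           zeroˡ; zeroʳ; distribˡ; distribʳ; -‿inverseʳ; ring; +-abelianGroup)
  private
    module RingPropertiesR = RingProperties ring

  totalOrder : TotalOrder c c ℓ
  totalOrder = record { isTotalOrder = IsDecTotalOrder.isTotalOrder isDecTotalOrder }

  open IsDecTotalOrder isDecTotalOrder public
    using (total) renaming (refl to ≤-refl; reflexive to ≤-reflexive; trans to ≤-trans; antisym to ≤-antisym; _≟_ to _≟ᶠ_)

  -- Integer coefficients and the ring solver.

  fromℕ-+ : ∀ a b → fromℕ (a ℕ.+ b) ≡ fromℕ a + fromℕ b
  fromℕ-+ ℕ.zero    b = sym (+-identityˡ _)
  fromℕ-+ (ℕ.suc a) b = trans (cong (1# +_) (fromℕ-+ a b)) (sym (+-assoc _ _ _))

  fromℕ-* : ∀ a b → fromℕ (a ℕ.* b) ≡ fromℕ a * fromℕ b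
  fromℕ-* ℕ.zero    b = sym (zeroˡ _)
  fromℕ-* (ℕ.suc a) b = trans (fromℕ-+ b (a ℕ.* b))
    (trans (cong₂ _+_ (sym (*-identityˡ _)) (fromℕ-* a b)) (sym (distribʳ _ _ _)))

  fromℤ : ℤ → Carrier
  fromℤ (ℤ.+ a)  = fromℕ a
  fromℤ -[1+ a ] = - fromℕ (ℕ.suc a)

  private
    cancel1 : ∀ a b → a + - b ≡ (1# + a) + - (1# + b)
    cancel1 a b = sym (begin
      (1# + a) + - (1# + b)     ≡⟨ cong ((1# + a) +_) (sym (RingPropertiesR.-‿+-comm 1# b)) ⟩
      (1# + a) + (- 1# + - b)   ≡⟨ cong (_+ (- 1# + - b)) (+-comm 1# a) ⟩
      (a + 1#) + (- 1# + - b)   ≡⟨ +-assoc a 1# _ ⟩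
      a + (1# + (- 1# + - b))   ≡⟨ cong (a +_) (sym (+-assoc 1# (- 1#) (- b))) ⟩
      a + ((1# + - 1#) + - b)   ≡⟨ cong (λ z → a + (z + - b)) (-‿inverseʳ 1#) ⟩
      a + (0# + - b)            ≡⟨ cong (a +_) (+-identityˡ _) ⟩
      a + - b                   ∎)
      where open ≡-Reasoning

  fromℤ-⊖ : ∀ a b → fromℤ (a ℤ.⊖ b) ≡ fromℕ a + - fromℕ b
  fromℤ-⊖ a ℕ.zero = sym (trans (cong (fromℕ a +_) RingPropertiesR.-0#≈0#) (+-identityʳ _))
  fromℤ-⊖ ℕ.zero (ℕ.suc b) = sym (+-identityˡ _)
  fromℤ-⊖ (ℕ.suc a) (ℕ.suc b) = trans (cong fromℤ (ℤ.[1+m]⊖[1+n]≡m⊖n a b))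
    (trans (fromℤ-⊖ a b) (cancel1 _ _))

  fromℤ-neg : ∀ a → fromℤ (ℤ.- a) ≡ - fromℤ a
  fromℤ-neg (ℤ.+ ℕ.zero)    = sym RingPropertiesR.-0#≈0#
  fromℤ-neg (ℤ.+ (ℕ.suc n)) = refl
  fromℤ-neg -[1+ n ]        = sym (RingPropertiesR.-‿involutive _)

  fromℤ-+ : ∀ a b → fromℤ (a ℤ.+ b) ≡ fromℤ a + fromℤ b
  fromℤ-+ (ℤ.+ a)  (ℤ.+ b)  = fromℕ-+ a b
  fromℤ-+ (ℤ.+ a)  -[1+ b ] = fromℤ-⊖ a (ℕ.suc b)
  fromℤ-+ -[1+ a ] (ℤ.+ b)  = trans (fromℤ-⊖ b (ℕ.suc a)) (+-comm _ _)
  fromℤ-+ -[1+ a ] -[1+ b ] = begin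
    - fromℕ (ℕ.suc (ℕ.suc (a ℕ.+ b)))         ≡⟨ cong (-_ ∘ fromℕ) (sym (ℕ.+-suc (ℕ.suc a) b)) ⟩
    - fromℕ (ℕ.suc a ℕ.+ ℕ.suc b)             ≡⟨ cong -_ (fromℕ-+ (ℕ.suc a) (ℕ.suc b)) ⟩
    - (fromℕ (ℕ.suc a) + fromℕ (ℕ.suc b))     ≡⟨ sym (RingPropertiesR.-‿+-comm _ _) ⟩
    - fromℕ (ℕ.suc a) + - fromℕ (ℕ.suc b)     ∎
    where open ≡-Reasoning

  fromℤ-pos* : ∀ a b → fromℤ (ℤ.+ a ℤ.* b) ≡ fromℕ a * fromℤ b
  fromℤ-pos* a (ℤ.+ b) = trans (cong fromℤ (sym (ℤ.pos-* a b))) (fromℕ-* a b)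
  fromℤ-pos* a -[1+ b ] = begin
    fromℤ (ℤ.+ a ℤ.* ℤ.- (ℤ.+ ℕ.suc b))     ≡⟨ cong fromℤ (sym (ℤ.neg-distribʳ-* (ℤ.+ a) (ℤ.+ ℕ.suc b))) ⟩
    fromℤ (ℤ.- (ℤ.+ a ℤ.* ℤ.+ ℕ.suc b))     ≡⟨ fromℤ-neg (ℤ.+ a ℤ.* ℤ.+ ℕ.suc b) ⟩
    - fromℤ (ℤ.+ a ℤ.* ℤ.+ ℕ.suc b)         ≡⟨ cong -_ (fromℤ-pos* a (ℤ.+ ℕ.suc b)) ⟩
    - (fromℕ a * fromℕ (ℕ.suc b))           ≡⟨ RingPropertiesR.-‿distribʳ-* _ _ ⟩
    fromℕ a * - fromℕ (ℕ.suc b)             ∎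
    where open ≡-Reasoning

  fromℤ-* : ∀ a b → fromℤ (a ℤ.* b) ≡ fromℤ a * fromℤ b
  fromℤ-* (ℤ.+ a) b = fromℤ-pos* a b
  fromℤ-* -[1+ a ] b = begin
    fromℤ (ℤ.- (ℤ.+ ℕ.suc a) ℤ.* b)     ≡⟨ cong fromℤ (sym (ℤ.neg-distribˡ-* (ℤ.+ ℕ.suc a) b)) ⟩
    fromℤ (ℤ.- (ℤ.+ ℕ.suc a ℤ.* b))     ≡⟨ fromℤ-neg (ℤ.+ ℕ.suc a ℤ.* b) ⟩
    - fromℤ (ℤ.+ ℕ.suc a ℤ.* b)         ≡⟨ cong -_ (fromℤ-pos* (ℕ.suc a) b) ⟩
    - (fromℕ (ℕ.suc a) * fromℤ b)       ≡⟨ RingPropertiesR.-‿distribˡ-* _ _ ⟩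
    - fromℕ (ℕ.suc a) * fromℤ b         ∎
    where open ≡-Reasoning

  private
    -- Coefficients live in ℤ, where equality is decided by computation. The image of the integer 1
    -- is `1# + 0#`, which is not definitionally `1#`; identities that involve the unit therefore
    -- pass `1#` to the solver as a variable.
    ℤ-raw : RawRing _ _
    ℤ-raw = record { _≈_ = _≡_ ; _+_ = ℤ._+_ ; _*_ = ℤ._*_ ; -_ = ℤ.-_ ; 0# = ℤ.+ 0 ; 1# = ℤ.+ 1 }

    ℤ-morphism : ℤ-raw -Raw-AlmostCommutative⟶ fromCommutativeRing commutativeRing
    ℤ-morphism = record
      { ⟦_⟧ = fromℤ ; +-homo = fromℤ-+ ; *-homo = fromℤ-* ; -‿homo = fromℤ-neg
      ; 0-homo = refl ; 1-homo = +-identityʳ 1# }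

    dec : ∀ a b → Maybe (fromℤ a ≡ fromℤ b)
    dec a b with a ℤ.≟ b
    ... | yes eq = just (cong fromℤ eq)
    ... | no _   = nothing

  open import Algebra.Solver.Ring ℤ-raw (fromCommutativeRing commutativeRing) ℤ-morphism dec public
    using (solve; _:=_; _:+_; _:*_; _:-_; :-_; con; Polynomial)

  -- Inequalities in an ordered field.

  ≤-resp₂ : ∀ {a a′ b b′} → a ≡ a′ → b ≡ b′ → a ≤ b → a′ ≤ b′
  ≤-resp₂ refl refl p = p

  +-mono-≤ : ∀ {a b c d} → a ≤ b → c ≤ d → a + c ≤ b + d
  +-mono-≤ {a} {b} {c} {d} p q = ≤-trans (+-monoʳ-≤ a q) (≤-resp₂ (+-comm _ _) (+-comm _ _) (+-monoʳ-≤ d p))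

  +-nonneg : ∀ {a b} → 0# ≤ a → 0# ≤ b → 0# ≤ a + b
  +-nonneg p q = ≤-resp₂ (+-identityˡ _) refl (+-mono-≤ p q)

  diff-nonneg : ∀ {a b} → a ≤ b → 0# ≤ b - a
  diff-nonneg {a} {b} p = ≤-resp₂ (solve 1 (λ a → :- a :+ a := con (ℤ.+ 0)) refl a) (+-comm _ _) (+-monoʳ-≤ (- a) p)

  -- The workhorse for linear arithmetic: an inequality is proved by exhibiting the
  -- difference of its sides as a visibly non-negative expression.
  ≤-by : ∀ {a b e} → 0# ≤ e → b - a ≡ e → a ≤ b
  ≤-by {a} {b} p refl = ≤-resp₂ (+-identityʳ a) (solve 2 (λ a b → a :+ (b :- a) := b) refl a b) (+-monoʳ-≤ a p)

  ≰⇒≥ : ∀ {a b} → ¬ a ≤ b → b ≤ a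
  ≰⇒≥ {a} {b} np with total a b
  ... | inj₁ p = contradiction p np
  ... | inj₂ q = q

  *-monoˡ-≤ : ∀ {a b c} → 0# ≤ c → a ≤ b → c * a ≤ c * b
  *-monoˡ-≤ {a} {b} {c} p q = ≤-by (*-nonNegative p (diff-nonneg q))
    (solve 3 (λ a b c → c :* b :- c :* a := c :* (b :- a)) refl a b c)

  -- If 1 ≤ 0, then 0 - 1 is non-negative, and so is its square, which is 1.
  0≤1 : 0# ≤ 1#
  0≤1 with total 0# 1#
  ... | inj₁ p = p
  ... | inj₂ q = ≤-resp₂ refl
    (trans (solve 1 (λ o → (con (ℤ.+ 0) :- o) :* (con (ℤ.+ 0) :- o) := o :* o) refl 1#) (*-identityˡ 1#))
    (*-nonNegative (diff-nonneg q) (diff-nonneg q))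

  fromℕ-nonneg : ∀ a → 0# ≤ fromℕ a
  fromℕ-nonneg ℕ.zero    = ≤-refl
  fromℕ-nonneg (ℕ.suc a) = +-nonneg 0≤1 (fromℕ-nonneg a)

  1≰0 : ¬ 1# ≤ 0#
  1≰0 p = 0≢1 (≤-antisym 0≤1 p)

  1≤⇒≢0 : ∀ {a} → 1# ≤ a → a ≢ 0#
  1≤⇒≢0 p refl = 1≰0 p

  ⁻¹-nonneg : ∀ {a} → 1# ≤ a → 0# ≤ a ⁻¹
  ⁻¹-nonneg {a} 1≤a with total 0# (a ⁻¹)
  ... | inj₁ p = p
  ... | inj₂ q = contradiction (≤-by nonneg eq) 1≰0
    where
    nonneg : 0# ≤ a * (0# - a ⁻¹)
    nonneg = *-nonNegative (≤-trans 0≤1 1≤a) (diff-nonneg q)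
    eq : 0# - 1# ≡ a * (0# - a ⁻¹)
    eq = trans (cong (λ z → 0# - z) (sym (*-inverseʳ a (1≤⇒≢0 1≤a))))
      (solve 2 (λ a b → con (ℤ.+ 0) :- a :* b := a :* (con (ℤ.+ 0) :- b)) refl a (a ⁻¹))

  -- Written as a product so that it is definitionally the value of the expression that the program
  -- stores in `HALF`.
  ½ : Carrier
  ½ = 1# * (1# + 1#) ⁻¹

  ½+½ : ½ + ½ ≡ 1#
  ½+½ = trans (solve 2 (λ o i → o :* i :+ o :* i := (o :+ o) :* i) refl 1# ((1# + 1#) ⁻¹))
    (*-inverseʳ _ (1≤⇒≢0 (≤-by 0≤1 (solve 1 (λ o → o :+ o :- o := o) refl 1#))))

  1≰½ : ¬ 1# ≤ ½
  1≰½ p = 1≰0 (≤-trans p (≤-by (diff-nonneg (≤-trans (≤-reflexive ½+½) p))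
    (solve 1 (λ h → con (ℤ.+ 0) :- h := h :- (h :+ h)) refl ½)))

  ½≤1 : ½ ≤ 1#
  ½≤1 = ≰⇒≥ 1≰½

  ½≰0 : ¬ ½ ≤ 0#
  ½≰0 p = 1≰½ (≤-by (diff-nonneg p) (trans (cong (λ z → ½ - z) (sym ½+½))
    (solve 1 (λ h → h :- (h :+ h) := con (ℤ.+ 0) :- h) refl ½)))

  open import Algebra.Construct.NaturalChoice.Min totalOrder public
    using (_⊓_; x≤y⇒x⊓y≈x; x≤y⇒y⊓x≈x; x⊓y≤x; x⊓y≤y; ⊓-monoˡ-≤)

  does-true : ∀ {p} {P : Set p} (d : Dec P) → does d ≡ true → P
  does-true (yes p) _ = p

  does-false : ∀ {p} {P : Set p} (d : Dec P) → does d ≡ false → ¬ P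
  does-false (no ¬p) _ = ¬p

  -- finite sums

  ∑ : ∀ {n} → (Fin n → Carrier) → Carrier
  ∑ {ℕ.zero}  f = 0#
  ∑ {ℕ.suc n} f = f zero + ∑ (f ∘ suc)

  ∑-cong : ∀ {n} {f g : Fin n → Carrier} → (∀ i → f i ≡ g i) → ∑ f ≡ ∑ g
  ∑-cong {ℕ.zero}  eq = refl
  ∑-cong {ℕ.suc n} eq = cong₂ _+_ (eq zero) (∑-cong (eq ∘ suc))

  ∑-mono-≤ : ∀ {n} {f g : Fin n → Carrier} → (∀ i → f i ≤ g i) → ∑ f ≤ ∑ g
  ∑-mono-≤ {ℕ.zero}  p = ≤-refl
  ∑-mono-≤ {ℕ.suc n} p = +-mono-≤ (p zero) (∑-mono-≤ (p ∘ suc))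

  ∑-zero : ∀ n → ∑ {n} (λ _ → 0#) ≡ 0#
  ∑-zero ℕ.zero    = refl
  ∑-zero (ℕ.suc n) = trans (+-identityˡ _) (∑-zero n)

  ∑-+ : ∀ {n} (f g : Fin n → Carrier) → ∑ (λ i → f i + g i) ≡ ∑ f + ∑ g
  ∑-+ {ℕ.zero}  f g = sym (+-identityˡ 0#)
  ∑-+ {ℕ.suc n} f g = trans (cong (f zero + g zero +_) (∑-+ (f ∘ suc) (g ∘ suc)))
    (solve 4 (λ a b c d → a :+ b :+ (c :+ d) := a :+ c :+ (b :+ d)) refl (f zero) (g zero) _ _)

  ∑-*ˡ : ∀ {n} a (f : Fin n → Carrier) → ∑ (λ i → a * f i) ≡ a * ∑ f
  ∑-*ˡ {ℕ.zero}  a f = sym (zeroʳ a)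
  ∑-*ˡ {ℕ.suc n} a f = trans (cong (a * f zero +_) (∑-*ˡ a (f ∘ suc))) (sym (distribˡ a _ _))

  ∑-neg : ∀ {n} (f : Fin n → Carrier) → ∑ (λ i → - f i) ≡ - ∑ f
  ∑-neg {ℕ.zero}  f = solve 0 (con (ℤ.+ 0) := :- con (ℤ.+ 0)) refl
  ∑-neg {ℕ.suc n} f = trans (cong (- f zero +_) (∑-neg (f ∘ suc)))
    (solve 2 (λ a b → :- a :+ :- b := :- (a :+ b)) refl (f zero) _)

  ∑-- : ∀ {n} (f g : Fin n → Carrier) → ∑ (λ i → f i - g i) ≡ ∑ f - ∑ g
  ∑-- f g = trans (∑-+ f (λ i → - g i)) (cong (∑ f +_) (∑-neg g))

  ∑-update : ∀ {n} {f g : Fin n → Carrier} i {a} → g i ≡ f i + a → (∀ j → j ≢ i → g j ≡ f j) →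
             ∑ g ≡ ∑ f + a
  ∑-update {ℕ.suc n} {f} {g} zero {a} eq eqs =
    trans (cong₂ _+_ eq (∑-cong (λ j → eqs (suc j) (λ ()))))
      (solve 3 (λ a b c → a :+ b :+ c := a :+ c :+ b) refl (f zero) a _)
  ∑-update {ℕ.suc n} {f} {g} (suc i) {a} eq eqs =
    trans (cong₂ _+_ (eqs zero (λ ())) (∑-update i eq (λ j j≢i → eqs (suc j) (j≢i ∘ Fin.suc-injective))))
      (sym (+-assoc _ _ a))

  ∑-const : ∀ n a → ∑ {n} (λ _ → a) ≡ fromℕ n * a
  ∑-const ℕ.zero    a = sym (zeroˡ a)
  ∑-const (ℕ.suc n) a = trans (cong₂ _+_ (sym (*-identityˡ a)) (∑-const n a)) (sym (distribʳ a _ _))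

  -- Turns the filtered list sums of the specification into sums over all indices, where
  -- inequalities can be proved pointwise.
  sumOver-filter : ∀ {n a p} {A : Set a} {P : A → Set p} (P? : Decidable P) (g : Fin n → A) (f : A → Carrier) →
    sumOver (filter P? (tabulate g)) f ≡ ∑ (λ i → if does (P? (g i)) then f (g i) else 0#)
  sumOver-filter {ℕ.zero}  P? g f = refl
  sumOver-filter {ℕ.suc n} P? g f with P? (g zero)
  ... | yes _ = cong (f (g zero) +_) (sumOver-filter P? (g ∘ suc) f)
  ... | no  _ = trans (sumOver-filter P? (g ∘ suc) f) (sym (+-identityˡ _))

  ∑-swap : ∀ {m n} (f : Fin m → Fin n → Carrier) → ∑ (λ i → ∑ (f i)) ≡ ∑ (λ j → ∑ (λ i → f i j))
  ∑-swap {ℕ.zero} {n} f = sym (∑-zero n)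
  ∑-swap {ℕ.suc m} f = trans (cong (∑ (f zero) +_) (∑-swap (f ∘ suc)))
    (sym (∑-+ (f zero) (λ j → ∑ (λ i → f (suc i) j))))

-- Total correctness with time bounds, and frame conditions.

module Hoare {c ℓ} (R : OrderedField c ℓ) where
  open import Data.Nat using (_≤_; _<_; _+_; _*_; _∸_)
  open import Data.Nat.Properties

  -- A total-correctness triple for one start state. T is only an upper bound on the time, so
  -- branches of different cost can be joined.
  Runs : ∀ {p} → Cmd → State R → ℕ → (State R → Set p) → Set (c ⊔ p)
  Runs P σ T Φ = ∃[ t ] ∃[ τ ] ⟨_,_⟩⇓[_]_ R P σ t τ × t ≤ T × Φ τ

  private variable
    p q : Level
    P Q : Cmd
    b   : BExp
    σ   : State R
    T U : ℕ
    Φ   : State R → Set p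
    Ψ   : State R → Set q

  Runs-mono : T ≤ U → (∀ τ → Φ τ → Ψ τ) → Runs P σ T Φ → Runs P σ U Ψ
  Runs-mono T≤U f (t , τ , r , t≤T , φ) = t , τ , r , ≤-trans t≤T T≤U , f τ φ

  Runs-seq : Runs P σ T Φ → (∀ τ → Φ τ → Runs Q τ U Ψ) → Runs (P ⨾ Q) σ (T + U) Ψ
  Runs-seq (t , τ , r , t≤T , φ) k with t′ , υ , r′ , t′≤U , ψ ← k τ φ =
    t + t′ , υ , ⇓seq r r′ , +-mono-≤ t≤T t′≤U , ψ

  Runs-then : evalᵇ R σ b ≡ true → Runs P σ T Φ → Runs (ifᶜ b then P else Q) σ (suc (costᵇ b + T)) Φ
  Runs-then {b = b} e (t , τ , r , t≤T , φ) = _ , τ , ⇓then e r , s≤s (+-monoʳ-≤ (costᵇ b) t≤T) , φ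

  Runs-else : evalᵇ R σ b ≡ false → Runs Q σ T Φ → Runs (ifᶜ b then P else Q) σ (suc (costᵇ b + T)) Φ
  Runs-else {b = b} e (t , τ , r , t≤T , φ) = _ , τ , ⇓else e r , s≤s (+-monoʳ-≤ (costᵇ b) t≤T) , φ

  Runs-if : (evalᵇ R σ b ≡ true → Runs P σ T Φ) → (evalᵇ R σ b ≡ false → Runs Q σ U Φ) →
            Runs (ifᶜ b then P else Q) σ (suc (costᵇ b + (T ℕ.⊔ U))) Φ
  Runs-if {σ = σ} {b = b} {T = T} {U = U} f g with evalᵇ R σ b in eq
  ... | true  = Runs-then eq (Runs-mono (m≤m⊔n T U) (λ _ φ → φ) (f refl))
  ... | false = Runs-else eq (Runs-mono (m≤n⊔m T U) (λ _ φ → φ) (g refl))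

  -- Amortised accounting: of a budget k, the part k′ is left after the run.
  Spends : ∀ {p} → Cmd → State R → ℕ → (ℕ → State R → Set p) → Set (c ⊔ p)
  Spends P σ k Φ = ∃[ t ] ∃[ τ ] ∃[ k′ ] ⟨_,_⟩⇓[_]_ R P σ t τ × t + k′ ≤ k × Φ k′ τ

  Runs⇒Spends : ∀ k → Runs P σ T Φ → Spends P σ (T + k) (λ k′ τ → k′ ≡ k × Φ τ)
  Runs⇒Spends k (t , τ , r , t≤T , φ) = t , τ , k , r , +-monoˡ-≤ k t≤T , refl , φ

  Spends⇒Runs : ∀ {k} {Φ : ℕ → State R → Set p} → Spends P σ k Φ → Runs P σ k (λ τ → ∃[ k′ ] Φ k′ τ)
  Spends⇒Runs (t , τ , k′ , r , le , φ) = t , τ , r , ≤-trans (m≤m+n t k′) le , k′ , φ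

  Spends-mono : ∀ {k k₁} {Φ : ℕ → State R → Set p} {Ψ : ℕ → State R → Set q} → k ≤ k₁ →
                (∀ k τ → Φ k τ → Ψ k τ) → Spends P σ k Φ → Spends P σ k₁ Ψ
  Spends-mono k≤k₁ f (t , τ , k′ , r , le , φ) = t , τ , k′ , r , ≤-trans le k≤k₁ , f k′ τ φ

  Spends-seq : ∀ {k} {Φ : ℕ → State R → Set p} {Ψ : ℕ → State R → Set q} →
               Spends P σ k Φ → (∀ k τ → Φ k τ → Spends Q τ k Ψ) → Spends (P ⨾ Q) σ k Ψ
  Spends-seq (t , τ , k₁ , r , le , φ) f with t′ , υ , k₂ , r′ , le′ , ψ ← f k₁ τ φ =
    t + t′ , υ , k₂ , ⇓seq r r′ ,
    ≤-trans (≤-reflexive (+-assoc t t′ k₂)) (≤-trans (+-monoʳ-≤ t le′) le) , ψ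

  -- Each iteration spends some of the budget, so termination comes with the time bound.
  Spends-while : (Inv : ℕ → State R → Set p) {Ψ : ℕ → State R → Set q} (e : ℕ) → costᵇ b < e →
    (∀ k σ → Inv k σ → evalᵇ R σ b ≡ true → ∃[ k₀ ] e + k₀ ≤ k × Spends P σ k₀ Inv) →
    (∀ k σ → Inv k σ → evalᵇ R σ b ≡ false → ∃[ k₀ ] e + k₀ ≤ k × Ψ k₀ σ) →
    ∀ k → Inv k σ → Spends (while b loop P) σ k Ψ
  Spends-while {b = b} {P = P} Inv {Ψ} e cost<e step exit k i = go (<-wellFounded k) i
    where
    go : ∀ {k} → Acc ℕ._<_ k → ∀ {σ} → Inv k σ → Spends (while b loop P) σ k Ψ
    go {k} (acc rec) {σ} i with evalᵇ R σ b in eq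
    ... | false with k₀ , le , ψ ← exit k σ i eq = _ , σ , k₀ , ⇓stop eq , ≤-trans (+-monoˡ-≤ k₀ cost<e) le , ψ
    ... | true with k₀ , le , t , τ , k₁ , r , le₁ , i₁ ← step k σ i eq
               with t′ , υ , k₂ , r′ , le₂ , ψ ← go (rec (≤-trans (s≤s (≤-trans (m≤n+m k₁ t) (≤-trans le₁ (m≤n+m k₀ (costᵇ b)))))
                                                          (≤-trans (+-monoˡ-≤ k₀ cost<e) le))) i₁ =
      _ , υ , k₂ , ⇓loop eq r r′ , bound , ψ
      where
      open ≤-Reasoning
      bound : suc (costᵇ b + t + t′) + k₂ ≤ k
      bound = begin
        suc (costᵇ b + t + t′) + k₂     ≡⟨ cong suc (trans (+-assoc (costᵇ b + t) t′ k₂) (+-assoc (costᵇ b) t (t′ + k₂))) ⟩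
        suc (costᵇ b + (t + (t′ + k₂))) ≤⟨ s≤s (+-monoʳ-≤ (costᵇ b) (≤-trans (+-monoʳ-≤ t le₂) le₁)) ⟩
        suc (costᵇ b) + k₀              ≤⟨ +-monoˡ-≤ k₀ cost<e ⟩
        e + k₀                          ≤⟨ le ⟩
        k                               ∎

  Runs-for : (Inv : ℕ → State R → Set p) (N T : ℕ) →
    (∀ i σ → i < N → Inv i σ → evalᵇ R σ b ≡ true × Runs P σ T (Inv (suc i))) →
    (∀ σ → Inv N σ → evalᵇ R σ b ≡ false) →
    Inv 0 σ →
    Runs (while b loop P) σ (N * suc (costᵇ b + T) + suc (costᵇ b)) (Inv N)
  Runs-for {b = b} {P = P} Inv N T step exit i₀ = go N 0 refl i₀
    where
    go : ∀ d i → i + d ≡ N → ∀ {σ} → Inv i σ → Runs (while b loop P) σ (d * suc (costᵇ b + T) + suc (costᵇ b)) (Inv N)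
    go zero i eq {σ} inv with refl ← trans (sym (+-identityʳ i)) eq = _ , σ , ⇓stop (exit σ inv) , ≤-refl , inv
    go (suc d) i eq {σ} inv
      with e , t , τ , r , t≤T , inv′ ← step i σ (subst (i <_) eq (m<m+n i (s≤s z≤n))) inv
      with t′ , υ , r′ , t′≤ , ψ ← go d (suc i) (trans (sym (+-suc i d)) eq) inv′ =
      _ , υ , ⇓loop e r r′ ,
      ≤-trans (s≤s (+-mono-≤ (+-monoʳ-≤ (costᵇ b) t≤T) t′≤))
        (≤-reflexive (sym (+-assoc (suc (costᵇ b + T)) (d * suc (costᵇ b + T)) _))) , ψ

  -- straight-line code

  -- Loop-free code is treated by reflection: `exec` computes the final state, so many
  -- postconditions hold by `refl` or by rewriting an array index. A `draw` is excluded because it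
  -- can be stuck.
  straight : Cmd → Bool
  straight skip                    = true
  straight (set _ _ _)             = true
  straight (setᵣ _ _ _)            = true
  straight (draw _ _)              = false
  straight (P ⨾ Q)                 = straight P ∧ straight Q
  straight (ifᶜ b then P else Q)   = straight P ∧ straight Q
  straight (while _ loop _)        = false

  time : Cmd → ℕ
  time (set x i e)               = suc (costₙ i + costₙ e)
  time (setᵣ x i e)              = suc (costₙ i + costᵣ e)
  time (P ⨾ Q)                   = time P + time Q
  time (ifᶜ b then P else Q)     = suc (costᵇ b + (time P ℕ.⊔ time Q))
  time _                         = 1

  exec : Cmd → State R → State R
  exec (set x i e) σ             = state (write (nats σ) x (evalₙ R σ i) (evalₙ R σ e)) (scalars σ) (tape σ)
  exec (setᵣ x i e) σ            = state (nats σ) (write (scalars σ) x (evalₙ R σ i) (evalᵣ R σ e)) (tape σ)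
  exec (P ⨾ Q) σ                 = exec Q (exec P σ)
  exec (ifᶜ b then P else Q) σ   = if evalᵇ R σ b then exec P σ else exec Q σ
  exec _ σ                       = σ

  exec-⇓ : ∀ P → straight P ≡ true → ∀ σ → Runs P σ (time P) (_≡ exec P σ)
  exec-⇓ skip s σ = _ , _ , ⇓skip , ≤-refl , refl
  exec-⇓ (set x i e) s σ = _ , _ , ⇓set , ≤-refl , refl
  exec-⇓ (setᵣ x i e) s σ = _ , _ , ⇓setᵣ , ≤-refl , refl
  exec-⇓ (P ⨾ Q) s σ = Runs-seq (exec-⇓ P (∧-conicalˡ _ _ s) σ) λ { _ refl → exec-⇓ Q (∧-conicalʳ (straight P) _ s) _ }
  exec-⇓ (ifᶜ b then P else Q) s σ = Runs-if
    (λ e → Runs-mono ≤-refl (λ { _ refl → cong (if_then exec P σ else exec Q σ) (sym e) })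
      (exec-⇓ P (∧-conicalˡ _ _ s) σ))
    (λ e → Runs-mono ≤-refl (λ { _ refl → cong (if_then exec P σ else exec Q σ) (sym e) })
      (exec-⇓ Q (∧-conicalʳ (straight P) _ s) σ))

  Runs-straight : ∀ P {σ} → straight P ≡ true → Φ (exec P σ) → Runs P σ (time P) Φ
  Runs-straight P s φ = Runs-mono ≤-refl (λ { _ refl → φ }) (exec-⇓ P s _)

  -- arrays that a program does not write

  -- A syntactic over-approximation that evaluates on concrete programs, so that frame conditions
  -- are discharged by `refl`.
  writesₙ : Cmd → ArrayName → Bool
  writesₙ (set x _ _)             y = x ≡ᵇ y
  writesₙ (P ⨾ Q)                 y = writesₙ P y ∨ writesₙ Q y
  writesₙ (ifᶜ _ then P else Q)   y = writesₙ P y ∨ writesₙ Q y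
  writesₙ (while _ loop P)        y = writesₙ P y
  writesₙ _                       y = false

  writesᵣ : Cmd → ArrayName → Bool
  writesᵣ (setᵣ x _ _)            y = x ≡ᵇ y
  writesᵣ (draw x _)              y = x ≡ᵇ y
  writesᵣ (P ⨾ Q)                 y = writesᵣ P y ∨ writesᵣ Q y
  writesᵣ (ifᶜ _ then P else Q)   y = writesᵣ P y ∨ writesᵣ Q y
  writesᵣ (while _ loop P)        y = writesᵣ P y
  writesᵣ _                       y = false

  record Frame (P : Cmd) (σ τ : State R) : Set c where
    field
      same-nats    : ∀ y → writesₙ P y ≡ false → nats τ y ≡ nats σ y
      same-scalars : ∀ y → writesᵣ P y ≡ false → scalars τ y ≡ scalars σ y
  open Frame public

  -- The arrays are equal as functions without extensionality: once the comparison of names is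
  -- `false`, the abstraction is `mem y` up to eta. The comparison is generalised to a variable so
  -- that the equation can be matched.
  write-other : ∀ {a} {A : Set a} (mem : ArrayName → ℕ → A) x i v y → (x ≡ᵇ y) ≡ false → write mem x i v y ≡ mem y
  write-other mem x i v y = lemma (x ≡ᵇ y)
    where
    lemma : ∀ b → b ≡ false → (λ j → if b ∧ (i ≡ᵇ j) then v else mem y j) ≡ mem y
    lemma _ refl = refl

  private
    ∨-l : ∀ {x y} → x ∨ y ≡ false → x ≡ false
    ∨-l = ∨-conicalˡ _ _
    ∨-r : ∀ x {y} → x ∨ y ≡ false → y ≡ false
    ∨-r x = ∨-conicalʳ x _

  ⇓-frame : ∀ {t τ} → ⟨_,_⟩⇓[_]_ R P σ t τ → Frame P σ τ
  ⇓-frame ⇓skip = record { same-nats = λ _ _ → refl ; same-scalars = λ _ _ → refl }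
  ⇓-frame (⇓set {σ} {x} {i} {e}) = record
    { same-nats = write-other (nats σ) x (evalₙ R σ i) (evalₙ R σ e) ; same-scalars = λ _ _ → refl }
  ⇓-frame (⇓setᵣ {σ} {x} {i} {e}) = record
    { same-nats = λ _ _ → refl ; same-scalars = write-other (scalars σ) x (evalₙ R σ i) (evalᵣ R σ e) }
  ⇓-frame (⇓draw {σ} {x} {i} {u} _) = record
    { same-nats = λ _ _ → refl ; same-scalars = write-other (scalars σ) x (evalₙ R σ i) u }
  ⇓-frame (⇓seq {P = P} r r′) with f ← ⇓-frame r | g ← ⇓-frame r′ = record
    { same-nats    = λ y e → trans (same-nats g y (∨-r (writesₙ P y) e)) (same-nats f y (∨-l e))
    ; same-scalars = λ y e → trans (same-scalars g y (∨-r (writesᵣ P y) e)) (same-scalars f y (∨-l e)) }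
  ⇓-frame (⇓then {P = P} _ r) with f ← ⇓-frame r = record
    { same-nats    = λ y e → same-nats f y (∨-l e)
    ; same-scalars = λ y e → same-scalars f y (∨-l e) }
  ⇓-frame (⇓else {P = P} _ r) with f ← ⇓-frame r = record
    { same-nats    = λ y e → same-nats f y (∨-r (writesₙ P y) e)
    ; same-scalars = λ y e → same-scalars f y (∨-r (writesᵣ P y) e) }
  ⇓-frame (⇓stop _) = record { same-nats = λ _ _ → refl ; same-scalars = λ _ _ → refl }
  ⇓-frame (⇓loop _ r r′) with f ← ⇓-frame r | g ← ⇓-frame r′ = record
    { same-nats    = λ y e → trans (same-nats g y e) (same-nats f y e)
    ; same-scalars = λ y e → trans (same-scalars g y e) (same-scalars f y e) }

  Runs-frame : Runs P σ T Φ → Runs P σ T (λ τ → Φ τ × Frame P σ τ)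
  Runs-frame (t , τ , r , t≤T , φ) = t , τ , r , t≤T , φ , ⇓-frame r

-- Threshold cuts around the terminals and the average over excluded terminals.

module Rounding {c ℓ} (R : OrderedField c ℓ) (I : NodeMC R) (x : Fin (NodeMC.n I) → OrderedField.Carrier R)
                (feasible : NodeMC.Feasible I x) where
  open FieldProperties R
  open NodeMC I
  open Feasible feasible
  open DecMembership (Fin._≟_ {n}) using () renaming (_∈?_ to _∈ₗ?_)

  private
    𝟎 : ∀ {m} → Polynomial m
    𝟎 = con (ℤ.+ 0)

  Adj-sym : ∀ {u v} → Adj u v → Adj v u
  Adj-sym = Sum.swap

  len∑ : List (Fin n) → Carrier
  len∑ l = sumOver l x

  len∑-nonneg : ∀ l → 0# ≤ len∑ l
  len∑-nonneg []      = ≤-refl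
  len∑-nonneg (v ∷ l) = +-nonneg (nonneg v) (len∑-nonneg l)

  len∑-tail : ∀ v l → len∑ l ≤ len∑ (v ∷ l)
  len∑-tail v l = ≤-by (nonneg v) (solve 2 (λ a b → a :+ b :- b := a) refl (x v) (len∑ l))

  -- walks contain paths

  suffix-path : ∀ {v t} p → Linked Adj p → Unique p → last p ≡ just t → v ∈ p →
                ∃[ p′ ] IsPath v t p′ × len∑ p′ ≤ len∑ p
  suffix-path p@(_ ∷ _) L U e (here refl) =
    p , record { linked = L ; simple = U ; starts = refl ; ends = e } , ≤-refl
  suffix-path (a ∷ p@(_ ∷ _)) (_ ∷ L) (_ ∷ U) e (there v∈p)
    with p′ , P , le ← suffix-path p L U e v∈p = p′ , P , ≤-trans le (len∑-tail a p)

  -- Loop erasure: if v already lies on the path obtained from the rest of the walk, the suffix that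
  -- starts at v is taken instead. Lengths do not grow because x is non-negative.
  shortcut : ∀ {v t} l → Linked Adj (v ∷ l) → last (v ∷ l) ≡ just t →
             ∃[ p ] IsPath v t p × len∑ p ≤ len∑ (v ∷ l)
  shortcut {v} [] L e = v ∷ [] , record { linked = L ; simple = [] ∷ [] ; starts = refl ; ends = e } , ≤-refl
  shortcut {v} (u ∷ l) (v~u ∷ L) e with shortcut l L e
  ... | [] , P , _ with () ← IsPath.starts P
  ... | p@(_ ∷ _) , P , le with IsPath.starts P | v ∈ₗ? p
  ...   | refl | yes v∈p with p′ , P′ , le′ ← suffix-path p (IsPath.linked P) (IsPath.simple P) (IsPath.ends P) v∈p =
            p′ , P′ , ≤-trans le′ (≤-trans le (len∑-tail v (u ∷ l)))
  ...   | refl | no v∉p =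
            v ∷ p , record { linked = v~u ∷ IsPath.linked P ; simple = ¬Any⇒All¬ _ v∉p ∷ IsPath.simple P
                           ; starts = refl ; ends = IsPath.ends P } , +-monoʳ-≤ (x v) le

  ʳ++-linked : ∀ {a} l {ys} → Linked Adj (a ∷ l) → Linked Adj (a ∷ ys) → Linked Adj (l ʳ++ (a ∷ ys))
  ʳ++-linked []      _       L′ = L′
  ʳ++-linked (b ∷ l) (e ∷ L) L′ = ʳ++-linked l L (Adj-sym e ∷ L′)

  ʳ++-head : ∀ (a : Fin n) l ys → head (l ʳ++ (a ∷ ys)) ≡ last (a ∷ l)
  ʳ++-head a []      ys = refl
  ʳ++-head a (b ∷ l) ys = ʳ++-head b l (a ∷ ys)

  ʳ++-last : ∀ (a : Fin n) l ys → last (l ʳ++ (a ∷ ys)) ≡ last (a ∷ ys)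
  ʳ++-last a []      ys = refl
  ʳ++-last a (b ∷ l) ys = ʳ++-last b l (a ∷ ys)

  ʳ++-len : ∀ l ys → len∑ (l ʳ++ ys) ≡ len∑ l + len∑ ys
  ʳ++-len []      ys = sym (+-identityˡ _)
  ʳ++-len (b ∷ l) ys = trans (ʳ++-len l (b ∷ ys))
    (solve 3 (λ a b c → b :+ (a :+ c) := a :+ b :+ c) refl (x b) (len∑ l) (len∑ ys))

  private
    covers< : ∀ {i j} p → i Fin.< j → Linked Adj p → head p ≡ just (s i) → last p ≡ just (s j) → 1# ≤ len∑ p
    covers< (v ∷ l) i<j L refl e with p , P , le ← shortcut l L e = ≤-trans (covers _ _ i<j p P) le

  -- Feasibility speaks of simple paths with i < j. Loop erasure lifts it to walks, and reversal,
  -- which preserves length, handles the other order.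
  covers-walk : ∀ {i j} p → i ≢ j → Linked Adj p → head p ≡ just (s i) → last p ≡ just (s j) → 1# ≤ len∑ p
  covers-walk {i} {j} p@(v ∷ l) i≢j L h e with Fin.<-cmp i j
  ... | tri< i<j _ _ = covers< p i<j L h e
  ... | tri≈ _ i≡j _ = contradiction i≡j i≢j
  ... | tri> _ _ j<i = ≤-trans
    (covers< (l ʳ++ (v ∷ [])) j<i (ʳ++-linked l L [-]) (trans (ʳ++-head v l []) e) (trans (ʳ++-last v l []) h))
    (≤-reflexive (trans (ʳ++-len l (v ∷ []))
      (solve 2 (λ a b → b :+ (a :+ 𝟎) := a :+ b) refl (x v) (len∑ l))))

  -- v ∷ l is a walk from v back to the terminal i
  record Walk (i : Fin k) (v : Fin n) (l : List (Fin n)) : Set where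
    field
      linked : Linked Adj (v ∷ l)
      ends   : last (v ∷ l) ≡ just (s i)

  -- The first walk reversed, followed by the second, joins two distinct terminals and counts v
  -- once.
  meet-vertex : ∀ {i j v l₁ l₂} → i ≢ j → Walk i v l₁ → Walk j v l₂ → 1# ≤ len∑ l₁ + (x v + len∑ l₂)
  meet-vertex {v = v} {l₁} {l₂} i≢j P Q = ≤-trans
    (covers-walk _ i≢j (ʳ++-linked l₁ (Walk.linked P) (Walk.linked Q))
      (trans (ʳ++-head v l₁ l₂) (Walk.ends P)) (trans (ʳ++-last v l₁ l₂) (Walk.ends Q)))
    (≤-reflexive (ʳ++-len l₁ (v ∷ l₂)))

  meet-edge : ∀ {i j u v l₁ l₂} → i ≢ j → Adj u v → Walk i u l₁ → Walk j v l₂ →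
              1# ≤ (len∑ l₁ + x u) + (len∑ l₂ + x v)
  meet-edge {u = u} {v} {l₁} {l₂} i≢j u~v P Q = ≤-trans
    (covers-walk _ i≢j (ʳ++-linked l₁ (Walk.linked P) (u~v ∷ Walk.linked Q))
      (trans (ʳ++-head u l₁ (v ∷ l₂)) (Walk.ends P)) (trans (ʳ++-last u l₁ (v ∷ l₂)) (Walk.ends Q)))
    (≤-reflexive (trans (ʳ++-len l₁ (u ∷ v ∷ l₂))
      (solve 4 (λ a b c d → a :+ (b :+ (c :+ d)) := (a :+ b) :+ (d :+ c)) refl (len∑ l₁) (x u) (x v) (len∑ l₂))))

  -- truncated distances from the terminals other than q

  -- A v is the distance to v without x v, D v the distance including it.
  record Found (q : ℕ) (A D : Carrier) (lab : ℕ) (v : Fin n) : Set (c ⊔ ℓ) where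
    field
      D≡        : D ≡ A + x v
      A<½       : ¬ ½ ≤ A
      terminal  : Fin k
      lab≡      : lab ≡ toℕ terminal
      lab≢q     : toℕ terminal ≢ q
      route     : List (Fin n)
      walk      : Walk terminal v route
      A≡        : len∑ route ≡ A

    0≤A : 0# ≤ A
    0≤A = ≤-resp₂ refl A≡ (len∑-nonneg route)

    A≤D : A ≤ D
    A≤D = ≤-by (nonneg v) (trans (cong (λ z → z - A) D≡) (solve 2 (λ a b → a :+ b :- a := b) refl A (x v)))

  -- The value 1 exceeds every threshold below ½, and A = D keeps the vertex out of every cut. The
  -- label 0 is a legitimate terminal index, so every vertex has a label below k, as `∑-profit`
  -- requires.
  record Unfound (A D : Carrier) (lab : ℕ) : Set c where
    field
      A≡1   : A ≡ 1#
      D≡1   : D ≡ 1#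
      lab≡0 : lab ≡ 0

  -- `Found` bounds the recorded values from below by exhibiting walks, and `closed`, the relaxation
  -- inequality, bounds them from above by every walk shorter than ½. With q = k every terminal is a
  -- source.
  record Distances (q : ℕ) (A D : Fin n → Carrier) (lab : Fin n → ℕ) : Set (c ⊔ ℓ) where
    field
      vertex  : ∀ v → Found q (A v) (D v) (lab v) v ⊎ Unfound (A v) (D v) (lab v)
      closed  : ∀ {u v} → Adj u v → ¬ ½ ≤ D u → A v ≤ D u
      sources : ∀ j → toℕ j ≢ q → D (s j) ≡ 0#

    length : Fin n → Carrier
    length v = (D v ⊓ ½) - (A v ⊓ ½)

    inCut : Carrier → Fin n → Bool
    inCut θ v = does (A v ≤? θ) ∧ not (does (D v ≤? θ))

    cutWeight : Carrier → Carrier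
    cutWeight θ = ∑ λ v → if inCut θ v then w v else 0#

    cut : Carrier → Subset n
    cut θ = Vec.tabulate (inCut θ)

    found : ∀ {v} → ¬ ½ ≤ A v → Found q (A v) (D v) (lab v) v
    found {v} A<½ with vertex v
    ... | inj₁ f = f
    ... | inj₂ u = contradiction (≤-resp₂ refl (sym (Unfound.A≡1 u)) ½≤1) A<½

    foundᴰ : ∀ {v} → ¬ ½ ≤ D v → Found q (A v) (D v) (lab v) v
    foundᴰ {v} D<½ with vertex v
    ... | inj₁ f = f
    ... | inj₂ u = contradiction (≤-resp₂ refl (sym (Unfound.D≡1 u)) ½≤1) D<½

    lab<k : ∀ v → lab v ℕ.< k
    lab<k v with vertex v
    ... | inj₁ f = subst (ℕ._< k) (sym (Found.lab≡ f)) (Fin.toℕ<n _)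
    ... | inj₂ u = subst (ℕ._< k) (sym (Unfound.lab≡0 u)) (ℕ.≤-trans (ℕ.s≤s ℕ.z≤n) 2≤k)

    terminal-A≡D : ∀ i → A (s i) ≡ D (s i)
    terminal-A≡D i with vertex (s i)
    ... | inj₁ f = sym (trans (Found.D≡ f) (trans (cong (A (s i) +_) (terminals i)) (+-identityʳ _)))
    ... | inj₂ u = trans (Unfound.A≡1 u) (sym (Unfound.D≡1 u))

    length-unfound : ∀ {v} → Unfound (A v) (D v) (lab v) → length v ≡ 0#
    length-unfound {v} u = trans (cong₂ (λ a d → (d ⊓ ½) - (a ⊓ ½)) (Unfound.A≡1 u) (Unfound.D≡1 u))
      (-‿inverseʳ (1# ⊓ ½))

    length-found : ∀ {v} → Found q (A v) (D v) (lab v) v → length v ≡ (D v ⊓ ½) - A v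
    length-found {v} f = cong (λ z → (D v ⊓ ½) - z) (x≤y⇒x⊓y≈x (≰⇒≥ (Found.A<½ f)))

    length≤½-A : ∀ {v} → Found q (A v) (D v) (lab v) v → length v ≤ ½ - A v
    length≤½-A {v} f rewrite length-found f = +-mono-≤ (x⊓y≤y (D v) ½) ≤-refl

    length≤x : ∀ v → length v ≤ x v
    length≤x v with vertex v
    ... | inj₂ u rewrite length-unfound u = nonneg v
    ... | inj₁ f rewrite length-found f = ≤-by (diff-nonneg (x⊓y≤x (D v) ½))
      (trans (solve 3 (λ m a y → y :- (m :- a) := a :+ y :- m) refl (D v ⊓ ½) (A v) (x v))
        (cong (λ z → z - (D v ⊓ ½)) (sym (Found.D≡ f))))

    0≤length : ∀ v → 0# ≤ length v
    0≤length v with vertex v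
    ... | inj₂ u rewrite length-unfound u = ≤-refl
    ... | inj₁ f = diff-nonneg (⊓-monoˡ-≤ ½ (Found.A≤D f))

    -- For a neighbour u in a ball, `closed` gives A v ≤ D u ≤ θ, and outside the cut this forces D
    -- v ≤ θ. So a path that avoids the cut cannot leave the balls.
    near-step : ∀ {θ u v} → ¬ ½ ≤ θ → Adj u v → inCut θ v ≡ false → D u ≤ θ → D v ≤ θ
    near-step {θ} {u} {v} θ<½ u~v v∉C Du≤θ with A v ≤? θ | D v ≤? θ
    ... | _      | yes p = p
    ... | no ¬p  | _     = contradiction (≤-trans (closed u~v (λ q → θ<½ (≤-trans q Du≤θ))) Du≤θ) ¬p
    near-step θ<½ u~v () Du≤θ | yes _ | no _
    -- Both directions are needed: the path may start at the terminal q, which need not be near.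
    near-forward : ∀ {θ u p} → ¬ ½ ≤ θ → Linked Adj (u ∷ p) → All.All (λ v → inCut θ v ≡ false) (u ∷ p) →
                   D u ≤ θ → All.All (λ v → D v ≤ θ) (u ∷ p)
    near-forward θ<½ [-] _ Du = Du ∷ []
    near-forward θ<½ (u~v ∷ L) (_ ∷ a@(v∉C ∷ _)) Du = Du ∷ near-forward θ<½ L a (near-step θ<½ u~v v∉C Du)

    near-backward : ∀ {θ u p t} → ¬ ½ ≤ θ → Linked Adj (u ∷ p) → All.All (λ v → inCut θ v ≡ false) (u ∷ p) →
                    last (u ∷ p) ≡ just t → D t ≤ θ → All.All (λ v → D v ≤ θ) (u ∷ p)
    near-backward θ<½ [-] _ refl Dt = Dt ∷ []
    near-backward θ<½ (u~v ∷ L) (u∉C ∷ a) e Dt with near-backward θ<½ L a e Dt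
    ... | ds@(Dv ∷ _) = near-step θ<½ (Adj-sym u~v) u∉C Dv ∷ ds

    private
      <½ : ∀ {θ a} → ¬ ½ ≤ θ → a ≤ θ → ¬ ½ ≤ a
      <½ θ<½ a≤θ p = θ<½ (≤-trans p a≤θ)

    same-label : ∀ {θ u v} → ¬ ½ ≤ θ → Adj u v → D u ≤ θ → D v ≤ θ → lab u ≡ lab v
    same-label {θ} {u} {v} θ<½ u~v Du≤θ Dv≤θ
      with f ← foundᴰ (<½ θ<½ Du≤θ) | g ← foundᴰ (<½ θ<½ Dv≤θ)
      with Found.terminal f Fin.≟ Found.terminal g
    ... | yes eq = trans (Found.lab≡ f) (trans (cong toℕ eq) (sym (Found.lab≡ g)))
    ... | no neq = contradiction θ-bound θ<½
      where
      1≤2θ : ½ + ½ ≤ θ + θ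
      1≤2θ = ≤-trans (≤-reflexive ½+½) (≤-trans (meet-edge neq u~v (Found.walk f) (Found.walk g))
        (+-mono-≤ (≤-trans (≤-reflexive (trans (cong (_+ x u) (Found.A≡ f)) (sym (Found.D≡ f)))) Du≤θ)
                  (≤-trans (≤-reflexive (trans (cong (_+ x v) (Found.A≡ g)) (sym (Found.D≡ g)))) Dv≤θ)))
      θ-bound : ½ ≤ θ
      θ-bound with total ½ θ
      ... | inj₁ p = p
      ... | inj₂ p = ≤-by (diff-nonneg (≤-trans 1≤2θ (+-mono-≤ p ≤-refl)))
              (solve 2 (λ t h → t :- h := (h :+ t) :- (h :+ h)) refl θ ½)

    constant-label : ∀ {θ u p t} → ¬ ½ ≤ θ → Linked Adj (u ∷ p) → All.All (λ v → D v ≤ θ) (u ∷ p) →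
                     last (u ∷ p) ≡ just t → lab u ≡ lab t
    constant-label θ<½ [-] _ refl = refl
    constant-label θ<½ (u~v ∷ L) (Du ∷ a@(Dv ∷ _)) e = trans (same-label θ<½ u~v Du Dv) (constant-label θ<½ L a e)

    -- A different label would give a walk between two terminals of length at most θ < ½, against
    -- feasibility. The excluded terminal is covered as well: no label can be q, so it lies in no
    -- ball.
    terminal-label : ∀ {θ} i → ¬ ½ ≤ θ → D (s i) ≤ θ → lab (s i) ≡ toℕ i
    terminal-label {θ} i θ<½ D≤θ with f ← foundᴰ (<½ θ<½ D≤θ) with i Fin.≟ Found.terminal f
    ... | yes eq = trans (Found.lab≡ f) (cong toℕ (sym eq))
    ... | no neq = contradiction (≤-trans ½≤1 (≤-trans
            (covers-walk _ neq (Walk.linked (Found.walk f)) refl (Walk.ends (Found.walk f)))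
            (≤-trans (≤-reflexive (trans (+-comm _ _) (trans (cong (_+ x (s i)) (Found.A≡ f)) (sym (Found.D≡ f))))) D≤θ))) θ<½

    source-near : ∀ {θ} i → 0# ≤ θ → toℕ i ≢ q → D (s i) ≤ θ
    source-near i 0≤θ i≢q = ≤-trans (≤-reflexive (sources i i≢q)) 0≤θ

    connected-in-ball : ∀ {θ i j p} → 0# ≤ θ → ¬ ½ ≤ θ → i ≢ j → IsPath (s i) (s j) p →
                        All.All (λ v → inCut θ v ≡ false) p → All.All (λ v → D v ≤ θ) p
    connected-in-ball {i = i} {j} {u ∷ p} 0≤θ θ<½ i≢j P a with toℕ i ℕ.≟ q | IsPath.starts P
    ... | no i≢q  | refl = near-forward θ<½ (IsPath.linked P) a (source-near i 0≤θ i≢q)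
    ... | yes i≡q | refl = near-backward θ<½ (IsPath.linked P) a (IsPath.ends P)
            (source-near j 0≤θ (λ j≡q → i≢j (Fin.toℕ-injective (trans i≡q (sym j≡q)))))

    last-All : ∀ {p} {P : Fin n → Set p} u l {t} → last (u ∷ l) ≡ just t → All.All P (u ∷ l) → P t
    last-All u []      refl (p ∷ _) = p
    last-All u (v ∷ l) e    (_ ∷ a) = last-All v l e a

    ∈-cut : ∀ θ v → inCut θ v ≡ true → v Subset.∈ cut θ
    ∈-cut θ v e = lookup⇒[]= v (cut θ) (trans (lookup∘tabulate (inCut θ) v) e)

    cut-∈ : ∀ θ v → v Subset.∈ cut θ → inCut θ v ≡ true
    cut-∈ θ v p = trans (sym (lookup∘tabulate (inCut θ) v)) ([]=⇒lookup p)

    ∉-cut : ∀ θ {v} → v ∉ cut θ → inCut θ v ≡ false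
    ∉-cut θ {v} p with inCut θ v in e
    ... | false = refl
    ... | true  = contradiction (∈-cut θ v e) p

    cut-isMultiwayCut : ∀ {θ} → 0# ≤ θ → ¬ ½ ≤ θ → IsMultiwayCut (cut θ)
    cut-isMultiwayCut {θ} 0≤θ θ<½ = no-terminal , disconnects
      where
      not-both : ∀ {a d} → a ≡ d → does (a ≤? θ) ∧ not (does (d ≤? θ)) ≢ true
      not-both {a} refl e with does (a ≤? θ) | e
      ... | true  | ()
      ... | false | ()
      -- As x vanishes on terminals, A and D agree there, and no threshold separates them.
      no-terminal : ∀ v → IsTerminal v → v ∉ cut θ
      no-terminal v (i , refl) v∈ = not-both (terminal-A≡D i) (cut-∈ θ v v∈)
      disconnects : ∀ i j → i ≢ j → ¬ (∃[ p ] IsPath (s i) (s j) p × All.All (_∉ cut θ) p)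
      disconnects i j i≢j (u ∷ p , P , a)
        with ds ← connected-in-ball 0≤θ θ<½ i≢j P (All.map (∉-cut θ) a) | IsPath.starts P
      ... | refl = i≢j (Fin.toℕ-injective
        (trans (sym (terminal-label i θ<½ (All.head ds)))
        (trans (constant-label θ<½ (IsPath.linked P) ds (IsPath.ends P))
               (terminal-label j θ<½ (last-All u p (IsPath.ends P) ds)))))

    weight-cut : ∀ θ → weight (cut θ) ≡ cutWeight θ
    weight-cut θ = trans (sumOver-filter (_∈? cut θ) (λ v → v) w)
      (∑-cong λ v → cong (if_then w v else 0#) (decided v))
      where
      decided : ∀ v → does (v ∈? cut θ) ≡ inCut θ v
      decided v with inCut θ v in e
      ... | true  = dec-true (v ∈? cut θ) (∈-cut θ v e)
      ... | false = dec-false (v ∈? cut θ) (λ p → contradiction (trans (sym e) (cut-∈ θ v p)) λ ())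

  -- the choice of the excluded terminal

  module Averaging {A₁ D₁ : Fin n → Carrier} {lab₁ : Fin n → ℕ} (all : Distances k A₁ D₁ lab₁) where
    private module All₁ = Distances all

    -- The difference between the two bounds w len₁ and w (x - len₁) on the share of v; the second
    -- is available when the label of v is excluded. It may be negative.
    gain : Fin n → Carrier
    gain v = w v * (All₁.length v + All₁.length v - x v)

    labelled : ℕ → Fin n → Bool
    labelled q v = lab₁ v ℕ.≡ᵇ q

    profit : ℕ → Carrier
    profit q = ∑ λ v → if labelled q v then gain v else 0#

    ∑-profit : ∑ {k} (profit ∘ toℕ) ≡ ∑ gain
    ∑-profit = trans (∑-swap λ (i : Fin k) v → if labelled (toℕ i) v then gain v else 0#) (∑-cong λ v →
      trans (∑-update (label v) (at v) (off v)) (trans (cong (_+ gain v) (∑-zero k)) (+-identityˡ _)))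
      where
      label : ∀ v → Fin k
      label v = Fin.fromℕ< (All₁.lab<k v)
      at : ∀ v → (if labelled (toℕ (label v)) v then gain v else 0#) ≡ 0# + gain v
      at v with lab₁ v ℕ.≡ᵇ toℕ (label v) in e
      ... | true  = sym (+-identityˡ _)
      ... | false = contradiction (ℕ.≡⇒≡ᵇ (lab₁ v) _ (sym (Fin.toℕ-fromℕ< (All₁.lab<k v)))) (subst (¬_ ∘ Bool.T) (sym e) λ ())
      off : ∀ v i → i ≢ label v → (if labelled (toℕ i) v then gain v else 0#) ≡ 0#
      off v i p with lab₁ v ℕ.≡ᵇ toℕ i in e
      ... | false = refl
      ... | true  = contradiction (Fin.toℕ-injective (trans (sym (ℕ.≡ᵇ⇒≡ (lab₁ v) _ (subst Bool.T (sym e) _)))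
                      (sym (Fin.toℕ-fromℕ< (All₁.lab<k v))))) p

    max-profit : ∀ {q} → (∀ (i : Fin k) → profit (toℕ i) ≤ profit q) → ∑ gain ≤ fromℕ k * profit q
    max-profit {q} p = ≤-trans (≤-reflexive (sym ∑-profit)) (≤-trans (∑-mono-≤ p) (≤-reflexive (∑-const k (profit q))))

    -- Relaxation along the walk, starting from its terminal. Being shorter than ½ passes to
    -- suffixes, and it is what permits the use of `closed` and `found` at each vertex.
    D₁≤walk : ∀ {i} u l → Walk i u l → ¬ ½ ≤ len∑ (u ∷ l) → D₁ u ≤ len∑ (u ∷ l)
    D₁≤walk {i} u [] P _ rewrite just-injective (Walk.ends P) =
      ≤-trans (≤-reflexive (All₁.sources i (ℕ.<⇒≢ (Fin.toℕ<n i)))) (len∑-nonneg (s i ∷ []))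
    D₁≤walk u (u′ ∷ l) P sum<½ with u~u′ ∷ L ← Walk.linked P = ≤-trans
      (≤-reflexive (trans (Found.D≡ f) (+-comm _ _))) (+-monoʳ-≤ (x u) A≤)
      where
      sum′<½ : ¬ ½ ≤ len∑ (u′ ∷ l)
      sum′<½ p = sum<½ (≤-trans p (len∑-tail u (u′ ∷ l)))
      D≤ = D₁≤walk u′ l (record { linked = L ; ends = Walk.ends P }) sum′<½
      A≤ : A₁ u ≤ len∑ (u′ ∷ l)
      A≤ = ≤-trans (All₁.closed (Adj-sym u~u′) (λ p → sum′<½ (≤-trans p D≤))) D≤
      f = All₁.found (λ p → sum′<½ (≤-trans p A≤))

    module _ {q : ℕ} {A D : Fin n → Carrier} {lab : Fin n → ℕ} (but-q : Distances q A D lab) where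
      private module Q = Distances but-q

      -- The route found without q is also a walk for the search from all terminals. Its length
      -- omits x v, so `D₁≤walk` is applied from the second vertex on.
      A₁≤A : ∀ {v} → Found q (A v) (D v) (lab v) v → A₁ v ≤ A v
      A₁≤A {v} f with Found.route f | Found.A≡ f | Found.walk f
      ... | [] | A≡ | P = ≤-reflexive (trans (at-terminal (just-injective (Walk.ends P))) A≡)
        where
        at-terminal : ∀ {v i} → v ≡ s i → A₁ v ≡ 0#
        at-terminal {i = i} refl = trans (All₁.terminal-A≡D i) (All₁.sources i (ℕ.<⇒≢ (Fin.toℕ<n i)))
      ... | u ∷ l | A≡ | P with v~u ∷ L ← Walk.linked P = ≤-trans
        (All₁.closed (Adj-sym v~u) (λ p → sum<½ (≤-trans p D≤))) (≤-trans D≤ (≤-reflexive A≡))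
        where
        sum<½ : ¬ ½ ≤ len∑ (u ∷ l)
        sum<½ p = Found.A<½ f (≤-trans p (≤-reflexive A≡))
        D≤ = D₁≤walk u l (record { linked = L ; ends = Walk.ends P }) sum<½

      -- The two intervals need not be nested. If D₁ v ≤ ½, the length on the right is all of x v;
      -- otherwise it is ½ - A₁ v, and A₁ v ≤ A v.
      length≤length₁ : ∀ v → Q.length v ≤ All₁.length v
      length≤length₁ v with Q.vertex v
      ... | inj₂ u = ≤-trans (≤-reflexive (Q.length-unfound u)) (All₁.0≤length v)
      ... | inj₁ f = cases (total (D₁ v) ½)
        where
        f₁ = All₁.found (λ p → Found.A<½ f (≤-trans p (A₁≤A f)))
        cases : D₁ v ≤ ½ ⊎ ½ ≤ D₁ v → Q.length v ≤ All₁.length v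
        cases (inj₁ D₁≤½) = ≤-trans (Q.length≤x v) (≤-reflexive (sym (trans (All₁.length-found f₁)
          (trans (cong (λ z → z - A₁ v) (trans (x≤y⇒x⊓y≈x D₁≤½) (Found.D≡ f₁)))
            (solve 2 (λ a y → a :+ y :- a := y) refl (A₁ v) (x v))))))
        cases (inj₂ ½≤D₁) = ≤-trans (Q.length≤½-A f) (≤-trans (≤-by (diff-nonneg (A₁≤A f))
          (solve 3 (λ h a b → h :- a :- (h :- b) := b :- a) refl ½ (A₁ v) (A v)))
          (≤-reflexive (sym (trans (All₁.length-found f₁) (cong (λ z → z - A₁ v) (x≤y⇒y⊓x≈x ½≤D₁))))))

      -- The full search reaches v from q and the other search from another terminal, so A₁ v + x v
      -- + A v ≥ ½ + ½. Hence ½ - A v ≤ x v - (½ - A₁ v), and the two truncated lengths are at most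
      -- ½ - A v and ½ - A₁ v.
      length≤x-length₁ : ∀ v → lab₁ v ≡ q → Q.length v ≤ x v - All₁.length v
      length≤x-length₁ v lab₁≡q with Q.vertex v
      ... | inj₂ u = ≤-trans (≤-reflexive (Q.length-unfound u)) (diff-nonneg (All₁.length≤x v))
      ... | inj₁ f = ≤-trans (Q.length≤½-A f) (≤-by
              (+-nonneg (diff-nonneg (All₁.length≤½-A f₁)) (diff-nonneg through))
              (solve 5 (λ y m h a b → y :- m :- (h :- b) := (h :- a :- m) :+ (a :+ (y :+ b) :- (h :+ h))) refl
                (x v) (All₁.length v) ½ (A₁ v) (A v)))
        where
        f₁ = All₁.found (λ p → Found.A<½ f (≤-trans p (A₁≤A f)))
        distinct : Found.terminal f₁ ≢ Found.terminal f
        distinct eq = Found.lab≢q f (trans (cong toℕ (sym eq)) (trans (sym (Found.lab≡ f₁)) lab₁≡q))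
        through : ½ + ½ ≤ A₁ v + (x v + A v)
        through = ≤-trans (≤-reflexive ½+½) (≤-trans (meet-vertex distinct (Found.walk f₁) (Found.walk f))
          (≤-reflexive (cong₂ (λ a b → a + (x v + b)) (Found.A≡ f₁) (Found.A≡ f))))

      total-length : ∑ (λ v → w v * Q.length v) ≤ ∑ (λ v → w v * All₁.length v) - profit q
      total-length = ≤-trans (∑-mono-≤ pointwise)
        (≤-reflexive (∑-- (λ v → w v * All₁.length v) (λ v → if labelled q v then gain v else 0#)))
        where
        pointwise : ∀ v → w v * Q.length v ≤ w v * All₁.length v - (if labelled q v then gain v else 0#)
        pointwise v with lab₁ v ℕ.≡ᵇ q in e
        ... | false = ≤-trans (*-monoˡ-≤ (w-nonneg v) (length≤length₁ v))
                (≤-reflexive (solve 1 (λ a → a := a :- 𝟎) refl _))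
        ... | true = ≤-trans (*-monoˡ-≤ (w-nonneg v) (length≤x-length₁ v (ℕ.≡ᵇ⇒≡ _ _ (subst Bool.T (sym e) _))))
                (≤-reflexive (solve 3 (λ w y m → w :* (y :- m) := w :* m :- w :* (m :+ m :- y)) refl
                  (w v) (x v) (All₁.length v)))

      -- k ∑ w len_q ≤ k ∑ w len₁ - ∑ gain = ∑ w (k len₁ - 2 len₁ + x) ≤ (k - 1) ∑ w x, as len₁ ≤ x and k ≥ 2.
      averaged : ∑ gain ≤ fromℕ k * profit q →
                 ∑ (λ v → w v * Q.length v) ≤ (1# - fromℕ k ⁻¹) * ∑ (λ v → w v * x v)
      averaged best = ≤-by (*-nonNegative (⁻¹-nonneg 1≤k) (diff-nonneg times-k)) eq
        where
        κ = fromℕ k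
        S = ∑ (λ v → w v * Q.length v)
        X = ∑ (λ v → w v * x v)
        L = ∑ (λ v → w v * All₁.length v)
        at-least-2 : ∀ {k} → 2 ℕ.≤ k → 0# ≤ fromℕ k - (1# + 1#)
        at-least-2 (ℕ.s≤s (ℕ.s≤s {n = j} _)) =
          ≤-resp₂ refl (solve 2 (λ o z → z := o :+ (o :+ z) :- (o :+ o)) refl 1# (fromℕ j)) (fromℕ-nonneg j)
        κ-2≥0 = at-least-2 2≤k
        1≤k : 1# ≤ κ
        1≤k = ≤-by (+-nonneg κ-2≥0 0≤1) (solve 2 (λ κ o → κ :- o := κ :- (o :+ o) :+ o) refl κ 1#)
        L≤X : L ≤ X
        L≤X = ∑-mono-≤ (λ v → *-monoˡ-≤ (w-nonneg v) (All₁.length≤x v))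
        ∑gain : ∑ gain ≡ L + L - X
        ∑gain = trans (∑-cong λ v → solve 3 (λ w m y → w :* (m :+ m :- y) := (w :* m :+ w :* m) :- w :* y) refl (w v) (All₁.length v) (x v))
          (trans (∑-- (λ v → w v * All₁.length v + w v * All₁.length v) (λ v → w v * x v))
            (cong (λ z → z - X) (∑-+ (λ v → w v * All₁.length v) (λ v → w v * All₁.length v))))
        Y = X - L
        [κ-2]Y≥0 : 0# ≤ κ * Y - (Y + Y)
        [κ-2]Y≥0 = ≤-resp₂ refl
          (trans (solve 3 (λ κ o y → (κ :- (o :+ o)) :* y := κ :* y :- (o :* y :+ o :* y)) refl κ 1# Y)
                 (cong (λ z → κ * Y - (z + z)) (*-identityˡ Y)))
          (*-nonNegative κ-2≥0 (diff-nonneg L≤X))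
        times-k : κ * S ≤ κ * X - X
        times-k = ≤-by
          (+-nonneg (+-nonneg (*-nonNegative (≤-trans 0≤1 1≤k) (diff-nonneg total-length))
            (diff-nonneg (≤-trans (≤-reflexive (sym ∑gain)) best))) [κ-2]Y≥0)
          (solve 5 (λ κ X S L P → κ :* X :- X :- κ :* S :=
              κ :* (L :- P :- S) :+ (κ :* P :- (L :+ L :- X)) :+ (κ :* (X :- L) :- (X :- L :+ (X :- L)))) refl
              κ X S L (profit q))
        eq : (1# - κ ⁻¹) * X - S ≡ κ ⁻¹ * (κ * X - X - κ * S)
        eq = trans (cong₂ (λ a b → (a - κ ⁻¹) * X - b) (sym inv) (trans (sym (*-identityˡ S)) (cong (_* S) (sym inv))))
          (solve 4 (λ κ i X S → (κ :* i :- i) :* X :- κ :* i :* S := i :* (κ :* X :- X :- κ :* S)) refl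
            κ (κ ⁻¹) X S)
          where
          inv = *-inverseʳ κ (1≤⇒≢0 1≤k)

      -- The first hypothesis compares one cut with the integral over [0 , ½); multiplying by 2 to
      -- clear the ½ is the origin of the factor 2.
      cut-bound : ∀ {θ} → Q.cutWeight θ * ½ ≤ ∑ (λ v → w v * Q.length v) → ∑ gain ≤ fromℕ k * profit q →
                  weight (Q.cut θ) ≤ 2[1-1/k]· (objective x)
      cut-bound {θ} good best = ≤-trans (≤-reflexive (trans (Q.weight-cut θ) doubled))
        (≤-trans (+-mono-≤ (≤-trans good (averaged best)) (≤-trans good (averaged best)))
          (≤-reflexive (trans (cong (λ z → (1# - fromℕ k ⁻¹) * z + (1# - fromℕ k ⁻¹) * z) (sym objective≡)) final)))
        where
        W = Q.cutWeight θ
        doubled : W ≡ W * ½ + W * ½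
        doubled = trans (sym (*-identityʳ W)) (trans (cong (W *_) (sym ½+½)) (distribˡ W ½ ½))
        objective≡ : objective x ≡ ∑ (λ v → w v * x v)
        objective≡ = trans (sumOver-filter (λ v → ¬? (isTerminal? v)) (λ v → v) (λ v → w v * x v)) (∑-cong pointwise)
          where
          pointwise : ∀ v → (if does (¬? (isTerminal? v)) then w v * x v else 0#) ≡ w v * x v
          pointwise v with isTerminal? v
          ... | yes (i , refl) = sym (trans (cong (w (s i) *_) (terminals i)) (zeroʳ _))
          ... | no _ = refl
        final : ∀ {a} → (1# - fromℕ k ⁻¹) * a + (1# - fromℕ k ⁻¹) * a ≡ 2[1-1/k]· a
        final {a} = trans (sym (cong₂ _+_ (*-identityˡ _) (*-identityˡ _)))
          (solve 3 (λ o c a → o :* (c :* a) :+ o :* (c :* a) := (o :+ o) :* c :* a) refl 1# (1# - fromℕ k ⁻¹) a)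

-- The algorithm as a program for the real RAM.

module Program where
  var : ArrayName → NExp
  var y = get y (lit 0)

  varᵣ : ArrayName → RExp
  varᵣ y = getᵣ y (lit 0)

  infix 5 _≔_ _≔ᵣ_
  _≔_ : ArrayName → NExp → Cmd
  y ≔ e = set y (lit 0) e

  _≔ᵣ_ : ArrayName → RExp → Cmd
  y ≔ᵣ e = setᵣ y (lit 0) e

  OUT PAR HEAD NEXT TO DISC LAB TOP I J V LABEL U P Q : ArrayName
  OUT = 4 ; PAR = 5 ; HEAD = 6 ; NEXT = 7 ; TO = 8 ; DISC = 9 ; LAB = 10 ; TOP = 11
  I = 12 ; J = 13 ; V = 14 ; LABEL = 15 ; U = 16 ; P = 17 ; Q = 18

  WT X A D KEY CUR W BEST THETA HALF PROFIT TMP₁ TMP₂ : ArrayName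
  WT = 0 ; X = 1 ; A = 2 ; D = 3 ; KEY = 4 ; CUR = 5 ; W = 6 ; BEST = 7 ; THETA = 8 ; HALF = 9
  PROFIT = 10 ; TMP₁ = 11 ; TMP₂ = 12

  N M K : NExp
  N = get 0 (lit 0)
  M = get 0 (lit 1)
  K = get 0 (lit 2)

  _<ₙ_ : NExp → NExp → BExp
  a <ₙ b = notᵇ (b ≤ₙ a)

  -- Vertex v is the leaf N + v of a tournament tree with root 1, in which the parent of
  -- node i is ⌊ i /2⌋; N need not be a power of two.
  parents : Cmd
  parents =
    I ≔ lit 0 ⨾
    while var I <ₙ N loop
      (set PAR (var I ⊕ var I) (var I) ⨾
       set PAR ((var I ⊕ var I) ⊕ lit 1) (var I) ⨾
       I ≔ var I ⊕ lit 1)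

  -- `P` is raised before the slot is used, so slots start at 1 and zeroed memory already represents
  -- empty lists.
  push : Cmd
  push =
    P ≔ var P ⊕ lit 1 ⨾
    set TO (var P) (var V) ⨾
    set NEXT (var P) (get HEAD (var U)) ⨾
    set HEAD (var U) (var P)

  -- Edges are pushed from the last to the first, so the linked lists follow the recursion of
  -- `neighbours` on suffixes of the edge list.
  adjacency : Cmd
  adjacency =
    J ≔ M ⨾
    while lit 1 ≤ₙ var J loop
      ((J ≔ var J ⊖ lit 1 ⨾ U ≔ get 2 (var J) ⨾ V ≔ get 3 (var J)) ⨾
       push ⨾
       (U ≔ get 3 (var J) ⨾ V ≔ get 2 (var J)) ⨾
       push)

  left right : NExp
  left  = var I ⊕ var I
  right = (var I ⊕ var I) ⊕ lit 1

  pull : Cmd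
  pull = ifᶜ getᵣ KEY left ≤ᵣ getᵣ KEY right
    then (set TOP (var I) (get TOP left) ⨾ setᵣ KEY (var I) (getᵣ KEY left))
    else (set TOP (var I) (get TOP right) ⨾ setᵣ KEY (var I) (getᵣ KEY right))

  -- Replays the matches on the way from the leaf of `V` to the root. The table stores 0 as the
  -- parent of the root, which ends the loop.
  sift : Cmd
  sift =
    I ≔ get PAR (N ⊕ var V) ⨾
    while lit 1 ≤ₙ var I loop
      (pull ⨾ I ≔ get PAR (var I))

  enqueue : Cmd
  enqueue =
    set DISC (var V) (lit 1) ⨾
    setᵣ A (var V) (varᵣ CUR) ⨾
    setᵣ D (var V) (varᵣ CUR ⊕ᵣ getᵣ X (var V)) ⨾
    set LAB (var V) (var LABEL) ⨾
    setᵣ KEY (N ⊕ var V) (varᵣ CUR ⊕ᵣ getᵣ X (var V)) ⨾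
    W ≔ᵣ varᵣ W ⊕ᵣ getᵣ WT (var V)

  visit : Cmd
  visit = ifᶜ get DISC (var V) =ₙ lit 0 then (enqueue ⨾ sift) else skip

  clear : Cmd
  clear =
    J ≔ lit 0 ⨾
    while var J <ₙ N loop
      (set DISC (var J) (lit 0) ⨾
       set LAB (var J) (lit 0) ⨾
       setᵣ A (var J) 1ᵣ ⨾
       setᵣ D (var J) 1ᵣ ⨾
       setᵣ KEY (N ⊕ var J) 1ᵣ ⨾
       set TOP (N ⊕ var J) (var J) ⨾
       J ≔ var J ⊕ lit 1)

  grow : Cmd
  grow =
    I ≔ N ⊖ lit 1 ⨾
    while lit 1 ≤ₙ var I loop
      (pull ⨾ I ≔ var I ⊖ lit 1)

  reset : Cmd
  reset =
    CUR ≔ᵣ 0ᵣ ⨾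
    W ≔ᵣ 0ᵣ ⨾
    BEST ≔ᵣ 0ᵣ ⨾
    THETA ≔ᵣ 0ᵣ

  -- When `Q` holds `K`, the test never succeeds and every terminal is a source.
  sources : Cmd
  sources =
    J ≔ lit 0 ⨾
    while var J <ₙ K loop
      ((ifᶜ var J =ₙ var Q then skip else
          (V ≔ get 1 (var J) ⨾ LABEL ≔ var J ⨾ visit)) ⨾
       J ≔ var J ⊕ lit 1)

  -- The weight of the frontier on the threshold interval that starts at CUR is W.
  keep-best : Cmd
  keep-best = ifᶜ notᵇ (varᵣ CUR ≤ᵣ 0ᵣ) andᵇ (varᵣ BEST ≤ᵣ varᵣ W)
    then skip
    else (BEST ≔ᵣ varᵣ W ⨾ THETA ≔ᵣ varᵣ CUR)

  -- Vertices with equal keys leave at the same threshold. Only a strictly larger key closes an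
  -- interval of positive length, on which the frontier is then final.
  advance : Cmd
  advance = ifᶜ getᵣ KEY (lit 1) ≤ᵣ varᵣ CUR
    then skip
    else (keep-best ⨾ CUR ≔ᵣ getᵣ KEY (lit 1))

  -- Deletion from the queue is a rise of the key to 1. `V` is set for the `sift` that follows, and
  -- `P` for the scan of the neighbours.
  settle : Cmd
  settle =
    set DISC (var U) (lit 2) ⨾
    setᵣ KEY (N ⊕ var U) 1ᵣ ⨾
    W ≔ᵣ varᵣ W ⊖ᵣ getᵣ WT (var U) ⨾
    V ≔ var U ⨾
    P ≔ get HEAD (var U)

  scan : Cmd
  scan = while lit 1 ≤ₙ var P loop
    ((V ≔ get TO (var P) ⨾ LABEL ≔ get LAB (var U)) ⨾
     visit ⨾
     P ≔ get NEXT (var P))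

  search : Cmd
  search = while notᵇ (varᵣ HALF ≤ᵣ getᵣ KEY (lit 1)) loop
    (U ≔ get TOP (lit 1) ⨾ advance ⨾ (settle ⨾ sift) ⨾ scan)

  pass : Cmd
  pass = clear ⨾ grow ⨾ reset ⨾ sources ⨾ search ⨾ keep-best

  truncate : ArrayName → ArrayName → Cmd
  truncate y z = ifᶜ getᵣ z (var J) ≤ᵣ varᵣ HALF then (y ≔ᵣ getᵣ z (var J)) else (y ≔ᵣ varᵣ HALF)

  profits : Cmd
  profits =
    J ≔ lit 0 ⨾
    while var J <ₙ N loop
      (truncate TMP₁ A ⨾
       truncate TMP₂ D ⨾
       setᵣ PROFIT (get LAB (var J))
         (getᵣ PROFIT (get LAB (var J)) ⊕ᵣ
          (getᵣ WT (var J) ⊗ᵣ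
            (((varᵣ TMP₂ ⊖ᵣ varᵣ TMP₁) ⊕ᵣ (varᵣ TMP₂ ⊖ᵣ varᵣ TMP₁)) ⊖ᵣ getᵣ X (var J)))) ⨾
       J ≔ var J ⊕ lit 1)

  argmax : Cmd
  argmax =
    (Q ≔ lit 0 ⨾ J ≔ lit 0) ⨾
    while var J <ₙ K loop
      ((ifᶜ getᵣ PROFIT (var Q) ≤ᵣ getᵣ PROFIT (var J) then (Q ≔ var J) else skip) ⨾
       J ≔ var J ⊕ lit 1)

  output : Cmd
  output =
    J ≔ lit 0 ⨾
    while var J <ₙ N loop
      ((ifᶜ (getᵣ A (var J) ≤ᵣ varᵣ THETA) andᵇ notᵇ (getᵣ D (var J) ≤ᵣ varᵣ THETA)
          then set OUT (var J) (lit 1) else skip) ⨾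
       J ≔ var J ⊕ lit 1)

  -- With `Q` equal to `K` the first pass excludes nothing; `argmax` then overwrites `Q` with the
  -- terminal that the second pass excludes.
  multiwayCut : Cmd
  multiwayCut =
    (HALF ≔ᵣ 1ᵣ ⊘ᵣ (1ᵣ ⊕ᵣ 1ᵣ)) ⨾
    parents ⨾
    adjacency ⨾
    (Q ≔ K) ⨾
    pass ⨾
    profits ⨾
    argmax ⨾
    pass ⨾
    output

-- Boolean comparisons, halving and logarithms.

≡true⇒T : ∀ {b} → b ≡ true → Bool.T b
≡true⇒T refl = _

≤ᵇ-true : ∀ {a b} → (a ≤ᵇ b) ≡ true → a ℕ.≤ b
≤ᵇ-true {a} {b} = ℕ.≤ᵇ⇒≤ a b ∘ ≡true⇒T

≤ᵇ-false : ∀ {a b} → (a ≤ᵇ b) ≡ false → b ℕ.< a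
≤ᵇ-false {a} {b} e = ℕ.≰⇒> λ p → contradiction (trans (sym e) (Equivalence.to T-≡ (ℕ.≤⇒≤ᵇ p))) λ ()

true-≤ᵇ : ∀ {a b} → a ℕ.≤ b → (a ≤ᵇ b) ≡ true
true-≤ᵇ = Equivalence.to T-≡ ∘ ℕ.≤⇒≤ᵇ

false-≤ᵇ : ∀ {a b} → b ℕ.< a → (a ≤ᵇ b) ≡ false
false-≤ᵇ {a} {b} p with a ≤ᵇ b in e
... | false = refl
... | true  = contradiction (≤ᵇ-true {a} e) (ℕ.<⇒≱ p)

≡ᵇ-true : ∀ {a b} → (a ≡ᵇ b) ≡ true → a ≡ b
≡ᵇ-true {a} {b} = ℕ.≡ᵇ⇒≡ a b ∘ ≡true⇒T

true-≡ᵇ : ∀ {a b} → a ≡ b → (a ≡ᵇ b) ≡ true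
true-≡ᵇ {a} {b} = Equivalence.to T-≡ ∘ ℕ.≡⇒≡ᵇ a b

false-≡ᵇ : ∀ {a b} → a ≢ b → (a ≡ᵇ b) ≡ false
false-≡ᵇ {a} {b} p with a ≡ᵇ b in e
... | false = refl
... | true  = contradiction (≡ᵇ-true e) p

≡ᵇ-false : ∀ {a b} → (a ≡ᵇ b) ≡ false → a ≢ b
≡ᵇ-false e p = contradiction (trans (sym e) (true-≡ᵇ p)) λ ()

at-same : ∀ {a} {A : Set a} i {x y : A} → (if i ≡ᵇ i then x else y) ≡ x
at-same i {x} {y} = cong (if_then x else y) (true-≡ᵇ {i} refl)

at-other : ∀ {a} {A : Set a} {i j} {x y : A} → i ≢ j → (if i ≡ᵇ j then x else y) ≡ y
at-other {x = x} {y} p = cong (if_then x else y) (false-≡ᵇ p)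

double-or-suc : ∀ i → i ≡ ⌊ i /2⌋ ℕ.+ ⌊ i /2⌋ ⊎ i ≡ ⌊ i /2⌋ ℕ.+ ⌊ i /2⌋ ℕ.+ 1
double-or-suc zero = inj₁ refl
double-or-suc (suc zero) = inj₂ refl
double-or-suc (suc (suc i)) = Sum.map
  (λ e → cong suc (trans (cong suc e) (sym (ℕ.+-suc h h))))
  (λ e → cong suc (trans (cong suc e) (cong (ℕ._+ 1) (sym (ℕ.+-suc h h))))) (double-or-suc i)
  where h = ⌊ i /2⌋

⌊i+i/2⌋ : ∀ i → ⌊ i ℕ.+ i /2⌋ ≡ i
⌊i+i/2⌋ i = sym (ℕ.n≡⌊n+n/2⌋ i)

⌊i+i+1/2⌋ : ∀ i → ⌊ i ℕ.+ i ℕ.+ 1 /2⌋ ≡ i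
⌊i+i+1/2⌋ i = trans (cong ⌊_/2⌋ (ℕ.+-comm (i ℕ.+ i) 1)) (sym (ℕ.n≡⌈n+n/2⌉ i))

n<2^[1+log] : ∀ n → n ℕ.< 2 ^ suc ⌊log₂ n ⌋
n<2^[1+log] n = ℕ.≰⇒> λ p → ℕ.1+n≰n (ℕ.≤-trans (ℕ.≤-reflexive (sym (⌊log₂[2^n]⌋≡n _))) (⌊log₂⌋-mono-≤ p))

half<2^ : ∀ {i h} → i ℕ.< 2 ^ suc h → ⌊ i /2⌋ ℕ.< 2 ^ h
half<2^ {i} {h} p = ℕ.≰⇒> λ q → ℕ.<⇒≱ p (ℕ.≤-trans
  (ℕ.≤-trans (ℕ.≤-reflexive (cong (2 ^ h ℕ.+_) (ℕ.+-identityʳ _))) (ℕ.+-mono-≤ q q)) double≤)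
  where
  double≤ : ⌊ i /2⌋ ℕ.+ ⌊ i /2⌋ ℕ.≤ i
  double≤ with double-or-suc i
  ... | inj₁ e = ℕ.≤-reflexive (sym e)
  ... | inj₂ e = ℕ.≤-trans (ℕ.m≤m+n _ 1) (ℕ.≤-reflexive (sym e))

-- The tournament tree as a priority queue.

module Tournament {c ℓ} (R : OrderedField c ℓ) where
  open FieldProperties R
  open Hoare R
  open Program

  record Node (key : ℕ → Carrier) (top : ℕ → ℕ) (i : ℕ) : Set (c ⊔ ℓ) where
    field
      child  : (key i ≡ key (i ℕ.+ i) × top i ≡ top (i ℕ.+ i)) ⊎
               (key i ≡ key (i ℕ.+ i ℕ.+ 1) × top i ≡ top (i ℕ.+ i ℕ.+ 1))
      ≤left  : key i ≤ key (i ℕ.+ i)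
      ≤right : key i ≤ key (i ℕ.+ i ℕ.+ 1)
  open Node

  Node-cong : ∀ {key key′ top top′ i} →
    (∀ j → j ≡ i ⊎ ⌊ j /2⌋ ≡ i → key′ j ≡ key j × top′ j ≡ top j) →
    Node key top i → Node key′ top′ i
  Node-cong {key} {key′} {top} {top′} {i} eq nd = record
    { child = Sum.map
        (λ (a , b) → trans (k i self) (trans a (sym (k _ l))) , trans (t i self) (trans b (sym (t _ l))))
        (λ (a , b) → trans (k i self) (trans a (sym (k _ r))) , trans (t i self) (trans b (sym (t _ r))))
        (child nd)
    ; ≤left  = ≤-resp₂ (sym (k i self)) (sym (k _ l)) (≤left nd)
    ; ≤right = ≤-resp₂ (sym (k i self)) (sym (k _ r)) (≤right nd) }
    where
    self = inj₁ refl
    l = inj₂ (⌊i+i/2⌋ i)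
    r = inj₂ (⌊i+i+1/2⌋ i)
    k = λ j p → proj₁ (eq j p)
    t = λ j p → proj₂ (eq j p)

  record Tree (n : ℕ) (key : ℕ → Carrier) (top : ℕ → ℕ) : Set (c ⊔ ℓ) where
    field
      node : ∀ i → 1 ℕ.≤ i → i ℕ.< n → Node key top i
      leaf : ∀ v → v ℕ.< n → top (n ℕ.+ v) ≡ v

    root-min : ∀ i → 1 ℕ.≤ i → i ℕ.< n ℕ.+ n → key 1 ≤ key i
    root-min i = go i i ℕ.≤-refl
      where
      go : ∀ b i → i ℕ.≤ b → 1 ℕ.≤ i → i ℕ.< n ℕ.+ n → key 1 ≤ key i
      go _ (suc zero) _ _ _ = ≤-refl
      go (suc b) (suc (suc i)) (s≤s i<b) _ i<2n = ≤-trans (go b h h≤b (s≤s z≤n) (ℕ.<-trans h<i i<2n)) step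
        where
        h = ⌊ suc (suc i) /2⌋
        h<i : h ℕ.< suc (suc i)
        h<i = ℕ.⌊n/2⌋<n (suc i)
        h≤b : h ℕ.≤ b
        h≤b = ℕ.≤-trans (ℕ.s≤s⁻¹ h<i) i<b
        h+h≤ : h ℕ.+ h ℕ.≤ suc (suc i)
        h+h≤ with double-or-suc (suc (suc i))
        ... | inj₁ e = ℕ.≤-reflexive (sym e)
        ... | inj₂ e = ℕ.≤-trans (ℕ.m≤m+n _ 1) (ℕ.≤-reflexive (sym e))
        h<n : h ℕ.< n
        h<n = ℕ.≰⇒> λ p → ℕ.<⇒≱ i<2n (ℕ.≤-trans (ℕ.+-mono-≤ p p) h+h≤)
        nd = node h (s≤s z≤n) h<n
        step : key h ≤ key (suc (suc i))
        step with double-or-suc (suc (suc i))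
        ... | inj₁ e = ≤-resp₂ refl (cong key (sym e)) (≤left nd)
        ... | inj₂ e = ≤-resp₂ refl (cong key (sym e)) (≤right nd)

    -- Follows the winning child downwards. Each step raises the index, so fuel d with 2n ≤ i + d
    -- lasts until a leaf is reached.
    root-leaf : 1 ℕ.≤ n → top 1 ℕ.< n × key (n ℕ.+ top 1) ≡ key 1
    root-leaf 1≤n = go (n ℕ.+ n) 1 (s≤s z≤n) (ℕ.+-mono-≤ 1≤n 1≤n) (ℕ.n≤1+n _)
      where
      go : ∀ d i → 1 ℕ.≤ i → i ℕ.< n ℕ.+ n → n ℕ.+ n ℕ.≤ i ℕ.+ d → top i ℕ.< n × key (n ℕ.+ top i) ≡ key i
      go zero i _ i<2n le = contradiction (ℕ.≤-trans le (ℕ.≤-reflexive (ℕ.+-identityʳ i))) (ℕ.<⇒≱ i<2n)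
      go (suc d) i 1≤i i<2n le with i ℕ.<? n
      ... | no i≮n with v , refl ← ℕ.m≤n⇒∃[o]m+o≡n (ℕ.≮⇒≥ i≮n)
              with v<n ← ℕ.+-cancelˡ-< n v n i<2n rewrite leaf v v<n = v<n , refl
      ... | yes i<n with child (node i 1≤i i<n)
      ...   | inj₁ (a , b) rewrite a | b = go d (i ℕ.+ i) (ℕ.≤-trans 1≤i (ℕ.m≤m+n i i))
                (ℕ.+-mono-< i<n i<n) (ℕ.≤-trans le (ℕ.≤-trans (ℕ.≤-reflexive (ℕ.+-suc i d)) (ℕ.+-monoˡ-≤ d (ℕ.m<m+n i 1≤i))))
      ...   | inj₂ (a , b) rewrite a | b = go d (i ℕ.+ i ℕ.+ 1) (ℕ.m≤n+m 1 (i ℕ.+ i))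
                (ℕ.≤-trans (ℕ.≤-reflexive (trans (cong suc (ℕ.+-comm (i ℕ.+ i) 1)) (cong suc (sym (ℕ.+-suc i i))))) (ℕ.+-mono-≤ i<n i<n))
                (ℕ.≤-trans le (ℕ.≤-trans (ℕ.≤-reflexive (ℕ.+-suc i d)) (ℕ.+-monoˡ-≤ d
                  (ℕ.≤-trans (ℕ.m<m+n i 1≤i) (ℕ.m≤m+n _ 1)))))

  key-of : State R → ℕ → Carrier
  key-of σ = scalars σ KEY

  top-of : State R → ℕ → ℕ
  top-of σ = nats σ TOP

  i≢i+i : ∀ {i} → 1 ℕ.≤ i → i ≢ i ℕ.+ i
  i≢i+i {i} 1≤i = ℕ.<⇒≢ (ℕ.m<m+n i 1≤i)

  i≢i+i+1 : ∀ {i} → i ≢ i ℕ.+ i ℕ.+ 1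
  i≢i+i+1 {i} = ℕ.<⇒≢ (ℕ.≤-trans (s≤s (ℕ.m≤m+n i i)) (ℕ.≤-reflexive (ℕ.+-comm 1 (i ℕ.+ i))))

  record Pulled (i : ℕ) (σ τ : State R) : Set (c ⊔ ℓ) where
    field
      pulled     : Node (key-of τ) (top-of τ) i
      other-key  : ∀ j → j ≢ i → key-of τ j ≡ key-of σ j
      other-top  : ∀ j → j ≢ i → top-of τ j ≡ top-of σ j
      same-index : nats τ I 0 ≡ i
  open Pulled

  private
    Pulled-from : ∀ {i key top σ τ} → 1 ℕ.≤ i → nats τ I 0 ≡ i →
      (∀ j → key-of τ j ≡ (if i ≡ᵇ j then key else key-of σ j)) →
      (∀ j → top-of τ j ≡ (if i ≡ᵇ j then top else top-of σ j)) →
      (key ≡ key-of σ (i ℕ.+ i) × top ≡ top-of σ (i ℕ.+ i)) ⊎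
      (key ≡ key-of σ (i ℕ.+ i ℕ.+ 1) × top ≡ top-of σ (i ℕ.+ i ℕ.+ 1)) →
      key ≤ key-of σ (i ℕ.+ i) → key ≤ key-of σ (i ℕ.+ i ℕ.+ 1) → Pulled i σ τ
    Pulled-from {i} 1≤i I≡ ks ts ch l r = record
      { pulled = record
          { child = Sum.map
              (λ (a , b) → trans k (trans a (sym (k′ _ (i≢i+i 1≤i)))) , trans t (trans b (sym (t′ _ (i≢i+i 1≤i)))))
              (λ (a , b) → trans k (trans a (sym (k′ _ i≢i+i+1))) , trans t (trans b (sym (t′ _ i≢i+i+1)))) ch
          ; ≤left = ≤-resp₂ (sym k) (sym (k′ _ (i≢i+i 1≤i))) l
          ; ≤right = ≤-resp₂ (sym k) (sym (k′ _ i≢i+i+1)) r }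
      ; other-key = λ j p → k′ j (p ∘ sym)
      ; other-top = λ j p → t′ j (p ∘ sym)
      ; same-index = I≡ }
      where
      k = trans (ks i) (at-same i)
      t = trans (ts i) (at-same i)
      k′ = λ j (p : i ≢ j) → trans (ks j) (at-other p)
      t′ = λ j (p : i ≢ j) → trans (ts j) (at-other p)

  Runs-pull : ∀ {σ i} → nats σ I 0 ≡ i → 1 ℕ.≤ i → Runs pull σ (time pull) (Pulled i σ)
  Runs-pull {σ} {i} refl 1≤i = Runs-if
    (λ e → let le = does-true (_ ≤? _) e in
      Runs-straight (set TOP (var I) (get TOP left) ⨾ setᵣ KEY (var I) (getᵣ KEY left)) refl
        (Pulled-from 1≤i refl (λ _ → refl) (λ _ → refl) (inj₁ (refl , refl)) ≤-refl le))
    (λ e → let ge = ≰⇒≥ (does-false (_ ≤? _) e) in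
      Runs-straight (set TOP (var I) (get TOP right) ⨾ setᵣ KEY (var I) (getᵣ KEY right)) refl
        (Pulled-from 1≤i refl (λ _ → refl) (λ _ → refl) (inj₂ (refl , refl)) ge ≤-refl))

  -- A tree with a hole at node i, the only match that may be out of date. A `pull` at the hole
  -- moves it to the parent, and a hole at 0 is no hole at all.
  record TreeBut (n i : ℕ) (key : ℕ → Carrier) (top : ℕ → ℕ) : Set (c ⊔ ℓ) where
    field
      i<n  : i ℕ.< n
      node : ∀ j → 1 ℕ.≤ j → j ℕ.< n → j ≢ i → Node key top j
      leaf : ∀ v → v ℕ.< n → top (n ℕ.+ v) ≡ v

  TreeBut-zero : ∀ {n key top} → TreeBut n 0 key top → Tree n key top
  TreeBut-zero t = record { node = λ { (suc i) p q → TreeBut.node t (suc i) p q λ () } ; leaf = TreeBut.leaf t }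

  Pulled-TreeBut : ∀ {n i σ τ} → Pulled i σ τ → TreeBut n i (key-of σ) (top-of σ) →
                   TreeBut n ⌊ i /2⌋ (key-of τ) (top-of τ)
  Pulled-TreeBut {n} {i} p t = record
    { i<n = ℕ.≤-<-trans (ℕ.⌊n/2⌋≤n i) (TreeBut.i<n t)
    ; node = node′
    ; leaf = λ v v<n → trans (other-top p _ (λ e → ℕ.<⇒≱ (TreeBut.i<n t) (ℕ.≤-trans (ℕ.m≤m+n n v) (ℕ.≤-reflexive e)))) (TreeBut.leaf t v v<n) }
    where
    node′ : ∀ j → 1 ℕ.≤ j → j ℕ.< n → j ≢ ⌊ i /2⌋ → Node _ _ j
    node′ j 1≤j j<n j≢ with j ℕ.≟ i
    ... | yes refl = pulled p
    ... | no j≢i = Node-cong (λ j′ near → other-key p j′ (off near) , other-top p j′ (off near)) (TreeBut.node t j 1≤j j<n j≢i)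
      where
      off : ∀ {j′} → j′ ≡ j ⊎ ⌊ j′ /2⌋ ≡ j → j′ ≢ i
      off (inj₁ refl) = j≢i
      off (inj₂ e) refl = j≢ (sym e)

  sift-step : ℕ
  sift-step = suc (costᵇ (lit 1 ≤ₙ var I)) ℕ.+ (time pull ℕ.+ time (I ≔ get PAR (var I)))

  sift-time : ℕ → ℕ
  sift-time L = time (I ≔ get PAR (N ⊕ var V)) ℕ.+ (suc L ℕ.* sift-step ℕ.+ suc (costᵇ (lit 1 ≤ₙ var I)))

  record Sifted (n : ℕ) (σ τ : State R) : Set (c ⊔ ℓ) where
    field
      tree   : Tree n (key-of τ) (top-of τ)
      leaves : ∀ j → n ℕ.≤ j → key-of τ j ≡ key-of σ j

  Parents : ℕ → (ℕ → ℕ) → Set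
  Parents n par = ∀ i → i ℕ.< n ℕ.+ n → par i ≡ ⌊ i /2⌋

  -- With h rounds left the hole is below 2 ^ h, and moving to the parent halves it. Initially it is
  -- below n, so h = 1 + ⌊log₂ n⌋ suffices.
  Runs-sift : ∀ {σ n v} → nats σ 0 0 ≡ n → nats σ V 0 ≡ v → v ℕ.< n → Parents n (nats σ PAR) →
    TreeBut n ⌊ n ℕ.+ v /2⌋ (key-of σ) (top-of σ) → Runs sift σ (sift-time ⌊log₂ n ⌋) (Sifted n σ)
  Runs-sift {σ} {n} {v} refl refl v<n par t = Runs-seq {Φ = λ τ → τ ≡ exec (I ≔ get PAR (N ⊕ var V)) σ}
    (Runs-straight (I ≔ get PAR (N ⊕ var V)) refl refl)
    λ { _ refl → Runs-mono ℕ.≤-refl (λ _ → proj₂) (Spends⇒Runs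
      (Spends-while Inv last-test ℕ.≤-refl step (λ k σ i e → exit k σ i e) _
        (suc ⌊log₂ n ⌋ , _ , refl , par-v , ℕ.<-trans (TreeBut.i<n t) (n<2^[1+log] n) , t , refl , λ _ _ → refl))) }
    where
    par-v : nats σ PAR (n ℕ.+ v) ≡ ⌊ n ℕ.+ v /2⌋
    par-v = par _ (ℕ.+-monoʳ-< n v<n)
    last-test = suc (costᵇ (lit 1 ≤ₙ var I))
    Inv : ℕ → State R → Set _
    Inv k τ = ∃[ h ] ∃[ i ] k ≡ h ℕ.* sift-step ℕ.+ last-test × nats τ I 0 ≡ i × i ℕ.< 2 ^ h ×
      TreeBut n i (key-of τ) (top-of τ) × nats τ PAR ≡ nats σ PAR × (∀ j → n ℕ.≤ j → key-of τ j ≡ key-of σ j)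
    exit : ∀ k τ → Inv k τ → evalᵇ R τ (lit 1 ≤ₙ var I) ≡ false →
           ∃[ k₀ ] last-test ℕ.+ k₀ ℕ.≤ k × Sifted n σ τ
    exit k τ (h , i , refl , refl , _ , t , _ , ls) e = 0 ,
      ℕ.≤-trans (ℕ.≤-reflexive (ℕ.+-identityʳ last-test)) (ℕ.m≤n+m last-test (h ℕ.* sift-step)) ,
      record { tree = TreeBut-zero (subst (λ i → TreeBut n i (key-of τ) (top-of τ)) (ℕ.n<1⇒n≡0 (≤ᵇ-false {1} e)) t) ; leaves = ls }
    step : ∀ k τ → Inv k τ → evalᵇ R τ (lit 1 ≤ₙ var I) ≡ true →
           ∃[ k₀ ] last-test ℕ.+ k₀ ℕ.≤ k × Spends (pull ⨾ I ≔ get PAR (var I)) τ k₀ Inv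
    step k τ (zero , i , refl , refl , i<1 , _) e = contradiction (≤ᵇ-true {1} e) (ℕ.<⇒≱ i<1)
    step k τ (suc h , i , refl , refl , i<2^ , t , par≡ , ls) e =
      _ , ℕ.≤-reflexive (trans (sym (ℕ.+-assoc last-test body k₁)) (sym (ℕ.+-assoc sift-step (h ℕ.* sift-step) last-test))) ,
      Spends-mono ℕ.≤-refl (λ { _ _ (refl , r) → r }) (Runs⇒Spends k₁
        (Runs-seq (Runs-frame (Runs-pull {τ} refl 1≤i)) λ υ (p , fr) →
          Runs-straight (I ≔ get PAR (var I)) refl
            (h , ⌊ i /2⌋ , refl ,
             trans (cong₂ (λ f j → f j) (trans (same-nats fr PAR refl) par≡) (same-index p))
               (par i (ℕ.<-≤-trans (TreeBut.i<n t) (ℕ.m≤m+n n n))) ,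
             half<2^ {i} {h} i<2^ , Pulled-TreeBut p t , trans (same-nats fr PAR refl) par≡ ,
             λ j n≤j → trans (other-key p j (λ e → ℕ.<⇒≱ (TreeBut.i<n t) (ℕ.≤-trans n≤j (ℕ.≤-reflexive e)))) (ls j n≤j))))
      where
      k₁ = h ℕ.* sift-step ℕ.+ last-test
      body = time pull ℕ.+ time (I ≔ get PAR (var I))
      1≤i : 1 ℕ.≤ i
      1≤i = ≤ᵇ-true {1} e

-- The invariant of the search, stated apart from machine states.

module Dijkstra {c ℓ} (R : OrderedField c ℓ) (ins : NodeMC R) (x : Fin (NodeMC.n ins) → OrderedField.Carrier R)
                (feasible : NodeMC.Feasible ins x) where
  open FieldProperties R
  open NodeMC ins
  open Feasible feasible
  open Rounding R ins x feasible

  private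
    𝟎 : ∀ {m} → Polynomial m
    𝟎 = con (ℤ.+ 0)

  record Arrays : Set c where
    field
      disc lab      : Fin n → ℕ
      A D key       : Fin n → Carrier
      cur W best θ  : Carrier
  open Arrays

  -- disc is 0 for undiscovered, 1 for queued and 2 for settled vertices.  Vertices that
  -- are not queued carry the key 1, which is too large to be extracted.  The neighbours
  -- of u₀ in l are still to be visited.
  data Vertex (q : ℕ) (a : Arrays) (u₀ : Fin n) (l : List (Fin n)) (v : Fin n) : Set (c ⊔ ℓ) where
    undiscovered : disc a v ≡ 0 → key a v ≡ 1# → Unfound (A a v) (D a v) (lab a v) → Vertex q a u₀ l v
    queued : disc a v ≡ 1 → key a v ≡ D a v → cur a ≤ D a v → A a v ≤ cur a →
             Found q (A a v) (D a v) (lab a v) v → Vertex q a u₀ l v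
    settled : disc a v ≡ 2 → key a v ≡ 1# → D a v ≤ cur a → Found q (A a v) (D a v) (lab a v) v →
              (∀ u → Adj v u → (v ≡ u₀ × u ∈ l) ⊎ A a u ≤ D a v) → Vertex q a u₀ l v

  inCutᵇ : (A D : Fin n → Carrier) → Carrier → Fin n → Bool
  inCutᵇ A D θ v = does (A v ≤? θ) ∧ not (does (D v ≤? θ))

  frontier : (Fin n → ℕ) → Carrier
  frontier disc = ∑ λ v → if disc v ≡ᵇ 1 then w v else 0#

  swept : (A D : Fin n → Carrier) → Carrier → Carrier
  swept A D t = ∑ λ v → w v * ((D v ⊓ t) - (A v ⊓ t))

  -- swept A D t is the integral of the weight of the cut over the thresholds in [0 , t).
  record Best (A D : Fin n → Carrier) (best θ t : Carrier) : Set (c ⊔ ℓ) where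
    field
      0≤θ      : 0# ≤ θ
      θ<t      : ¬ t ≤ θ
      best≡    : best ≡ ∑ (λ v → if inCutᵇ A D θ v then w v else 0#)
      average  : best * t ≤ swept A D t

  -- While cur = 0, no interval of positive length has been swept, and `best` and `θ` are
  -- placeholders; hence the first alternative of `record-best`.
  record Inv (q : ℕ) (a : Arrays) (u₀ : Fin n) (l : List (Fin n)) : Set (c ⊔ ℓ) where
    field
      0≤cur    : 0# ≤ cur a
      cur<½    : ¬ ½ ≤ cur a
      vertex   : ∀ v → Vertex q a u₀ l v
      W≡       : W a ≡ frontier (disc a)
      record-best : cur a ≤ 0# ⊎ Best (A a) (D a) (best a) (θ a) (cur a)

    A≤D : ∀ v → A a v ≤ D a v
    A≤D v with vertex v
    ... | undiscovered _ _ u  = ≤-reflexive (trans (Unfound.A≡1 u) (sym (Unfound.D≡1 u)))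
    ... | queued _ _ _ _ f    = Found.A≤D f
    ... | settled _ _ _ f _   = Found.A≤D f

    cur≤1 : cur a ≤ 1#
    cur≤1 = ≤-trans (≰⇒≥ cur<½) ½≤1

  open Inv

  inCutᵇ-A> : ∀ A D {θ} v → ¬ A v ≤ θ → inCutᵇ A D θ v ≡ false
  inCutᵇ-A> A D {θ} v p = cong (_∧ not (does (D v ≤? θ))) (dec-false (A v ≤? θ) p)

  inCutᵇ-D≤ : ∀ A D {θ} v → D v ≤ θ → inCutᵇ A D θ v ≡ false
  inCutᵇ-D≤ A D {θ} v p with does (A v ≤? θ)
  ... | false = refl
  ... | true  = cong not (dec-true (D v ≤? θ) p)

  inCutᵇ-between : ∀ A D {θ} v → A v ≤ θ → ¬ D v ≤ θ → inCutᵇ A D θ v ≡ true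
  inCutᵇ-between A D {θ} v p q = cong₂ (λ a d → a ∧ not d) (dec-true (A v ≤? θ) p) (dec-false (D v ≤? θ) q)

  -- At cur = 0 the frontier is recorded unconditionally, which replaces the placeholder; later the
  -- lighter of the two candidates is kept.
  record KeptBest (a : Arrays) (best′ θ′ : Carrier) : Set (c ⊔ ℓ) where
    constructor kept
    field choice : (¬ cur a ≤ 0# × best a ≤ W a × best′ ≡ best a × θ′ ≡ θ a) ⊎
                   ((cur a ≤ 0# ⊎ W a ≤ best a) × best′ ≡ W a × θ′ ≡ cur a)

  module _ {q a u₀ l} (inv : Inv q a u₀ l) where

    swept-nonneg : ∀ t → 0# ≤ swept (A a) (D a) t
    swept-nonneg t = ≤-trans (≤-reflexive (sym (∑-zero n)))
      (∑-mono-≤ λ v → *-nonNegative (w-nonneg v) (diff-nonneg (⊓-monoˡ-≤ t (A≤D inv v))))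

    module _ {κ : Carrier} (cur<κ : ¬ κ ≤ cur a) (κ≤½ : κ ≤ ½) (κ-min : ∀ v → disc a v ≡ 1 → κ ≤ D a v) where
      private
        cur≤κ : cur a ≤ κ
        cur≤κ = ≰⇒≥ cur<κ
        Δ = κ - cur a

      -- Between cur and κ only queued vertices contribute, each its weight times Δ. Settled
      -- intervals end by cur, and those of undiscovered vertices are empty.
      swept-advance : swept (A a) (D a) κ ≡ swept (A a) (D a) (cur a) + W a * Δ
      swept-advance = trans (∑-cong pointwise)
        (trans (∑-+ (λ v → w v * ((D a v ⊓ cur a) - (A a v ⊓ cur a))) (λ v → Δ * (if disc a v ≡ᵇ 1 then w v else 0#)))
          (cong (swept (A a) (D a) (cur a) +_)
            (trans (∑-*ˡ Δ (λ v → if disc a v ≡ᵇ 1 then w v else 0#)) (trans (*-comm Δ _) (cong (_* Δ) (sym (W≡ inv)))))))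
        where
        keep : ∀ v → (disc a v ≡ᵇ 1) ≡ false → D a v ⊓ κ ≡ A a v ⊓ κ + ((D a v ⊓ cur a) - (A a v ⊓ cur a)) →
          w v * ((D a v ⊓ κ) - (A a v ⊓ κ)) ≡
          w v * ((D a v ⊓ cur a) - (A a v ⊓ cur a)) + Δ * (if disc a v ≡ᵇ 1 then w v else 0#)
        keep v e eq rewrite e = trans (cong (λ z → w v * (z - (A a v ⊓ κ))) eq)
          (solve 4 (λ w′ a d δ → w′ :* (a :+ d :- a) := w′ :* d :+ δ :* 𝟎) refl (w v) (A a v ⊓ κ) _ Δ)
        pointwise : ∀ v → w v * ((D a v ⊓ κ) - (A a v ⊓ κ)) ≡
          w v * ((D a v ⊓ cur a) - (A a v ⊓ cur a)) + Δ * (if disc a v ≡ᵇ 1 then w v else 0#)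
        pointwise v with vertex inv v
        ... | undiscovered e _ u = keep v (cong (_≡ᵇ 1) e)
              (trans (cong (_⊓ κ) D≡A) (trans (sym (+-identityʳ _)) (cong (A a v ⊓ κ +_)
                (sym (trans (cong (λ z → (z ⊓ cur a) - (A a v ⊓ cur a)) D≡A) (-‿inverseʳ _))))))
              where
              D≡A : D a v ≡ A a v
              D≡A = trans (Unfound.D≡1 u) (sym (Unfound.A≡1 u))
        ... | settled e _ D≤cur f _ = keep v (cong (_≡ᵇ 1) e)
              (trans (x≤y⇒x⊓y≈x (≤-trans D≤cur cur≤κ))
              (trans (solve 2 (λ d a → d := a :+ (d :- a)) refl (D a v) (A a v))
                (sym (cong₂ _+_ (x≤y⇒x⊓y≈x (≤-trans A≤cur cur≤κ))
                  (cong₂ _-_ (x≤y⇒x⊓y≈x D≤cur) (x≤y⇒x⊓y≈x A≤cur))))))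
              where
              A≤cur = ≤-trans (Found.A≤D f) D≤cur
        ... | queued e _ cur≤D A≤cur f rewrite cong (_≡ᵇ 1) e =
              trans (cong (w v *_) (cong₂ _-_ (x≤y⇒y⊓x≈x (κ-min v e)) (x≤y⇒x⊓y≈x (≤-trans A≤cur cur≤κ))))
              (trans (solve 4 (λ w′ κ a c → w′ :* (κ :- a) := w′ :* (c :- a) :+ (κ :- c) :* w′) refl
                       (w v) κ (A a v) (cur a))
                (sym (cong (λ z → w v * z + Δ * w v)
                  (cong₂ _-_ (x≤y⇒y⊓x≈x cur≤D) (x≤y⇒x⊓y≈x A≤cur)))))

      -- The strict inequality cur < κ matters: a queued vertex with D = cur would count in the
      -- frontier without belonging to the cut at threshold cur.
      frontier-cut : W a ≡ ∑ (λ v → if inCutᵇ (A a) (D a) (cur a) v then w v else 0#)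
      frontier-cut = trans (W≡ inv) (∑-cong λ v → cong (if_then w v else 0#) (agree v))
        where
        agree : ∀ v → (disc a v ≡ᵇ 1) ≡ inCutᵇ (A a) (D a) (cur a) v
        agree v with vertex inv v
        ... | undiscovered e _ u = trans (cong (_≡ᵇ 1) e) (sym (inCutᵇ-A> (A a) (D a) v
                λ p → cur<½ inv (≤-trans ½≤1 (≤-resp₂ (Unfound.A≡1 u) refl p))))
        ... | settled e _ D≤cur f _ = trans (cong (_≡ᵇ 1) e) (sym (inCutᵇ-D≤ (A a) (D a) v D≤cur))
        ... | queued e _ cur≤D A≤cur f = trans (cong (_≡ᵇ 1) e)
                (sym (inCutᵇ-between (A a) (D a) v A≤cur λ p → cur<κ (≤-trans (κ-min v e) p)))

      -- The product best′ * κ splits at cur. If the old value is kept, its part up to cur is the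
      -- old average bound and the rest follows from best ≤ W. If W replaces it, the rest is exact
      -- and W ≤ best bounds the first part, or that part is zero.
      best-advance : ∀ {best′ θ′} → KeptBest a best′ θ′ → Best (A a) (D a) best′ θ′ κ
      best-advance (kept (inj₁ (0<cur , best≤W , refl , refl))) with record-best inv
      ... | inj₁ cur≤0 = contradiction cur≤0 0<cur
      ... | inj₂ b = record
        { 0≤θ = Best.0≤θ b
        ; θ<t = λ p → Best.θ<t b (≤-trans cur≤κ p)
        ; best≡ = Best.best≡ b
        ; average = ≤-trans (≤-reflexive (solve 3 (λ b κ c → b :* κ := b :* c :+ (κ :- c) :* b) refl (best a) κ (cur a)))
            (≤-trans (+-mono-≤ (Best.average b) (≤-trans (*-monoˡ-≤ (diff-nonneg cur≤κ) best≤W) (≤-reflexive (*-comm Δ (W a)))))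
              (≤-reflexive (sym swept-advance))) }
      best-advance (kept (inj₂ (cond , refl , refl))) = record
        { 0≤θ = 0≤cur inv
        ; θ<t = cur<κ
        ; best≡ = frontier-cut
        ; average = ≤-trans (≤-reflexive (solve 3 (λ b κ c → b :* κ := b :* c :+ b :* (κ :- c)) refl (W a) κ (cur a)))
            (≤-trans (+-mono-≤ (so-far cond (record-best inv)) ≤-refl) (≤-reflexive (sym swept-advance))) }
        where
        at-0 : cur a ≤ 0# → W a * cur a ≤ swept (A a) (D a) (cur a)
        at-0 cur≤0 = ≤-trans (≤-reflexive (trans (cong (W a *_) (≤-antisym cur≤0 (0≤cur inv))) (zeroʳ _))) (swept-nonneg (cur a))
        so-far : cur a ≤ 0# ⊎ W a ≤ best a → cur a ≤ 0# ⊎ Best (A a) (D a) (best a) (θ a) (cur a) →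
                 W a * cur a ≤ swept (A a) (D a) (cur a)
        so-far (inj₁ z) _ = at-0 z
        so-far (inj₂ _) (inj₁ z) = at-0 z
        so-far (inj₂ W≤best) (inj₂ b) = ≤-trans (≤-resp₂ (*-comm _ _) (*-comm _ _) (*-monoˡ-≤ (0≤cur inv) W≤best)) (Best.average b)

      Inv-advance : ∀ {best′ θ′} → ¬ ½ ≤ κ → KeptBest a best′ θ′ →
                    Inv q (record a { cur = κ ; best = best′ ; θ = θ′ }) u₀ l
      Inv-advance κ<½ choice = record
        { 0≤cur = ≤-trans (0≤cur inv) cur≤κ
        ; cur<½ = κ<½
        ; vertex = λ v → vertex′ v (vertex inv v)
        ; W≡ = W≡ inv
        ; record-best = inj₂ (best-advance choice) }
        where
        vertex′ : ∀ v → Vertex q a u₀ l v → Vertex q _ u₀ l v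
        vertex′ v (undiscovered e k u) = undiscovered e k u
        vertex′ v (queued e k _ A≤ f) = queued e k (κ-min v e) (≤-trans A≤ cur≤κ) f
        vertex′ v (settled e k D≤ f cl) = settled e k (≤-trans D≤ cur≤κ) f cl

  record Updated {b} {B : Set b} (f f′ : Fin n → B) (u : Fin n) (y : B) : Set b where
    constructor updated
    field
      new : f′ u ≡ y
      old : ∀ v → v ≢ u → f′ v ≡ f v

  open Updated

  private
    Found-cong : ∀ {q A A′ D D′ lab lab′ v} → A′ ≡ A → D′ ≡ D → lab′ ≡ lab → Found q A D lab v → Found q A′ D′ lab′ v
    Found-cong refl refl refl f = f

    Unfound-cong : ∀ {A A′ D D′ lab lab′} → A′ ≡ A → D′ ≡ D → lab′ ≡ lab → Unfound A D lab → Unfound A′ D′ lab′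
    Unfound-cong refl refl refl f = f

  key<½⇒queued : ∀ {q a u₀ l} → Inv q a u₀ l → ∀ {v} → ¬ ½ ≤ key a v → disc a v ≡ 1 × key a v ≡ D a v
  key<½⇒queued inv {v} p with vertex inv v
  ... | undiscovered _ k _ = contradiction (≤-resp₂ refl (sym k) ½≤1) p
  ... | queued e k _ _ _   = e , k
  ... | settled _ k _ _ _  = contradiction (≤-resp₂ refl (sym k) ½≤1) p

  D<½⇒discovered : ∀ {q a u₀ l} → Inv q a u₀ l → ∀ {v} → ¬ ½ ≤ D a v → disc a v ≢ 0
  D<½⇒discovered inv {v} p e with vertex inv v
  ... | undiscovered _ _ u  = p (≤-resp₂ refl (sym (Unfound.D≡1 u)) ½≤1)
  ... | queued e′ _ _ _ _   = contradiction (trans (sym e) e′) λ ()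
  ... | settled e′ _ _ _ _  = contradiction (trans (sym e) e′) λ ()

  discovered-A≤ : ∀ {q a u₀ l} → Inv q a u₀ l → ∀ {v} → disc a v ≢ 0 → A a v ≤ cur a × 0# ≤ A a v
  discovered-A≤ inv {v} p with vertex inv v
  ... | undiscovered e _ _  = contradiction e p
  ... | queued _ _ _ A≤ f   = A≤ , Found.0≤A f
  ... | settled _ _ D≤ f _  = ≤-trans (Found.A≤D f) D≤ , Found.0≤A f

  discovered-D≡ : ∀ {q a u₀ l} → Inv q a u₀ l → ∀ {v} → disc a v ≢ 0 → Found q (A a v) (D a v) (lab a v) v
  discovered-D≡ inv {v} p with vertex inv v
  ... | undiscovered e _ _  = contradiction e p
  ... | queued _ _ _ A≤ f   = f
  ... | settled _ _ D≤ f _  = f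

  -- A key equal to cur is below ½, so u was queued with D u = cur. Its closure condition is
  -- postponed by declaring all of its neighbours pending in l.
  Inv-settle : ∀ {q a u₀ disc′ key′ W′ u l} → Inv q a u₀ [] → key a u ≡ cur a →
    Updated (disc a) disc′ u 2 → Updated (key a) key′ u 1# → W′ ≡ W a - w u → (∀ v → Adj u v → v ∈ l) →
    Inv q (record a { disc = disc′ ; key = key′ ; W = W′ }) u l
  Inv-settle {q} {a} {u₀} {disc′} {key′} {W′} {u} {l} inv key≡cur ds ks W≡′ nbrs = record
    { 0≤cur = 0≤cur inv ; cur<½ = cur<½ inv
    ; vertex = vertex′
    ; W≡ = trans W≡′ (trans (cong (λ z → z - w u) (W≡ inv)) (sym (∑-update u at-u off-u)))
    ; record-best = record-best inv }
    where
    was-queued = key<½⇒queued inv (λ p → cur<½ inv (≤-trans p (≤-reflexive key≡cur)))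
    at-u : (if disc′ u ≡ᵇ 1 then w u else 0#) ≡ (if disc a u ≡ᵇ 1 then w u else 0#) + - w u
    at-u rewrite new ds | proj₁ was-queued = sym (-‿inverseʳ (w u))
    off-u : ∀ v → v ≢ u → (if disc′ v ≡ᵇ 1 then w v else 0#) ≡ (if disc a v ≡ᵇ 1 then w v else 0#)
    off-u v p = cong (λ d → if d ≡ᵇ 1 then w v else 0#) (old ds v p)
    vertex′ : ∀ v → Vertex q _ u l v
    vertex′ v with v Fin.≟ u | vertex inv v
    ... | yes refl | undiscovered e _ _ = contradiction (trans (sym e) (proj₁ was-queued)) λ ()
    ... | yes refl | settled e _ _ _ _  = contradiction (trans (sym e) (proj₁ was-queued)) λ ()
    ... | yes refl | queued _ k _ _ f   = settled (new ds) (new ks)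
            (≤-reflexive (trans (sym k) key≡cur)) f (λ v u~v → inj₁ (refl , nbrs v u~v))
    ... | no p | undiscovered e k f     = undiscovered (trans (old ds v p) e) (trans (old ks v p) k) f
    ... | no p | queued e k c≤ A≤ f     = queued (trans (old ds v p) e) (trans (old ks v p) k) c≤ A≤ f
    ... | no p | settled e k D≤ f cl    = settled (trans (old ds v p) e) (trans (old ks v p) k) D≤ f
            λ u′ v~u′ → inj₂ (closed (cl u′ v~u′))
            where
            closed : ∀ {u′} → (v ≡ u₀ × u′ ∈ []) ⊎ A a u′ ≤ D a v → A a u′ ≤ D a v
            closed (inj₂ q) = q

  Inv-visited : ∀ {q a u v l} → Inv q a u (v ∷ l) → A a v ≤ D a u → Inv q a u l
  Inv-visited {q} {a} {u} {v} {l} inv A≤ = record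
    { 0≤cur = 0≤cur inv ; cur<½ = cur<½ inv ; vertex = λ v → vertex′ v (vertex inv v)
    ; W≡ = W≡ inv ; record-best = record-best inv }
    where
    strike : ∀ {v′ u′} → (v′ ≡ u × u′ ∈ v ∷ l) ⊎ A a u′ ≤ D a v′ → (v′ ≡ u × u′ ∈ l) ⊎ A a u′ ≤ D a v′
    strike (inj₁ (refl , here refl)) = inj₂ A≤
    strike (inj₁ (refl , there p))   = inj₁ (refl , p)
    strike (inj₂ p)                  = inj₂ p
    vertex′ : ∀ v → Vertex q a u _ v → Vertex q a u l v
    vertex′ v (undiscovered e k u) = undiscovered e k u
    vertex′ v (queued e k c≤ A≤ f) = queued e k c≤ A≤ f
    vertex′ v (settled e k D≤ f cl) = settled e k D≤ f λ u′ v~u′ → strike (cl u′ v~u′)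

  -- The new vertex starts at A = cur, above the recorded θ and at the end of the swept range, so
  -- neither the recorded cut nor the integral up to cur changes. Its A only drops, from 1, so
  -- closure conditions of settled vertices survive.
  Inv-enqueue : ∀ {q a u₀ l disc′ lab′ A′ D′ key′ W′ u} {i : Fin k} {r} → Inv q a u₀ l → disc a u ≡ 0 →
    toℕ i ≢ q → Walk i u r → len∑ r ≡ cur a →
    Updated (disc a) disc′ u 1 → Updated (lab a) lab′ u (toℕ i) → Updated (A a) A′ u (cur a) →
    Updated (D a) D′ u (cur a + x u) → Updated (key a) key′ u (cur a + x u) → W′ ≡ W a + w u →
    Inv q (record a { disc = disc′ ; lab = lab′ ; A = A′ ; D = D′ ; key = key′ ; W = W′ }) u₀ l
  Inv-enqueue {q} {a} {u₀} {l} {disc′} {lab′} {A′} {D′} {key′} {W′} {u} {i} {r} inv du i≢q walk len≡ ds ls as Ds ks W≡′ = record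
    { 0≤cur = 0≤cur inv ; cur<½ = cur<½ inv
    ; vertex = vertex′
    ; W≡ = trans W≡′ (trans (cong (_+ w u) (W≡ inv)) (sym (∑-update u at-u off-u)))
    ; record-best = Sum.map₂ best′ (record-best inv) }
    where
    was-unfound : Unfound (A a u) (D a u) (lab a u)
    was-unfound with vertex inv u
    ... | undiscovered _ _ f  = f
    ... | queued e _ _ _ _    = contradiction (trans (sym du) e) λ ()
    ... | settled e _ _ _ _   = contradiction (trans (sym du) e) λ ()
    at-u : (if disc′ u ≡ᵇ 1 then w u else 0#) ≡ (if disc a u ≡ᵇ 1 then w u else 0#) + w u
    at-u rewrite new ds | du = sym (+-identityˡ (w u))
    off-u : ∀ v → v ≢ u → (if disc′ v ≡ᵇ 1 then w v else 0#) ≡ (if disc a v ≡ᵇ 1 then w v else 0#)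
    off-u v p = cong (λ d → if d ≡ᵇ 1 then w v else 0#) (old ds v p)
    A′≤A : ∀ v → A′ v ≤ A a v
    A′≤A v with v Fin.≟ u
    ... | yes refl = ≤-resp₂ (sym (new as)) (sym (Unfound.A≡1 was-unfound)) (cur≤1 inv)
    ... | no p     = ≤-reflexive (old as v p)
    cur≤D′ : cur a ≤ D′ u
    cur≤D′ = ≤-by (nonneg u) (trans (cong (λ z → z - cur a) (new Ds)) (solve 2 (λ c y → c :+ y :- c := y) refl (cur a) (x u)))
    vertex′ : ∀ v → Vertex q _ u₀ l v
    vertex′ v with v Fin.≟ u
    ... | yes refl = queued (new ds) (trans (new ks) (sym (new Ds))) cur≤D′ (≤-reflexive (new as)) record
            { D≡ = trans (new Ds) (cong (_+ x u) (sym (new as)))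
            ; A<½ = λ p → cur<½ inv (≤-resp₂ refl (new as) p)
            ; terminal = i ; lab≡ = new ls ; lab≢q = i≢q ; route = r ; walk = walk
            ; A≡ = trans len≡ (sym (new as)) }
    ... | no p with vertex inv v
    ...   | undiscovered e k f = undiscovered (trans (old ds v p) e) (trans (old ks v p) k)
            (Unfound-cong (old as v p) (old Ds v p) (old ls v p) f)
    ...   | queued e k c≤ A≤ f = queued (trans (old ds v p) e) (trans (old ks v p) (trans k (sym (old Ds v p))))
            (≤-resp₂ refl (sym (old Ds v p)) c≤) (≤-resp₂ (sym (old as v p)) refl A≤)
            (Found-cong (old as v p) (old Ds v p) (old ls v p) f)
    ...   | settled e k D≤ f cl = settled (trans (old ds v p) e) (trans (old ks v p) k)
            (≤-resp₂ (sym (old Ds v p)) refl D≤)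
            (Found-cong (old as v p) (old Ds v p) (old ls v p) f)
            λ u′ v~u′ → Sum.map₂ (λ q → ≤-trans (A′≤A u′) (≤-resp₂ refl (sym (old Ds v p)) q)) (cl u′ v~u′)
    best′ : Best (A a) (D a) (best a) (θ a) (cur a) → Best A′ D′ (best a) (θ a) (cur a)
    best′ b = record
      { 0≤θ = Best.0≤θ b ; θ<t = Best.θ<t b
      ; best≡ = trans (Best.best≡ b) (∑-cong λ v → cong (if_then w v else 0#) (cut-same v))
      ; average = ≤-trans (Best.average b) (≤-reflexive (∑-cong swept-same)) }
      where
      cut-same : ∀ v → inCutᵇ (A a) (D a) (θ a) v ≡ inCutᵇ A′ D′ (θ a) v
      cut-same v with v Fin.≟ u
      ... | no p = cong₂ (λ y z → does (y ≤? θ a) ∧ not (does (z ≤? θ a))) (sym (old as v p)) (sym (old Ds v p))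
      ... | yes refl = trans
        (inCutᵇ-A> (A a) (D a) u (λ p → Best.θ<t b (≤-trans (cur≤1 inv) (≤-resp₂ (Unfound.A≡1 was-unfound) refl p))))
        (sym (inCutᵇ-A> A′ D′ u (λ p → Best.θ<t b (≤-resp₂ (new as) refl p))))
      swept-same : ∀ v → w v * ((D a v ⊓ cur a) - (A a v ⊓ cur a)) ≡ w v * ((D′ v ⊓ cur a) - (A′ v ⊓ cur a))
      swept-same v with v Fin.≟ u
      ... | no p = cong₂ (λ y z → w v * ((z ⊓ cur a) - (y ⊓ cur a))) (sym (old as v p)) (sym (old Ds v p))
      ... | yes refl = cong (w u *_) (trans
        (trans (cong₂ _-_ (x≤y⇒y⊓x≈x (≤-resp₂ refl (sym (Unfound.D≡1 was-unfound)) (cur≤1 inv)))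
                          (x≤y⇒y⊓x≈x (≤-resp₂ refl (sym (Unfound.A≡1 was-unfound)) (cur≤1 inv)))) refl)
        (sym (cong₂ _-_ (x≤y⇒y⊓x≈x cur≤D′) (x≤y⇒y⊓x≈x (≤-reflexive (sym (new as)))))))

  -- Once every key is at least ½, a vertex with D < ½ can be neither queued nor undiscovered. It is
  -- settled with nothing pending, which is `closed`.
  Inv-final : ∀ {q a u₀} → Inv q a u₀ [] → (∀ v → ½ ≤ key a v) → (∀ j → toℕ j ≢ q → D a (s j) ≡ 0#) →
              Distances q (A a) (D a) (lab a)
  Inv-final {q} {a} {u₀} inv keys src = record
    { vertex = λ v → found (vertex inv v)
    ; closed = λ {u} {v} u~v D<½ → closed u~v D<½ (vertex inv u)
    ; sources = src }
    where
    found : ∀ {v} → Vertex q a u₀ [] v → Found q (A a v) (D a v) (lab a v) v ⊎ Unfound (A a v) (D a v) (lab a v)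
    found (undiscovered _ _ u)  = inj₂ u
    found (queued _ _ _ _ f)    = inj₁ f
    found (settled _ _ _ f _)   = inj₁ f
    closed : ∀ {u v} → Adj u v → ¬ ½ ≤ D a u → Vertex q a u₀ [] u → A a v ≤ D a u
    closed u~v D<½ (undiscovered _ _ f) = contradiction (≤-resp₂ refl (sym (Unfound.D≡1 f)) ½≤1) D<½
    closed u~v D<½ (queued _ k _ _ _) = contradiction (≤-resp₂ refl k (keys _)) D<½
    closed u~v D<½ (settled _ _ _ _ cl) with cl _ u~v
    ... | inj₂ p = p

-- Adjacency lists and their linked representation.

sum-update : ∀ {n} {f g : Fin n → ℕ} i {a} → g i ≡ a ℕ.+ f i → (∀ j → j ≢ i → g j ≡ f j) → sum g ≡ a ℕ.+ sum f
sum-update {suc n} {f} {g} zero {a} eq eqs =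
  trans (cong₂ ℕ._+_ eq (sum-cong-≗ {n} (λ j → eqs (suc j) (λ ())))) (ℕ.+-assoc a (f zero) _)
sum-update {suc n} {f} {g} (suc i) {a} eq eqs =
  trans (cong₂ ℕ._+_ (eqs zero (λ ())) (sum-update i eq (λ j p → eqs (suc j) (p ∘ Fin.suc-injective))))
    (trans (sym (ℕ.+-assoc (f zero) a rest)) (trans (cong (ℕ._+ rest) (ℕ.+-comm (f zero) a)) (ℕ.+-assoc a (f zero) rest)))
  where rest = sum (f ∘ suc)

drop-lookup : ∀ {a} {A : Set a} (xs : List A) i → drop (toℕ i) xs ≡ lookup xs i ∷ drop (suc (toℕ i)) xs
drop-lookup (x ∷ xs) zero    = refl
drop-lookup (x ∷ xs) (suc i) = drop-lookup xs i

drop-all : ∀ {a} {A : Set a} (xs : List A) → drop (List.length xs) xs ≡ []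
drop-all []       = refl
drop-all (x ∷ xs) = drop-all xs

module _ {n : ℕ} where
  cons-at : Fin n → Fin n → (Fin n → List (Fin n)) → Fin n → List (Fin n)
  cons-at u v f t = if does (u Fin.≟ t) then v ∷ f t else f t

  neighbours : List (Fin n × Fin n) → Fin n → List (Fin n)
  neighbours []             = λ _ → []
  neighbours ((a , b) ∷ es) = cons-at b a (cons-at a b (neighbours es))

  cons-at-here : ∀ u v f → v ∈ cons-at u v f u
  cons-at-here u v f with u Fin.≟ u
  ... | yes _ = here refl
  ... | no p  = contradiction refl p

  cons-at-there : ∀ u v f {t z} → z ∈ f t → z ∈ cons-at u v f t
  cons-at-there u v f {t} p with u Fin.≟ t
  ... | yes _ = there p
  ... | no _  = p

  cons-at-inv : ∀ u v f {t z} → z ∈ cons-at u v f t → (t ≡ u × z ≡ v) ⊎ z ∈ f t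
  cons-at-inv u v f {t} p with u Fin.≟ t | p
  ... | yes refl | here e  = inj₁ (refl , e)
  ... | yes _    | there q = inj₂ q
  ... | no _     | q       = inj₂ q

  neighbours-complete : ∀ es {u v} → (u , v) ∈ es ⊎ (v , u) ∈ es → v ∈ neighbours es u
  neighbours-complete ((a , b) ∷ es) (inj₁ (here refl)) = cons-at-there b a (cons-at a b (neighbours es)) (cons-at-here a b (neighbours es))
  neighbours-complete ((a , b) ∷ es) (inj₂ (here refl)) = cons-at-here b a (cons-at a b (neighbours es))
  neighbours-complete ((a , b) ∷ es) (inj₁ (there p)) = cons-at-there b a (cons-at a b (neighbours es)) (cons-at-there a b (neighbours es) (neighbours-complete es (inj₁ p)))
  neighbours-complete ((a , b) ∷ es) (inj₂ (there p)) = cons-at-there b a (cons-at a b (neighbours es)) (cons-at-there a b (neighbours es) (neighbours-complete es (inj₂ p)))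

  neighbours-sound : ∀ es {u v} → v ∈ neighbours es u → (u , v) ∈ es ⊎ (v , u) ∈ es
  neighbours-sound ((a , b) ∷ es) {u} {v} p with cons-at-inv b a (cons-at a b (neighbours es)) {u} {v} p
  ... | inj₁ (refl , refl) = inj₂ (here refl)
  ... | inj₂ q with cons-at-inv a b (neighbours es) {u} {v} q
  ...   | inj₁ (refl , refl) = inj₁ (here refl)
  ...   | inj₂ r = Sum.map there there (neighbours-sound es r)

  private
    cons-at-length : ∀ u v f → sum (List.length ∘ cons-at u v f) ≡ suc (sum (List.length ∘ f))
    cons-at-length u v f = sum-update {f = List.length ∘ f} u at off
      where
      at : List.length (cons-at u v f u) ≡ 1 ℕ.+ List.length (f u)
      at with u Fin.≟ u
      ... | yes _ = refl
      ... | no p  = contradiction refl p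
      off : ∀ t → t ≢ u → List.length (cons-at u v f t) ≡ List.length (f t)
      off t p with u Fin.≟ t
      ... | yes e = contradiction (sym e) p
      ... | no _  = refl

  -- The handshake identity, which turns the total cost of the scans into a multiple of m.
  neighbours-length : ∀ es → sum (List.length ∘ neighbours es) ≡ List.length es ℕ.+ List.length es
  neighbours-length [] = sum-replicate-zero n
  neighbours-length ((a , b) ∷ es) = trans (cons-at-length b a (cons-at a b (neighbours es)))
    (cong suc (trans (cons-at-length a b (neighbours es))
      (trans (cong suc (neighbours-length es)) (sym (ℕ.+-suc _ _)))))

  -- linked lists of slots numbered from 1 to b, with 0 as the null pointer
  data Chain (next to : ℕ → ℕ) (b : ℕ) : ℕ → List (Fin n) → Set where
    nil  : Chain next to b 0 []
    link : ∀ {p v l} → 1 ℕ.≤ p → p ℕ.≤ b → to p ≡ toℕ v → Chain next to b (next p) l → Chain next to b p (v ∷ l)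

  Chain-cong : ∀ {next to next′ to′ b b′ p l} → b ℕ.≤ b′ → (∀ j → j ℕ.≤ b → next′ j ≡ next j × to′ j ≡ to j) →
               Chain next to b p l → Chain next′ to′ b′ p l
  Chain-cong le eq nil = nil
  Chain-cong {next} {to} {next′} {to′} {b} {b′} le eq (link {p} {v} {l} 1≤p p≤b e ch) =
    link 1≤p (ℕ.≤-trans p≤b le) (trans (proj₂ (eq p p≤b)) e)
      (subst (λ z → Chain next′ to′ b′ z l) (sym (proj₁ (eq p p≤b)))
        (Chain-cong {next} {to} {next′} {to′} {b} {b′} le eq ch))

  -- The new slot is b + 1, and existing chains use only slots up to b, so the writes cannot disturb
  -- them.
  Chain-push : ∀ {next to next′ to′ head head′ : ℕ → ℕ} {b p i : ℕ} {f : Fin n → List (Fin n)} {u v : Fin n} → i ≡ toℕ u → p ≡ suc b →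
    (∀ j → next′ j ≡ (if p ≡ᵇ j then head i else next j)) →
    (∀ j → to′ j ≡ (if p ≡ᵇ j then toℕ v else to j)) →
    (∀ j → head′ j ≡ (if i ≡ᵇ j then p else head j)) →
    (∀ t → Chain next to b (head (toℕ t)) (f t)) →
    ∀ t → Chain next′ to′ p (head′ (toℕ t)) (cons-at u v f t)
  Chain-push {next} {to} {next′} {to′} {head} {head′} {b} {_} {_} {f} {u} {v} refl refl next≡ to≡ head≡ chains t = go t
    where
    fresh : ∀ {j} → j ℕ.≤ b → suc b ≢ j
    fresh j≤b e = ℕ.1+n≰n (ℕ.≤-trans (ℕ.≤-reflexive e) j≤b)
    old : ∀ {p l} → Chain next to b p l → Chain next′ to′ (suc b) p l
    old = Chain-cong {next} {to} {next′} {to′} {b} {suc b} (ℕ.n≤1+n b)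
      λ j j≤b → trans (next≡ j) (at-other (fresh j≤b)) , trans (to≡ j) (at-other (fresh j≤b))
    at : ∀ {p p′ l} → p ≡ p′ → Chain next′ to′ (suc b) p l → Chain next′ to′ (suc b) p′ l
    at refl ch = ch
    go : ∀ t → Chain next′ to′ (suc b) (head′ (toℕ t)) (cons-at u v f t)
    go t with u Fin.≟ t
    ... | yes refl = at (sym (trans (head≡ (toℕ u)) (at-same (toℕ u))))
      (link (s≤s z≤n) ℕ.≤-refl (trans (to≡ (suc b)) (at-same b))
        (at (sym (trans (next≡ (suc b)) (at-same b))) (old (chains u))))
    ... | no p = at (sym (trans (head≡ (toℕ t)) (at-other (p ∘ Fin.toℕ-injective)))) (old (chains t))

<false⇒≡true : ∀ {a b} → a ℕ.< b → not (b ≤ᵇ a) ≡ true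
<false⇒≡true p = cong not (false-≤ᵇ p)

<-stop : ∀ {a b} → a ≡ b → not (b ≤ᵇ a) ≡ false
<-stop {a} refl = cong not (true-≤ᵇ (ℕ.≤-refl {a}))

-- The set-up code and the memory it fixes.

module Verification {c ℓ} (R : OrderedField c ℓ) (ins : NodeMC R) (x : Fin (NodeMC.n ins) → OrderedField.Carrier R)
                    (feasible : NodeMC.Feasible ins x) where
  open FieldProperties R
  open NodeMC ins
  open Hoare R
  open Tournament R
  open Program

  nbrs : Fin n → List (Fin n)
  nbrs = neighbours edges

  n≥2 : 2 ℕ.≤ n
  n≥2 = ℕ.≤-trans 2≤k (Fin.injective⇒≤ s-injective)

  1≤n : 1 ℕ.≤ n
  1≤n = ℕ.≤-trans (s≤s z≤n) n≥2

  Chains : State R → (Fin n → List (Fin n)) → Set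
  Chains σ f = ∃[ b ] ∀ v → Chain (nats σ NEXT) (nats σ TO) b (nats σ HEAD (toℕ v)) (f v)

  record Static (σ : State R) : Set c where
    field
      n≡       : nats σ 0 0 ≡ n
      k≡       : nats σ 0 2 ≡ k
      terminal : ∀ i → nats σ 1 (toℕ i) ≡ toℕ (s i)
      w≡       : ∀ v → scalars σ WT (toℕ v) ≡ w v
      x≡       : ∀ v → scalars σ X (toℕ v) ≡ x v
      half     : scalars σ HALF 0 ≡ ½
      parent   : Parents n (nats σ PAR)
      chains   : Chains σ nbrs

  private
    Static-cong : ∀ {σ τ} → nats τ 0 ≡ nats σ 0 → nats τ 1 ≡ nats σ 1 → nats τ PAR ≡ nats σ PAR →
      nats τ HEAD ≡ nats σ HEAD → nats τ NEXT ≡ nats σ NEXT → nats τ TO ≡ nats σ TO →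
      scalars τ WT ≡ scalars σ WT → scalars τ X ≡ scalars σ X → scalars τ HALF ≡ scalars σ HALF →
      Static σ → Static τ
    Static-cong {σ} {τ} e₀ e₁ e₂ e₃ e₄ e₅ e₆ e₇ e₈ st = record
      { n≡ = trans (cong-app e₀ 0) (Static.n≡ st)
      ; k≡ = trans (cong-app e₀ 2) (Static.k≡ st)
      ; terminal = λ i → trans (cong-app e₁ (toℕ i)) (Static.terminal st i)
      ; w≡ = λ v → trans (cong-app e₆ (toℕ v)) (Static.w≡ st v)
      ; x≡ = λ v → trans (cong-app e₇ (toℕ v)) (Static.x≡ st v)
      ; half = trans (cong-app e₈ 0) (Static.half st)
      ; parent = λ i p → trans (cong-app e₂ i) (Static.parent st i p)
      ; chains = proj₁ (Static.chains st) , λ v → Chain-resp e₄ e₅ (cong-app e₃ (toℕ v)) (proj₂ (Static.chains st) v) }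
      where
      Chain-resp : ∀ {next next′ to to′ b p p′ l} → next′ ≡ next → to′ ≡ to → p′ ≡ p →
                   Chain {n} next to b p l → Chain next′ to′ b p′ l
      Chain-resp refl refl refl ch = ch

  -- A Boolean test, so that for each concrete command the preservation of `Static` has `refl` as
  -- its side condition.
  writesStatic : Cmd → Bool
  writesStatic C = writesₙ C 0 ∨ writesₙ C 1 ∨ writesₙ C PAR ∨ writesₙ C HEAD ∨ writesₙ C NEXT ∨ writesₙ C TO ∨
                   writesᵣ C WT ∨ writesᵣ C X ∨ writesᵣ C HALF

  Static-frame : ∀ C {σ τ} → writesStatic C ≡ false → Frame C σ τ → Static σ → Static τ
  Static-frame C e fr = Static-cong
    (same-nats fr _ (∨ˡ e)) (same-nats fr _ (∨ˡ e₁)) (same-nats fr _ (∨ˡ e₂)) (same-nats fr _ (∨ˡ e₃))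
    (same-nats fr _ (∨ˡ e₄)) (same-nats fr _ (∨ˡ e₅)) (same-scalars fr _ (∨ˡ e₆)) (same-scalars fr _ (∨ˡ e₇))
    (same-scalars fr _ (∨ʳ (writesᵣ C X) e₇))
    where
    ∨ˡ : ∀ {x y} → x ∨ y ≡ false → x ≡ false
    ∨ˡ = ∨-conicalˡ _ _
    ∨ʳ : ∀ x {y} → x ∨ y ≡ false → y ≡ false
    ∨ʳ x = ∨-conicalʳ x _
    e₁ = ∨ʳ (writesₙ C 0) e
    e₂ = ∨ʳ (writesₙ C 1) e₁
    e₃ = ∨ʳ (writesₙ C PAR) e₂
    e₄ = ∨ʳ (writesₙ C HEAD) e₃
    e₅ = ∨ʳ (writesₙ C NEXT) e₄
    e₆ = ∨ʳ (writesₙ C TO) e₅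
    e₇ = ∨ʳ (writesᵣ C WT) e₆

  halved : Cmd
  halved = HALF ≔ᵣ 1ᵣ ⊘ᵣ (1ᵣ ⊕ᵣ 1ᵣ)

  parents-body : Cmd
  parents-body = set PAR (var I ⊕ var I) (var I) ⨾
       set PAR ((var I ⊕ var I) ⊕ lit 1) (var I) ⨾
       I ≔ var I ⊕ lit 1

  loop-time : ℕ → BExp → Cmd → ℕ
  loop-time N b C = N ℕ.* suc (costᵇ b ℕ.+ time C) ℕ.+ suc (costᵇ b)

  -- Halving is not primitive, so the table is filled by doubling: after i rounds the entries below
  -- 2i are correct. Round 0 gives entry 1 the value 0, the stopping value of `sift`.
  Runs-parents : ∀ {σ} → nats σ 0 0 ≡ n →
    Runs parents σ (time (I ≔ lit 0) ℕ.+ loop-time n (var I <ₙ N) parents-body) (λ τ → Parents n (nats τ PAR))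
  Runs-parents {σ} n≡ = Runs-seq {Φ = Inv′ 0} (Runs-straight (I ≔ lit 0) refl (refl , n≡ , λ _ ()))
    λ τ i₀ → Runs-mono ℕ.≤-refl (λ _ (_ , _ , p) → p) (Runs-for Inv′ n (time parents-body) step (λ τ (i≡ , n≡ , _) → <-stop (trans i≡ (sym n≡))) i₀)
    where
    Inv′ : ℕ → State R → Set
    Inv′ i τ = nats τ I 0 ≡ i × nats τ 0 0 ≡ n × Parents i (nats τ PAR)
    step : ∀ i τ → i ℕ.< n → Inv′ i τ →
      evalᵇ R τ (var I <ₙ N) ≡ true × Runs parents-body τ (time parents-body) (Inv′ (suc i))
    step i τ i<n (refl , n≡ , par) = <false⇒≡true (ℕ.≤-trans i<n (ℕ.≤-reflexive (sym n≡))) ,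
      Runs-straight parents-body refl (ℕ.+-comm i 1 , n≡ , par′)
      where
      par′ : ∀ j → j ℕ.< suc i ℕ.+ suc i → (if i ℕ.+ i ℕ.+ 1 ≡ᵇ j then i else if i ℕ.+ i ≡ᵇ j then i else nats τ PAR j) ≡ ⌊ j /2⌋
      par′ j j< with j ℕ.≟ i ℕ.+ i ℕ.+ 1
      ... | yes refl = trans (at-same (i ℕ.+ i ℕ.+ 1)) (sym (⌊i+i+1/2⌋ i))
      ... | no p with j ℕ.≟ i ℕ.+ i
      ...   | yes refl = trans (at-other (p ∘ sym)) (trans (at-same (i ℕ.+ i)) (sym (⌊i+i/2⌋ i)))
      ...   | no q = trans (at-other (p ∘ sym)) (trans (at-other (q ∘ sym)) (par j
                (ℕ.≤∧≢⇒< (ℕ.≤-pred (ℕ.≤∧≢⇒< (ℕ.≤-pred (ℕ.≤-trans j< (ℕ.≤-reflexive (cong suc (ℕ.+-suc i i)))))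
                   (λ e → p (trans e (sym (ℕ.+-comm (i ℕ.+ i) 1)))))) q)))

  Slots : State R → (Fin n → List (Fin n)) → Set
  Slots σ f = ∀ v → Chain (nats σ NEXT) (nats σ TO) (nats σ P 0) (nats σ HEAD (toℕ v)) (f v)

  Runs-push : ∀ {σ f u v} → nats σ U 0 ≡ toℕ u → nats σ V 0 ≡ toℕ v → Slots σ f →
              Runs push σ (time push) (λ τ → Slots τ (cons-at u v f))
  Runs-push {σ} {f} {u} {v} u≡ v≡ ch = Runs-straight push refl
    (Chain-push {next = nats σ NEXT} {to = nats σ TO} {head = nats σ HEAD} u≡ (ℕ.+-comm _ 1) (λ _ → refl)
      (λ j → cong (λ z → if nats σ P 0 ℕ.+ 1 ≡ᵇ j then z else nats σ TO j) v≡) (λ _ → refl) ch)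

  fetch fetch′ adjacency-body : Cmd
  fetch = J ≔ var J ⊖ lit 1 ⨾ U ≔ get 2 (var J) ⨾ V ≔ get 3 (var J)
  fetch′ = U ≔ get 3 (var J) ⨾ V ≔ get 2 (var J)
  adjacency-body = fetch ⨾ push ⨾ fetch′ ⨾ push

  Runs-adjacency : ∀ {σ} → nats σ 0 1 ≡ m → (∀ j → nats σ HEAD j ≡ 0) →
    (∀ e → nats σ 2 (toℕ e) ≡ toℕ (proj₁ (lookup edges e))) →
    (∀ e → nats σ 3 (toℕ e) ≡ toℕ (proj₂ (lookup edges e))) →
    Runs adjacency σ (time (J ≔ M) ℕ.+ loop-time m (lit 1 ≤ₙ var J) adjacency-body) (λ τ → Chains τ nbrs)
  Runs-adjacency {σ} m≡ head≡ fst≡ snd≡ = Runs-seq {Φ = Inv′ 0}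
    (Runs-straight (J ≔ M) refl (m≡ , refl , refl , λ v → empty (head≡ (toℕ v)) (cong (λ es → neighbours es v) (drop-all edges))))
    λ τ i₀ → Runs-mono ℕ.≤-refl (λ { τ (_ , _ , _ , ch) → nats τ P 0 ,
      subst (λ r → Slots τ (neighbours (drop r edges))) (ℕ.n∸n≡0 m) ch })
      (Runs-for Inv′ m (time adjacency-body) step (λ τ (J≡ , _) → cong (1 ≤ᵇ_) (trans J≡ (ℕ.n∸n≡0 m))) i₀)
    where
    empty : ∀ {next to b p l} → p ≡ 0 → l ≡ [] → Chain next to b p l
    empty refl refl = nil
    Inv′ : ℕ → State R → Set
    Inv′ i τ = nats τ J 0 ≡ m ∸ i × nats τ 2 ≡ nats σ 2 × nats τ 3 ≡ nats σ 3 × Slots τ (neighbours (drop (m ∸ i) edges))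
    step : ∀ i τ → i ℕ.< m → Inv′ i τ →
      evalᵇ R τ (lit 1 ≤ₙ var J) ≡ true × Runs adjacency-body τ (time adjacency-body) (Inv′ (suc i))
    step i τ i<m (J≡ , two , three , ch) =
      true-≤ᵇ {1} (ℕ.≤-trans (ℕ.m<n⇒0<n∸m i<m) (ℕ.≤-reflexive (sym J≡))) ,
      Runs-seq {Φ = λ υ → At υ × nats υ U 0 ≡ toℕ a × nats υ V 0 ≡ toℕ b × Slots υ (neighbours (drop (suc (toℕ e)) edges))}
        (Runs-straight fetch refl ((r≡ , two , three) ,
          trans (cong₂ (λ f j → f j) two J≡e) (fst≡ e) , trans (cong₂ (λ f j → f j) three J≡e) (snd≡ e) ,
          subst (λ es → Slots τ (neighbours es)) dropped ch))
        λ υ (at , u≡ , v≡ , ch) → Runs-seq (Runs-frame (Runs-push u≡ v≡ ch))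
        λ υ (ch , fr) → let at = At-frame fr at ; (J≡ , two , three) = at in
          Runs-seq {Φ = λ υ → At υ × nats υ U 0 ≡ toℕ b × nats υ V 0 ≡ toℕ a × Slots υ (cons-at a b (neighbours (drop (suc (toℕ e)) edges)))}
            (Runs-straight fetch′ refl (at ,
              trans (cong₂ (λ f j → f j) three (trans J≡ r≡e)) (snd≡ e) , trans (cong₂ (λ f j → f j) two (trans J≡ r≡e)) (fst≡ e) , ch))
        λ υ (at , u≡ , v≡ , ch) → Runs-mono ℕ.≤-refl
          (λ υ (ch , fr) → let (J≡ , two , three) = At-frame fr at in J≡ , two , three ,
            subst (λ es → Slots υ (neighbours es)) (trans (sym (drop-lookup edges e)) (cong (λ z → drop z edges) (sym r≡e))) ch)
          (Runs-frame (Runs-push u≡ v≡ ch))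
      where
      r = m ∸ suc i
      At : State R → Set
      At υ = nats υ J 0 ≡ r × nats υ 2 ≡ nats σ 2 × nats υ 3 ≡ nats σ 3
      At-frame : ∀ {υ υ′} → Frame push υ υ′ → At υ → At υ′
      At-frame fr (a , b , c) = trans (cong-app (same-nats fr J refl) 0) a ,
        trans (same-nats fr 2 refl) b , trans (same-nats fr 3 refl) c
      r≡ : nats τ J 0 ∸ 1 ≡ r
      r≡ = trans (cong (_∸ 1) J≡) (trans (ℕ.∸-+-assoc m i 1) (cong (m ∸_) (ℕ.+-comm i 1)))
      r<m : r ℕ.< m
      r<m = ℕ.∸-monoʳ-< {m} (s≤s z≤n) i<m
      e = fromℕ< r<m
      a = proj₁ (lookup edges e)
      b = proj₂ (lookup edges e)
      r≡e : r ≡ toℕ e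
      r≡e = sym (Fin.toℕ-fromℕ< r<m)
      J≡e : nats τ J 0 ∸ 1 ≡ toℕ e
      J≡e = trans r≡ r≡e
      dropped : drop (m ∸ i) edges ≡ drop (suc (toℕ e)) edges
      dropped = cong (λ z → drop z edges) (trans (sym (ℕ.suc-pred (m ∸ i) ⦃ ℕ.>-nonZero (ℕ.m<n⇒0<n∸m i<m) ⦄))
        (cong suc (trans (ℕ.pred[m∸n]≡m∸[1+n] m i) r≡e)))

-- Initialisation of a pass and the visit of a vertex.

module Passes {c ℓ} (R : OrderedField c ℓ) (ins : NodeMC R) (x : Fin (NodeMC.n ins) → OrderedField.Carrier R)
              (feasible : NodeMC.Feasible ins x) where
  open FieldProperties R
  open NodeMC ins
  open Rounding R ins x feasible
  open Dijkstra R ins x feasible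
  open Hoare R
  open Tournament R
  open Program
  open Verification R ins x feasible

  L : ℕ
  L = ⌊log₂ n ⌋

  record ClearedAt (τ : State R) (i : ℕ) : Set c where
    constructor cleared
    field
      disc≡ : nats τ DISC i ≡ 0
      lab≡  : nats τ LAB i ≡ 0
      A≡    : scalars τ A i ≡ 1#
      D≡    : scalars τ D i ≡ 1#
      key≡  : scalars τ KEY (n ℕ.+ i) ≡ 1#
      top≡  : nats τ TOP (n ℕ.+ i) ≡ i

  clear-body : Cmd
  clear-body =
    set DISC (var J) (lit 0) ⨾ set LAB (var J) (lit 0) ⨾ setᵣ A (var J) 1ᵣ ⨾ setᵣ D (var J) 1ᵣ ⨾
    setᵣ KEY (N ⊕ var J) 1ᵣ ⨾ set TOP (N ⊕ var J) (var J) ⨾ J ≔ var J ⊕ lit 1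

  clear-time : ℕ
  clear-time = time (J ≔ lit 0) ℕ.+ loop-time n (var J <ₙ N) clear-body

  Runs-clear : ∀ {σ} → nats σ 0 0 ≡ n → Runs clear σ clear-time (λ τ → ∀ i → i ℕ.< n → ClearedAt τ i)
  Runs-clear {σ} n≡ = Runs-seq {Φ = Inv′ 0} (Runs-straight (J ≔ lit 0) refl (refl , n≡ , λ _ ()))
    λ τ i₀ → Runs-mono ℕ.≤-refl (λ _ (_ , _ , p) → p)
      (Runs-for Inv′ n (time clear-body) step (λ τ (i≡ , n≡ , _) → <-stop (trans i≡ (sym n≡))) i₀)
    where
    Inv′ : ℕ → State R → Set _
    Inv′ j τ = nats τ J 0 ≡ j × nats τ 0 0 ≡ n × (∀ i → i ℕ.< j → ClearedAt τ i)
    step : ∀ j τ → j ℕ.< n → Inv′ j τ →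
      evalᵇ R τ (var J <ₙ N) ≡ true × Runs clear-body τ (time clear-body) (Inv′ (suc j))
    step j τ j<n (refl , n≡ , done) = <false⇒≡true (ℕ.≤-trans j<n (ℕ.≤-reflexive (sym n≡))) ,
      Runs-straight clear-body refl (ℕ.+-comm j 1 , n≡ , λ i i<1+j → at i (i ℕ.≟ j) i<1+j)
      where
      τ′ = exec clear-body τ
      at : ∀ i → Dec (i ≡ j) → i ℕ.< suc j → ClearedAt τ′ i
      at i (yes refl) _ = cleared (at-same i) (at-same i) (at-same i) (at-same i)
        (trans (cong (λ z → if z ℕ.+ j ≡ᵇ n ℕ.+ i then 1# else scalars τ KEY (n ℕ.+ i)) n≡) (at-same (n ℕ.+ i)))
        (trans (cong (λ z → if z ℕ.+ j ≡ᵇ n ℕ.+ i then j else nats τ TOP (n ℕ.+ i)) n≡) (at-same (n ℕ.+ i)))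
      at i (no i≢j) i<1+j with cleared a b c d e f ← done i (ℕ.≤∧≢⇒< (ℕ.≤-pred i<1+j) i≢j) =
        cleared (trans (at-other j≢i) a) (trans (at-other j≢i) b) (trans (at-other j≢i) c) (trans (at-other j≢i) d)
          (trans (at-other n+j≢) e) (trans (at-other n+j≢) f)
        where
        j≢i = i≢j ∘ sym
        n+j≢ : nats τ 0 0 ℕ.+ j ≢ n ℕ.+ i
        n+j≢ eq = j≢i (ℕ.+-cancelˡ-≡ n j i (trans (cong (ℕ._+ j) (sym n≡)) eq))

  grow-time : ℕ
  grow-time = time (I ≔ N ⊖ lit 1) ℕ.+ loop-time (n ∸ 1) (lit 1 ≤ₙ var I) (pull ⨾ I ≔ var I ⊖ lit 1)

  record Grown (σ τ : State R) : Set (c ⊔ ℓ) where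
    field
      tree   : Tree n (key-of τ) (top-of τ)
      leaves : ∀ j → n ℕ.≤ j → key-of τ j ≡ key-of σ j

  -- Matches are played from node n - 1 downwards. Playing node i changes node i alone, and it is
  -- not a child of any larger node, so finished nodes stay valid.
  Runs-grow : ∀ {σ} → nats σ 0 0 ≡ n → (∀ v → v ℕ.< n → top-of σ (n ℕ.+ v) ≡ v) → Runs grow σ grow-time (Grown σ)
  Runs-grow {σ} n≡ leaf₀ = Runs-seq {Φ = Inv′ 0}
    (Runs-straight (I ≔ N ⊖ lit 1) refl (n ∸ 1 , cong (_∸ 1) n≡ , ℕ.+-identityʳ _ , record
      { i<n = ℕ.≤-reflexive (ℕ.suc-pred n ⦃ ℕ.>-nonZero 1≤n ⦄)
      ; node = λ j lt j<n → contradiction (ℕ.≤-trans (ℕ.≤-reflexive (sym (ℕ.suc-pred n ⦃ ℕ.>-nonZero 1≤n ⦄))) lt) (ℕ.<⇒≱ j<n)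
      ; leaf = leaf₀ ; leaves = λ _ _ → refl }))
    λ τ i₀ → Runs-mono ℕ.≤-refl finish
      (Runs-for Inv′ (n ∸ 1) (time (pull ⨾ I ≔ var I ⊖ lit 1)) step
        (λ τ (i , I≡ , sum≡ , _) → cong (1 ≤ᵇ_) (trans I≡ (ℕ.+-cancelʳ-≡ (n ∸ 1) i 0 sum≡))) i₀)
    where
    record Above (i : ℕ) (τ : State R) : Set (c ⊔ ℓ) where
      field
        i<n    : i ℕ.< n
        node   : ∀ j → i ℕ.< j → j ℕ.< n → Node (key-of τ) (top-of τ) j
        leaf   : ∀ v → v ℕ.< n → top-of τ (n ℕ.+ v) ≡ v
        leaves : ∀ j → n ℕ.≤ j → key-of τ j ≡ key-of σ j
    Inv′ : ℕ → State R → Set _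
    Inv′ j τ = ∃[ i ] nats τ I 0 ≡ i × i ℕ.+ j ≡ n ∸ 1 × Above i τ
    finish : ∀ τ → Inv′ (n ∸ 1) τ → Grown σ τ
    finish τ (i , _ , sum≡ , ab) with refl ← ℕ.+-cancelʳ-≡ (n ∸ 1) i 0 sum≡ = record
      { tree = record { node = Above.node ab ; leaf = Above.leaf ab } ; leaves = Above.leaves ab }
    step : ∀ j τ → j ℕ.< n ∸ 1 → Inv′ j τ →
      evalᵇ R τ (lit 1 ≤ₙ var I) ≡ true ×
      Runs (pull ⨾ I ≔ var I ⊖ lit 1) τ (time (pull ⨾ I ≔ var I ⊖ lit 1)) (Inv′ (suc j))
    step j τ j< (zero , I≡ , sum≡ , ab) = contradiction sum≡ (ℕ.<⇒≢ j<)
    step j τ j< (suc i , I≡ , sum≡ , ab) = cong (1 ≤ᵇ_) I≡ , Runs-seq (Runs-pull {τ} I≡ (s≤s z≤n)) λ υ p →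
      Runs-straight (I ≔ var I ⊖ lit 1) refl (i , cong (_∸ 1) (Pulled.same-index p) , trans (ℕ.+-suc i j) sum≡ , record
        { i<n = ℕ.<-trans (ℕ.n<1+n i) (Above.i<n ab)
        ; node = λ t lt t<n → node′ υ p t lt t<n (t ℕ.≟ suc i)
        ; leaf = λ v v<n → trans (Pulled.other-top p _ (beyond (ℕ.m≤m+n n v))) (Above.leaf ab v v<n)
        ; leaves = λ t n≤t → trans (Pulled.other-key p _ (beyond n≤t)) (Above.leaves ab t n≤t) })
      where
      beyond : ∀ {t} → n ℕ.≤ t → t ≢ suc i
      beyond n≤t refl = ℕ.<⇒≱ (Above.i<n ab) n≤t
      node′ : ∀ υ → Pulled (suc i) τ υ → ∀ t → i ℕ.< t → t ℕ.< n → Dec (t ≡ suc i) → Node (key-of υ) (top-of υ) t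
      node′ υ p t lt t<n (yes refl) = Pulled.pulled p
      node′ υ p t lt t<n (no t≢) = Node-cong (λ t′ near → Pulled.other-key p t′ (off near) , Pulled.other-top p t′ (off near))
        (Above.node ab t 1+i<t t<n)
        where
        1+i<t = ℕ.≤∧≢⇒< lt (t≢ ∘ sym)
        off : ∀ {t′} → t′ ≡ t ⊎ ⌊ t′ /2⌋ ≡ t → t′ ≢ suc i
        off (inj₁ refl) = t≢
        off (inj₂ e) refl = ℕ.<⇒≱ 1+i<t (ℕ.≤-trans (ℕ.≤-reflexive (sym e)) (ℕ.⌊n/2⌋≤n (suc i)))

  -- the search invariant on states

  arrays : (disc lab : ℕ → ℕ) (a d key : ℕ → Carrier) (cur w best θ : Carrier) → Arrays
  arrays disc lab a d key cur w best θ = record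
    { disc = disc ∘ toℕ ; lab = lab ∘ toℕ ; A = a ∘ toℕ ; D = d ∘ toℕ ; key = λ v → key (n ℕ.+ toℕ v)
    ; cur = cur ; W = w ; best = best ; θ = θ }

  view : State R → Arrays
  view σ = arrays (nats σ DISC) (nats σ LAB) (scalars σ A) (scalars σ D) (scalars σ KEY)
    (scalars σ CUR 0) (scalars σ W 0) (scalars σ BEST 0) (scalars σ THETA 0)

  module V σ = Arrays (view σ)

  record Live (q : ℕ) (u₀ : Fin n) (l : List (Fin n)) (σ : State R) : Set (c ⊔ ℓ) where
    field
      static   : Static σ
      excluded : nats σ Q 0 ≡ q
      tree     : Tree n (key-of σ) (top-of σ)
      inv      : Inv q (view σ) u₀ l

  Updated-at : ∀ {b} {B : Set b} {f f′ : Fin n → B} {i u y y′} → i ≡ toℕ u → y ≡ y′ →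
               (∀ v → f′ v ≡ (if i ≡ᵇ toℕ v then y else f v)) → Updated f f′ u y′
  Updated-at {u = u} refl refl eq = updated (trans (eq u) (at-same (toℕ u)))
    (λ v v≢u → trans (eq v) (at-other (v≢u ∘ sym ∘ Fin.toℕ-injective)))

  Updated-leaf : ∀ {f f′ : ℕ → Carrier} {i u y y′} → i ≡ n ℕ.+ toℕ u → y ≡ y′ →
    (∀ j → f′ j ≡ (if i ≡ᵇ j then y else f j)) →
    Updated (λ v → f (n ℕ.+ toℕ v)) (λ v → f′ (n ℕ.+ toℕ v)) u y′ × (∀ j → j ≢ n ℕ.+ toℕ u → f′ j ≡ f j)
  Updated-leaf {u = u} refl refl eq = updated (trans (eq _) (at-same (n ℕ.+ toℕ u)))
    (λ v v≢u → trans (eq _) (at-other (v≢u ∘ sym ∘ Fin.toℕ-injective ∘ ℕ.+-cancelˡ-≡ n _ _))) ,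
    λ j p → trans (eq j) (at-other (p ∘ sym))

  Updated-resp : ∀ {b} {B : Set b} {f f′ f″ : Fin n → B} {u y} → (∀ v → f″ v ≡ f′ v) → Updated f f′ u y → Updated f f″ u y
  Updated-resp eq (updated a b) = updated (trans (eq _) a) (λ v p → trans (eq v) (b v p))

  TreeBut-leaf : ∀ {key key′ top top′} (v : Fin n) → Tree n key top → (∀ j → j ≢ n ℕ.+ toℕ v → key′ j ≡ key j) →
                 top′ ≡ top → TreeBut n ⌊ n ℕ.+ toℕ v /2⌋ key′ top′
  TreeBut-leaf {key} {key′} {top} v t same refl = record
    { i<n = half<n
    ; node = λ j 1≤j j<n j≢ → Node-cong (λ j′ near → same j′ (off j<n j≢ near) , refl) (Tree.node t j 1≤j j<n)
    ; leaf = Tree.leaf t }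
    where
    off : ∀ {j j′} → j ℕ.< n → j ≢ ⌊ n ℕ.+ toℕ v /2⌋ → j′ ≡ j ⊎ ⌊ j′ /2⌋ ≡ j → j′ ≢ n ℕ.+ toℕ v
    off j<n _ (inj₁ refl) e = ℕ.<⇒≱ j<n (ℕ.≤-trans (ℕ.m≤m+n n (toℕ v)) (ℕ.≤-reflexive (sym e)))
    off _ j≢ (inj₂ e) refl = j≢ (sym e)
    half<n : ⌊ n ℕ.+ toℕ v /2⌋ ℕ.< n
    half<n = ℕ.≰⇒> λ p → ℕ.<⇒≱ (ℕ.+-monoʳ-< n (Fin.toℕ<n v)) (ℕ.≤-trans (ℕ.+-mono-≤ p p) twice≤)
      where
      twice≤ : ⌊ n ℕ.+ toℕ v /2⌋ ℕ.+ ⌊ n ℕ.+ toℕ v /2⌋ ℕ.≤ n ℕ.+ toℕ v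
      twice≤ with double-or-suc (n ℕ.+ toℕ v)
      ... | inj₁ e = ℕ.≤-reflexive (sym e)
      ... | inj₂ e = ℕ.≤-trans (ℕ.m≤m+n _ 1) (ℕ.≤-reflexive (sym e))

  Inv-scalars : ∀ {q u₀ l a cur best θ} → cur ≡ Arrays.cur a → best ≡ Arrays.best a → θ ≡ Arrays.θ a →
                Inv q a u₀ l → Inv q (record a { cur = cur ; best = best ; θ = θ }) u₀ l
  Inv-scalars refl refl refl i = i

  record Enqueued (v : Fin n) (i : Fin k) (σ τ : State R) : Set c where
    field
      V≡        : nats τ V 0 ≡ toℕ v
      disc-new  : Updated (V.disc σ) (V.disc τ) v 1
      lab-new   : Updated (V.lab σ) (V.lab τ) v (toℕ i)
      A-new     : Updated (V.A σ) (V.A τ) v (V.cur σ)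
      D-new     : Updated (V.D σ) (V.D τ) v (V.cur σ + x v)
      key-new   : Updated (V.key σ) (V.key τ) v (V.cur σ + x v)
      key-other : ∀ j → j ≢ n ℕ.+ toℕ v → key-of τ j ≡ key-of σ j
      W≡        : V.W τ ≡ V.W σ + w v

  Runs-enqueue : ∀ {σ v i} → Static σ → nats σ V 0 ≡ toℕ v → nats σ LABEL 0 ≡ toℕ i →
                 Runs enqueue σ (time enqueue) (Enqueued v i σ)
  Runs-enqueue {σ} {v} {i} st V≡ LABEL≡ = Runs-straight enqueue refl record
    { V≡ = V≡
    ; disc-new = Updated-at V≡ refl (λ _ → refl)
    ; lab-new = Updated-at V≡ LABEL≡ (λ _ → refl)
    ; A-new = Updated-at V≡ refl (λ _ → refl)
    ; D-new = Updated-at V≡ D≡ (λ _ → refl)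
    ; key-new = proj₁ leaf
    ; key-other = proj₂ leaf
    ; W≡ = cong (V.W σ +_) (trans (cong (scalars σ WT) V≡) (Static.w≡ st v)) }
    where
    D≡ : V.cur σ + scalars σ X (nats σ V 0) ≡ V.cur σ + x v
    D≡ = cong (V.cur σ +_) (trans (cong (scalars σ X) V≡) (Static.x≡ st v))
    leaf = Updated-leaf {f = key-of σ} {f′ = key-of (exec enqueue σ)} (cong₂ ℕ._+_ (Static.n≡ st) V≡) D≡ (λ _ → refl)

  -- `persist` carries the zero distances of the sources, and D of the vertex being scanned, through
  -- a visit.
  record Visited (q : ℕ) (u₀ : Fin n) (l : List (Fin n)) (v : Fin n) (σ τ : State R) : Set (c ⊔ ℓ) where
    field
      live  : Live q u₀ l τ
      seen  : V.disc τ v ≢ 0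
      persist : ∀ t → V.disc σ t ≢ 0 → V.disc τ t ≢ 0 × V.D τ t ≡ V.D σ t
      cur≡  : V.cur τ ≡ V.cur σ
      P≡    : nats τ P ≡ nats σ P
      U≡    : nats τ U ≡ nats σ U
      J≡    : nats τ J ≡ nats σ J
      NEXT≡ : nats τ NEXT ≡ nats σ NEXT
      TO≡   : nats τ TO ≡ nats σ TO

  new-cost old-time visit-time : ℕ
  new-cost = time enqueue ℕ.+ sift-time L
  old-time = suc (costᵇ (get DISC (var V) =ₙ lit 0) ℕ.+ 1)
  visit-time = suc (costᵇ (get DISC (var V) =ₙ lit 0) ℕ.+ new-cost)

  module _ {q u₀ l σ v} {i : Fin k} {r} (lv : Live q u₀ l σ) (V≡ : nats σ V 0 ≡ toℕ v)
           (LABEL≡ : nats σ LABEL 0 ≡ toℕ i) (i≢q : toℕ i ≢ q) (walk : Walk i v r) (len≡ : len∑ r ≡ V.cur σ) where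

    -- Kept apart from `Runs-visit-old` for the amortised count: a first discovery pays for a
    -- `sift`, a repeated visit takes constant time.
    Runs-visit-new : V.disc σ v ≡ 0 →
      Runs visit σ visit-time (λ τ → Visited q u₀ l v σ τ × Updated (V.disc σ) (V.disc τ) v 1)
    Runs-visit-new unseen = Runs-mono ℕ.≤-refl (λ { _ (f , fr) → f fr })
      (Runs-frame (Runs-then (true-≡ᵇ (trans (cong (nats σ DISC) V≡) unseen))
        (Runs-seq (Runs-frame (Runs-enqueue (Live.static lv) V≡ LABEL≡)) λ υ (e , fr₁) →
          let st₁ = Static-frame enqueue refl fr₁ (Live.static lv) in
          Runs-mono ℕ.≤-refl (λ τ (s , fr₂) fr → finish υ τ e fr₁ s fr₂ fr)
            (Runs-frame (Runs-sift (Static.n≡ st₁) (Enqueued.V≡ e) (Fin.toℕ<n v) (Static.parent st₁)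
              (TreeBut-leaf v (Live.tree lv) (Enqueued.key-other e) (same-nats fr₁ TOP refl)))))))
      where
      finish : ∀ υ τ → Enqueued v i σ υ → Frame enqueue σ υ → Sifted n υ τ → Frame sift υ τ → Frame visit σ τ →
               Visited q u₀ l v σ τ × Updated (V.disc σ) (V.disc τ) v 1
      finish υ τ e fr₁ s fr₂ fr = record
        { live = record
            { static = Static-frame visit refl fr (Live.static lv)
            ; excluded = trans (cong-app (same-nats fr Q refl) 0) (Live.excluded lv)
            ; tree = Sifted.tree s
            ; inv = Inv-scalars (cong-app (same-scalars fr CUR refl) 0) (cong-app (same-scalars fr BEST refl) 0)
                (cong-app (same-scalars fr THETA refl) 0)
                (Inv-enqueue (Live.inv lv) unseen i≢q walk len≡ disc′
                  (Updated-resp (λ t → cong-app (same-nats fr₂ LAB refl) (toℕ t)) (Enqueued.lab-new e))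
                  (Updated-resp (λ t → cong-app (same-scalars fr₂ A refl) (toℕ t)) (Enqueued.A-new e))
                  D′
                  (Updated-resp (λ t → Sifted.leaves s _ (ℕ.m≤m+n n (toℕ t))) (Enqueued.key-new e))
                  (trans (cong-app (same-scalars fr₂ W refl) 0) (Enqueued.W≡ e))) }
        ; seen = λ eq → contradiction (trans (sym (Updated.new disc′)) eq) λ ()
        ; persist = persist
        ; cur≡ = cong-app (same-scalars fr CUR refl) 0
        ; P≡ = same-nats fr P refl
        ; U≡ = same-nats fr U refl
        ; J≡ = same-nats fr J refl
        ; NEXT≡ = same-nats fr NEXT refl
        ; TO≡ = same-nats fr TO refl } , disc′
        where
        disc′ : Updated (V.disc σ) (V.disc τ) v 1
        disc′ = Updated-resp (λ t → cong-app (same-nats fr₂ DISC refl) (toℕ t)) (Enqueued.disc-new e)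
        D′ : Updated (V.D σ) (V.D τ) v (V.cur σ + x v)
        D′ = Updated-resp (λ t → cong-app (same-scalars fr₂ D refl) (toℕ t)) (Enqueued.D-new e)
        persist : ∀ t → V.disc σ t ≢ 0 → V.disc τ t ≢ 0 × V.D τ t ≡ V.D σ t
        persist t p with t Fin.≟ v
        ... | yes refl = contradiction unseen p
        ... | no t≢v = (λ eq → p (trans (sym (Updated.old disc′ t t≢v)) eq)) , Updated.old D′ t t≢v

    Runs-visit-old : V.disc σ v ≢ 0 → Runs visit σ old-time (λ τ → Visited q u₀ l v σ τ × nats τ DISC ≡ nats σ DISC)
    Runs-visit-old seen = Runs-else (false-≡ᵇ (seen ∘ trans (cong (nats σ DISC) (sym V≡))))
      (Runs-straight skip refl (record
        { live = lv ; seen = seen ; persist = λ t p → p , refl ; cur≡ = refl ; P≡ = refl ; U≡ = refl ; J≡ = refl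
        ; NEXT≡ = refl ; TO≡ = refl } , refl))

    old≤visit : old-time ℕ.≤ visit-time
    old≤visit = s≤s (ℕ.+-monoʳ-≤ (costᵇ (get DISC (var V) =ₙ lit 0)) (s≤s z≤n))

    Runs-visit : Runs visit σ visit-time (Visited q u₀ l v σ)
    Runs-visit with V.disc σ v ℕ.≟ 0
    ... | yes p = Runs-mono ℕ.≤-refl (λ _ → proj₁) (Runs-visit-new p)
    ... | no p  = Runs-mono old≤visit (λ _ → proj₁) (Runs-visit-old p)

-- The search loop and its amortised cost.

module Search {c ℓ} (R : OrderedField c ℓ) (ins : NodeMC R) (x : Fin (NodeMC.n ins) → OrderedField.Carrier R)
              (feasible : NodeMC.Feasible ins x) where
  open FieldProperties R hiding (solve; _:=_; _:+_; _:*_; _:-_; :-_; con; Polynomial)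
  open +-*-Solver using (solve; _:+_; _:*_; _:=_; con)
  open NodeMC ins
  open NodeMC.Feasible feasible
  open Rounding R ins x feasible
  open Dijkstra R ins x feasible
  open Hoare R
  open Tournament R
  open Program
  open Verification R ins x feasible
  open Passes R ins x feasible

  u-any : Fin n
  u-any = s (fromℕ< (ℕ.≤-trans (s≤s z≤n) 2≤k))

  Sourced : ℕ → State R → Set c
  Sourced q τ = ∀ i → toℕ i ≢ q → V.D τ (s i) ≡ 0#

  D≡0⇒discovered : ∀ {q u₀ l σ v} → Live q u₀ l σ → V.D σ v ≡ 0# → V.disc σ v ≢ 0
  D≡0⇒discovered lv e = D<½⇒discovered (Live.inv lv) (λ p → ½≰0 (≤-resp₂ refl e p))

  source-var source-body : Cmd
  source-var = V ≔ get 1 (var J) ⨾ LABEL ≔ var J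
  source-body = (ifᶜ var J =ₙ var Q then skip else (V ≔ get 1 (var J) ⨾ LABEL ≔ var J ⨾ visit)) ⨾ J ≔ var J ⊕ lit 1

  source-time sources-time : ℕ
  source-time = suc (costᵇ (var J =ₙ var Q) ℕ.+ (1 ℕ.⊔ (time (V ≔ get 1 (var J)) ℕ.+ (time (LABEL ≔ var J) ℕ.+ visit-time))))
                ℕ.+ time (J ≔ var J ⊕ lit 1)
  sources-time = time (J ≔ lit 0) ℕ.+ (k ℕ.* suc (costᵇ (var J <ₙ K) ℕ.+ source-time) ℕ.+ suc (costᵇ (var J <ₙ K)))

  Started : ℕ → State R → Set (c ⊔ ℓ)
  Started q σ = Live q u-any [] σ × V.cur σ ≡ 0#

  Runs-sources : ∀ {q σ} → Started q σ → Runs sources σ sources-time (λ τ → Started q τ × Sourced q τ)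
  Runs-sources {q} {σ} (lv , cur≡0) = Runs-seq {Φ = Inv′ 0}
    (Runs-straight (J ≔ lit 0) refl (refl , (record { static = Static-frame (J ≔ lit 0) refl (⇓-frame ⇓set) (Live.static lv) ; excluded = Live.excluded lv ; tree = Live.tree lv ; inv = Live.inv lv } , cur≡0) , λ _ ()))
    λ τ i₀ → Runs-mono ℕ.≤-refl (λ _ (_ , st , p) → st , λ i → p i (Fin.toℕ<n i))
      (Runs-for Inv′ k source-time step (λ τ (J≡ , (lv , _) , _) → <-stop (trans J≡ (sym (Static.k≡ (Live.static lv))))) i₀)
    where
    Inv′ : ℕ → State R → Set _
    Inv′ j τ = nats τ J 0 ≡ j × Started q τ × (∀ i → toℕ i ℕ.< j → toℕ i ≢ q → V.D τ (s i) ≡ 0#)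
    Next : ℕ → State R → Set _
    Next j τ = nats τ J 0 ≡ j × Started q τ × (∀ i → toℕ i ℕ.< suc j → toℕ i ≢ q → V.D τ (s i) ≡ 0#)
    step : ∀ j τ → j ℕ.< k → Inv′ j τ → evalᵇ R τ (var J <ₙ K) ≡ true × Runs source-body τ source-time (Inv′ (suc j))
    step j τ j<k (J≡ , (lv , cur≡0) , done) =
      <false⇒≡true (subst₂ ℕ._<_ (sym J≡) (sym (Static.k≡ (Live.static lv))) j<k) ,
      Runs-seq {Φ = Next j} (Runs-if
        (λ e → Runs-straight skip refl (J≡ , (lv , cur≡0) , λ i i<1+j i≢q → skipped i i<1+j i≢q (≡ᵇ-true {nats τ J 0} e) (toℕ i ℕ.≟ j)))
        (λ e → visited (λ eq → ≡ᵇ-false {nats τ J 0} e (trans J≡ (trans eq (sym (Live.excluded lv)))))))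
      λ υ (J≡ , (lv , z) , d) → Runs-straight (J ≔ var J ⊕ lit 1) refl (trans (cong (ℕ._+ 1) J≡) (ℕ.+-comm j 1) ,
        (record { static = Static-frame (J ≔ var J ⊕ lit 1) refl (⇓-frame ⇓set) (Live.static lv) ; excluded = Live.excluded lv
                ; tree = Live.tree lv ; inv = Live.inv lv } , z) , d)
      where
      skipped : ∀ i → toℕ i ℕ.< suc j → toℕ i ≢ q → nats τ J 0 ≡ nats τ Q 0 → Dec (toℕ i ≡ j) → V.D τ (s i) ≡ 0#
      skipped i _ i≢q e (yes refl) = contradiction (trans (sym J≡) (trans e (Live.excluded lv))) i≢q
      skipped i i<1+j i≢q _ (no p) = done i (ℕ.≤∧≢⇒< (ℕ.≤-pred i<1+j) p) i≢q
      jᶠ = fromℕ< j<k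
      toℕ-j : toℕ jᶠ ≡ j
      toℕ-j = Fin.toℕ-fromℕ< j<k
      visited : j ≢ q → Runs (V ≔ get 1 (var J) ⨾ LABEL ≔ var J ⨾ visit) τ _ (Next j)
      visited j≢q = Runs-seq {Φ = λ υ → υ ≡ exec (V ≔ get 1 (var J)) τ} (Runs-straight (V ≔ get 1 (var J)) refl refl)
        λ { _ refl → Runs-seq {Φ = λ υ → υ ≡ exec source-var τ} (Runs-straight (LABEL ≔ var J) refl refl)
        λ { _ refl → Runs-mono ℕ.≤-refl finish (Runs-visit {v = s jᶠ} {i = jᶠ} {r = []}
          (record { static = Static-frame source-var refl (⇓-frame (⇓seq ⇓set ⇓set)) (Live.static lv) ; excluded = Live.excluded lv
                  ; tree = Live.tree lv ; inv = Live.inv lv })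
          (trans (cong (nats τ 1) (trans J≡ (sym toℕ-j))) (Static.terminal (Live.static lv) jᶠ)) (trans J≡ (sym toℕ-j))
          (λ e → j≢q (trans (sym toℕ-j) e)) (record { linked = [-] ; ends = refl }) (sym cur≡0)) } }
        where
        finish : ∀ υ → Visited q u-any [] (s jᶠ) (exec source-var τ) υ → Next j υ
        finish υ vis = trans (cong-app (Visited.J≡ vis) 0) J≡ , (Visited.live vis , cur≡0′) , λ i i< i≢q → at i i< i≢q (toℕ i ℕ.≟ j)
          where
          cur≡0′ : V.cur υ ≡ 0#
          cur≡0′ = trans (Visited.cur≡ vis) cur≡0
          inv′ = Live.inv (Visited.live vis)
          at : ∀ i → toℕ i ℕ.< suc j → toℕ i ≢ q → Dec (toℕ i ≡ j) → V.D υ (s i) ≡ 0#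
          at i i<1+j i≢q (no p) with d ← done i (ℕ.≤∧≢⇒< (ℕ.≤-pred i<1+j) p) i≢q =
            trans (proj₂ (Visited.persist vis (s i) (D≡0⇒discovered lv d))) d
          at i _ i≢q (yes refl) = subst (λ i → V.D υ (s i) ≡ 0#) (Fin.toℕ-injective toℕ-j)
            (trans (Found.D≡ (discovered-D≡ inv′ (Visited.seen vis)))
              (trans (cong₂ _+_ A≡0 (terminals jᶠ)) (+-identityˡ 0#)))
            where
            -- Whether or not this visit was the first one, a discovered vertex satisfies 0 ≤ A ≤
            -- cur = 0.
            A≡0 : V.A υ (s jᶠ) ≡ 0#
            A≡0 with A≤ , 0≤A ← discovered-A≤ inv′ (Visited.seen vis) = ≤-antisym (≤-trans A≤ (≤-reflexive cur≡0′)) 0≤A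

  -- the sweep

  ∧-false : ∀ {a b} → not a ∧ b ≡ false → a ≡ true ⊎ b ≡ false
  ∧-false {true}  _ = inj₁ refl
  ∧-false {false} e = inj₂ e

  ∧-true : ∀ {a b} → not a ∧ b ≡ true → a ≡ false × b ≡ true
  ∧-true {false} e = refl , e

  Runs-keep-best : ∀ {σ} → Runs keep-best σ (time keep-best) (λ τ → KeptBest (view σ) (V.best τ) (V.θ τ))
  Runs-keep-best {σ} = Runs-if
    (λ e → let (a , b) = ∧-true e in Runs-straight skip refl
      (kept (inj₁ (does-false (V.cur σ ≤? 0#) a , does-true (V.best σ ≤? V.W σ) b , refl , refl))))
    (λ e → Runs-straight (BEST ≔ᵣ varᵣ W ⨾ THETA ≔ᵣ varᵣ CUR) refl
      (kept (inj₂ (Sum.map (does-true (V.cur σ ≤? 0#)) (≰⇒≥ ∘ does-false (V.best σ ≤? V.W σ)) (∧-false e) , refl , refl))))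

  private
    view-keep : ∀ {σ τ} → nats τ DISC ≡ nats σ DISC → nats τ LAB ≡ nats σ LAB → scalars τ A ≡ scalars σ A →
      scalars τ D ≡ scalars σ D → scalars τ KEY ≡ scalars σ KEY → scalars τ W ≡ scalars σ W →
      view τ ≡ record (view σ) { cur = V.cur τ ; best = V.best τ ; θ = V.θ τ }
    view-keep {σ} {τ} = go
      where
      go : ∀ {d l : ℕ → ℕ} {a d′ k w : ℕ → Carrier} → d ≡ nats σ DISC → l ≡ nats σ LAB → a ≡ scalars σ A → d′ ≡ scalars σ D →
        k ≡ scalars σ KEY → w ≡ scalars σ W →
        arrays d l a d′ k (V.cur τ) (w 0) (V.best τ) (V.θ τ) ≡ record (view σ) { cur = V.cur τ ; best = V.best τ ; θ = V.θ τ }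
      go refl refl refl refl refl refl = refl

  record Advanced (q : ℕ) (u : Fin n) (σ τ : State R) : Set (c ⊔ ℓ) where
    field
      live : Live q u-any [] τ
      key≡ : V.key τ u ≡ V.cur τ

  Runs-advance : ∀ {q u σ} → Live q u-any [] σ → key-of σ 1 ≡ V.key σ u → ¬ ½ ≤ key-of σ 1 →
    Runs advance σ (time advance) (Advanced q u σ)
  Runs-advance {q} {u} {σ} lv key≡ key<½ = Runs-if
    (λ e → let κ≤cur = does-true (key-of σ 1 ≤? V.cur σ) e in Runs-straight skip refl (record
      { live = lv ; key≡ = ≤-antisym (≤-trans (≤-reflexive (sym key≡)) κ≤cur) cur≤key }))
    (λ e → Runs-seq (Runs-frame Runs-keep-best) λ υ (kb , fr) →
      let keys = same-scalars fr KEY refl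
          cur<κ = does-false (key-of σ 1 ≤? V.cur σ) e
      in Runs-straight (CUR ≔ᵣ getᵣ KEY (lit 1)) refl (record
        { live = record
            { static = Static-frame (CUR ≔ᵣ getᵣ KEY (lit 1)) refl (⇓-frame ⇓setᵣ) (Static-frame keep-best refl fr (Live.static lv))
            ; excluded = trans (cong-app (same-nats fr Q refl) 0) (Live.excluded lv)
            ; tree = subst₂ (Tree n) (sym keys) (sym (same-nats fr TOP refl)) (Live.tree lv)
            ; inv = subst (λ a → Inv q a u-any [])
                (sym (view-keep {σ} {exec (CUR ≔ᵣ getᵣ KEY (lit 1)) υ} (same-nats fr DISC refl) (same-nats fr LAB refl)
                  (same-scalars fr A refl) (same-scalars fr D refl) keys (same-scalars fr W refl)))
                (subst (λ z → Inv q (record (view σ) { cur = z ; best = V.best υ ; θ = V.θ υ }) u-any []) (sym (cong-app keys 1))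
                  (Inv-advance (Live.inv lv) cur<κ (≰⇒≥ key<½) κ-min key<½ kb)) }
        ; key≡ = trans (cong-app keys (n ℕ.+ toℕ u)) (trans (sym key≡) (sym (cong-app keys 1))) }))
    where
    u-queued : V.disc σ u ≡ 1 × V.key σ u ≡ V.D σ u
    u-queued = key<½⇒queued (Live.inv lv) (λ p → key<½ (≤-resp₂ refl (sym key≡) p))
    root≤ : ∀ v → key-of σ 1 ≤ V.key σ v
    root≤ v = Tree.root-min (Live.tree lv) (n ℕ.+ toℕ v) (ℕ.≤-trans 1≤n (ℕ.m≤m+n n _)) (ℕ.+-monoʳ-< n (Fin.toℕ<n v))
    κ-min : ∀ v → V.disc σ v ≡ 1 → key-of σ 1 ≤ V.D σ v
    κ-min v e with Inv.vertex (Live.inv lv) v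
    ... | undiscovered e′ _ _   = contradiction (trans (sym e) e′) λ ()
    ... | queued _ k _ _ _      = ≤-resp₂ refl k (root≤ v)
    ... | settled e′ _ _ _ _    = contradiction (trans (sym e) e′) λ ()
    cur≤key : V.cur σ ≤ V.key σ u
    cur≤key with Inv.vertex (Live.inv lv) u
    ... | undiscovered e′ _ _   = contradiction (trans (sym (proj₁ u-queued)) e′) λ ()
    ... | queued _ k c≤ _ _     = ≤-resp₂ refl (sym k) c≤
    ... | settled e′ _ _ _ _    = contradiction (trans (sym (proj₁ u-queued)) e′) λ ()

  record Settled (u : Fin n) (σ τ : State R) : Set c where
    field
      V≡        : nats τ V 0 ≡ toℕ u
      disc-new  : Updated (V.disc σ) (V.disc τ) u 2
      key-new   : Updated (V.key σ) (V.key τ) u 1#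
      key-other : ∀ j → j ≢ n ℕ.+ toℕ u → key-of τ j ≡ key-of σ j
      W≡        : V.W τ ≡ V.W σ - w u
      P≡        : nats τ P 0 ≡ nats σ HEAD (toℕ u)

  Runs-settle : ∀ {σ u} → Static σ → nats σ U 0 ≡ toℕ u → Runs settle σ (time settle) (Settled u σ)
  Runs-settle {σ} {u} st U≡ = Runs-straight settle refl record
    { V≡ = U≡
    ; disc-new = Updated-at U≡ refl (λ _ → refl)
    ; key-new = proj₁ leaf
    ; key-other = proj₂ leaf
    ; W≡ = cong (λ z → V.W σ - z) (trans (cong (scalars σ WT) U≡) (Static.w≡ st u))
    ; P≡ = cong (nats σ HEAD) U≡ }
    where
    leaf = Updated-leaf {f = key-of σ} {f′ = key-of (exec settle σ)} (cong₂ ℕ._+_ (Static.n≡ st) U≡) refl (λ _ → refl)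

  record Removed (q : ℕ) (u : Fin n) (σ τ : State R) : Set (c ⊔ ℓ) where
    field
      live     : Live q u (nbrs u) τ
      U≡       : nats τ U 0 ≡ toℕ u
      disc-new : Updated (V.disc σ) (V.disc τ) u 2
      D≡       : ∀ v → V.D τ v ≡ V.D σ v
      D≡cur    : V.D τ u ≡ V.cur τ
      chain    : ∃[ b ] Chain (nats τ NEXT) (nats τ TO) b (nats τ P 0) (nbrs u)

  Runs-remove : ∀ {q u σ} → Live q u-any [] σ → nats σ U 0 ≡ toℕ u → V.key σ u ≡ V.cur σ →
    Runs (settle ⨾ sift) σ (time settle ℕ.+ sift-time L) (Removed q u σ)
  Runs-remove {q} {u} {σ} lv U≡ key≡ = Runs-mono ℕ.≤-refl (λ { _ (f , fr) → f fr }) (Runs-frame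
    (Runs-seq (Runs-frame (Runs-settle (Live.static lv) U≡)) λ υ (e , fr₁) →
      let st₁ = Static-frame settle refl fr₁ (Live.static lv) in
      Runs-mono ℕ.≤-refl (λ τ (s , fr₂) fr → finish υ τ e fr₁ s fr₂ fr)
        (Runs-frame (Runs-sift (Static.n≡ st₁) (Settled.V≡ e) (Fin.toℕ<n u) (Static.parent st₁)
          (TreeBut-leaf u (Live.tree lv) (Settled.key-other e) (same-nats fr₁ TOP refl))))))
    where
    finish : ∀ υ τ → Settled u σ υ → Frame settle σ υ → Sifted n υ τ → Frame sift υ τ → Frame (settle ⨾ sift) σ τ → Removed q u σ τ
    finish υ τ e fr₁ s fr₂ fr = record
      { live = record
          { static = static
          ; excluded = trans (cong-app (same-nats fr Q refl) 0) (Live.excluded lv)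
          ; tree = Sifted.tree s
          ; inv = subst (λ a → Inv q a u (nbrs u)) (sym same)
              (Inv-settle (Live.inv lv) key≡ disc′
                (Updated-resp (λ t → Sifted.leaves s _ (ℕ.m≤m+n n (toℕ t))) (Settled.key-new e))
                (trans (cong-app (same-scalars fr₂ W refl) 0) (Settled.W≡ e))
                (λ v u~v → neighbours-complete edges u~v)) }
      ; U≡ = trans (cong-app (same-nats fr U refl) 0) U≡
      ; disc-new = disc′
      ; D≡ = λ v → cong-app (same-scalars fr D refl) (toℕ v)
      ; D≡cur = trans (cong-app (same-scalars fr D refl) (toℕ u)) (trans (sym (proj₂ u-queued))
          (trans key≡ (sym (cong-app (same-scalars fr CUR refl) 0))))
      ; chain = proj₁ (Static.chains static) , subst (λ p → Chain (nats τ NEXT) (nats τ TO) (proj₁ (Static.chains static)) p (nbrs u)) (sym P≡) (proj₂ (Static.chains static) u) }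
      where
      static = Static-frame (settle ⨾ sift) refl fr (Live.static lv)
      u-queued = key<½⇒queued (Live.inv lv) {u} (λ p → Inv.cur<½ (Live.inv lv) (≤-trans p (≤-reflexive key≡)))
      disc′ : Updated (V.disc σ) (V.disc τ) u 2
      disc′ = Updated-resp (λ t → cong-app (same-nats fr₂ DISC refl) (toℕ t)) (Settled.disc-new e)
      P≡ : nats τ P 0 ≡ nats τ HEAD (toℕ u)
      P≡ = trans (cong-app (same-nats fr₂ P refl) 0) (trans (Settled.P≡ e) (cong-app (sym (same-nats fr HEAD refl)) (toℕ u)))
      same : view τ ≡ record (view σ) { disc = V.disc τ ; key = V.key τ ; W = V.W τ }
      same = go (same-nats fr LAB refl) (same-scalars fr A refl) (same-scalars fr D refl) (same-scalars fr CUR refl)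
               (same-scalars fr BEST refl) (same-scalars fr THETA refl)
        where
        go : ∀ {l : ℕ → ℕ} {a d cu b t : ℕ → Carrier} → l ≡ nats σ LAB → a ≡ scalars σ A → d ≡ scalars σ D →
          cu ≡ scalars σ CUR → b ≡ scalars σ BEST → t ≡ scalars σ THETA →
          arrays (nats τ DISC) l a d (scalars τ KEY) (cu 0) (V.W τ) (b 0) (t 0) ≡
          record (view σ) { disc = V.disc τ ; key = V.key τ ; W = V.W τ }
        go refl refl refl refl refl refl = refl

  -- potential

  next-vertex next-slot extract : Cmd
  next-vertex = V ≔ get TO (var P) ⨾ LABEL ≔ get LAB (var U)
  next-slot = P ≔ get NEXT (var P)
  extract = U ≔ get TOP (lit 1)

  -- The constants are sealed: the budget identities treat them as atoms, and only the numerical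
  -- bounds at the end unfold them.
  opaque
    scan-exit search-exit next-time slot-time extract-time advance-time remove-time seen-time enqueue-time : ℕ
    scan-exit    = suc (costᵇ (lit 1 ≤ₙ var P))
    search-exit  = suc (costᵇ (notᵇ (varᵣ HALF ≤ᵣ getᵣ KEY (lit 1))))
    next-time    = time next-vertex
    slot-time    = time next-slot
    extract-time = time extract
    advance-time = time advance
    remove-time  = time settle ℕ.+ sift-time L
    seen-time    = old-time
    enqueue-time = new-cost

    scan-exit< : costᵇ (lit 1 ≤ₙ var P) ℕ.< scan-exit
    scan-exit< = ℕ.≤-refl

    search-exit< : costᵇ (notᵇ (varᵣ HALF ≤ᵣ getᵣ KEY (lit 1))) ℕ.< search-exit
    search-exit< = ℕ.≤-refl

    Runs-next-vertex : ∀ σ → Runs next-vertex σ next-time (_≡ exec next-vertex σ)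
    Runs-next-vertex = exec-⇓ next-vertex refl

    Runs-next-slot : ∀ σ → Runs next-slot σ slot-time (_≡ exec next-slot σ)
    Runs-next-slot = exec-⇓ next-slot refl

    Runs-extract : ∀ σ → Runs extract σ extract-time (_≡ exec extract σ)
    Runs-extract = exec-⇓ extract refl

    Runs-advance-time : ∀ {p σ} {Φ : State R → Set p} → Runs advance σ (time advance) Φ → Runs advance σ advance-time Φ
    Runs-advance-time r = r

    Runs-remove-time : ∀ {p σ} {Φ : State R → Set p} →
      Runs (settle ⨾ sift) σ (time settle ℕ.+ sift-time L) Φ → Runs (settle ⨾ sift) σ remove-time Φ
    Runs-remove-time r = r

    old-time≤ : old-time ℕ.≤ seen-time
    old-time≤ = ℕ.≤-refl

    visit-time≤ : visit-time ℕ.≤ seen-time ℕ.+ enqueue-time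
    visit-time≤ = s≤s (ℕ.+-monoˡ-≤ new-cost (ℕ.m≤m+n (costᵇ (get DISC (var V) =ₙ lit 0)) 1))

  slot-cost vertex-cost : ℕ
  slot-cost = scan-exit ℕ.+ (next-time ℕ.+ (seen-time ℕ.+ slot-time))
  vertex-cost = search-exit ℕ.+ (extract-time ℕ.+ (advance-time ℕ.+ (remove-time ℕ.+ scan-exit)))

  -- the time still to be spent on a vertex, given its state and its degree
  φ : ℕ → ℕ → ℕ
  φ 0 d             = enqueue-time ℕ.+ (vertex-cost ℕ.+ d ℕ.* slot-cost)
  φ 1 d             = vertex-cost ℕ.+ d ℕ.* slot-cost
  φ (suc (suc _)) d = 0

  degree : Fin n → ℕ
  degree v = List.length (nbrs v)

  potential : (Fin n → ℕ) → ℕ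
  potential disc = sum λ v → φ (disc v) (degree v)

  potential-cong : ∀ {d d′ : Fin n → ℕ} → (∀ v → d′ v ≡ d v) → potential d′ ≡ potential d
  potential-cong eq = sum-cong-≗ {n} λ v → cong (λ z → φ z (degree v)) (eq v)

  potential-new : ∀ {d d′ : Fin n → ℕ} {v} → d v ≡ 0 → Updated d d′ v 1 → potential d ≡ enqueue-time ℕ.+ potential d′
  potential-new {d} {d′} {v} e up = sum-update {f = λ t → φ (d′ t) (degree t)} v
    (trans (cong (λ z → φ z (degree v)) e) (cong (λ z → enqueue-time ℕ.+ φ z (degree v)) (sym (Updated.new up))))
    (λ t p → cong (λ z → φ z (degree t)) (sym (Updated.old up t p)))

  potential-settled : ∀ {d d′ : Fin n → ℕ} {v} → d v ≡ 1 → Updated d d′ v 2 →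
    potential d ≡ (vertex-cost ℕ.+ degree v ℕ.* slot-cost) ℕ.+ potential d′
  potential-settled {d} {d′} {v} e up = sum-update {f = λ t → φ (d′ t) (degree t)} v
    (trans (cong (λ z → φ z (degree v)) e) (trans (sym (ℕ.+-identityʳ _))
      (cong (λ z → (vertex-cost ℕ.+ degree v ℕ.* slot-cost) ℕ.+ φ z (degree v)) (sym (Updated.new up)))))
    (λ t p → cong (λ z → φ z (degree t)) (sym (Updated.old up t p)))

  -- Beyond `seen-time`, a visit is paid by the potential: a first discovery takes `φ` from state 0
  -- to state 1 and releases `enqueue-time`, which covers the `sift`.
  Spends-visit : ∀ {q u₀ l σ v r k₀} {i : Fin k} → Live q u₀ l σ → nats σ V 0 ≡ toℕ v → nats σ LABEL 0 ≡ toℕ i →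
    toℕ i ≢ q → Walk i v r → len∑ r ≡ V.cur σ →
    Spends visit σ (seen-time ℕ.+ (potential (V.disc σ) ℕ.+ k₀))
      (λ k′ τ → k′ ≡ potential (V.disc τ) ℕ.+ k₀ × Visited q u₀ l v σ τ)
  Spends-visit {q} {u₀} {l} {σ} {v} {k₀ = k₀} lv V≡ L≡ i≢q wk len≡ = cases (V.disc σ v ℕ.≟ 0)
    where
    cases : Dec (V.disc σ v ≡ 0) → Spends visit σ (seen-time ℕ.+ (potential (V.disc σ) ℕ.+ k₀))
      (λ k′ τ → k′ ≡ potential (V.disc τ) ℕ.+ k₀ × Visited q u₀ l v σ τ)
    cases (no p) = old (Runs-visit-old lv V≡ L≡ i≢q wk len≡ p)
      where
      old : Runs visit σ old-time (λ τ → Visited q u₀ l v σ τ × nats τ DISC ≡ nats σ DISC) → _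
      old (t , τ , r , t≤ , vis , disc≡) = t , τ , _ , r , ℕ.+-mono-≤ (ℕ.≤-trans t≤ old-time≤) (ℕ.≤-reflexive (cong (ℕ._+ k₀)
        (potential-cong {V.disc σ} {V.disc τ} (λ v → cong-app disc≡ (toℕ v))))) , refl , vis
    cases (yes p) = new (Runs-visit-new lv V≡ L≡ i≢q wk len≡ p)
      where
      new : Runs visit σ visit-time (λ τ → Visited q u₀ l v σ τ × Updated (V.disc σ) (V.disc τ) v 1) → _
      new (t , τ , r , t≤ , vis , up) = t , τ , _ , r , ℕ.≤-trans (ℕ.+-monoˡ-≤ _ (ℕ.≤-trans t≤ visit-time≤)) (ℕ.≤-reflexive bound) , refl , vis
        where
        bound : seen-time ℕ.+ enqueue-time ℕ.+ (potential (V.disc τ) ℕ.+ k₀) ≡ seen-time ℕ.+ (potential (V.disc σ) ℕ.+ k₀)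
        bound = trans (solve 4 (λ a b p k → a :+ b :+ (p :+ k) := a :+ (b :+ p :+ k)) refl
            seen-time enqueue-time (potential (V.disc τ)) k₀)
          (cong (λ z → seen-time ℕ.+ (z ℕ.+ k₀)) (sym (potential-new {V.disc σ} {V.disc τ} p up)))

  record Scanned (q : ℕ) (τ : State R) : Set (c ⊔ ℓ) where
    field
      live    : Live q u-any [] τ
      sourced : Sourced q τ

  record Finished (q : ℕ) (τ : State R) : Set (c ⊔ ℓ) where
    field
      live    : Live q u-any [] τ
      sourced : Sourced q τ
      far     : ½ ≤ key-of τ 1

  Inv-nothing-pending : ∀ {q a u u′} → Inv q a u [] → Inv q a u′ []
  Inv-nothing-pending inv = record
    { 0≤cur = Inv.0≤cur inv ; cur<½ = Inv.cur<½ inv ; vertex = λ v → vertex′ (Inv.vertex inv v) ; W≡ = Inv.W≡ inv ; record-best = Inv.record-best inv }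
    where
    vertex′ : ∀ {v} → Vertex _ _ _ [] v → Vertex _ _ _ [] v
    vertex′ (undiscovered a b c) = undiscovered a b c
    vertex′ (queued a b c d e) = queued a b c d e
    vertex′ (settled a b c d e) = settled a b c d λ u v~u → Sum.map₁ (λ { (_ , ()) }) (e u v~u)

  -- Pending slots are prepaid by the degree term that `φ` released when u was settled; the
  -- potential itself pays only for new discoveries.
  Spends-scan : ∀ {q u σ k₀} → Live q u (nbrs u) σ → nats σ U 0 ≡ toℕ u → V.disc σ u ≢ 0 → V.D σ u ≡ V.cur σ →
    ∃[ b ] Chain (nats σ NEXT) (nats σ TO) b (nats σ P 0) (nbrs u) → Sourced q σ →
    Spends scan σ (potential (V.disc σ) ℕ.+ (degree u ℕ.* slot-cost ℕ.+ (scan-exit ℕ.+ k₀)))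
      (λ k′ τ → k′ ≡ potential (V.disc τ) ℕ.+ k₀ × Scanned q τ)
  Spends-scan {q} {u} {σ} {k₀} lv U-u du D-u ch src = Spends-while Inv′ scan-exit scan-exit< step exit _
    (nbrs u , refl , record { live = lv ; U≡ = U-u ; seen = du ; D≡ = D-u ; chain = ch ; sourced = src ; adjacent = λ v p → neighbours-sound edges p })
    where
    record At (l : List (Fin n)) (τ : State R) : Set (c ⊔ ℓ) where
      field
        live     : Live q u l τ
        U≡       : nats τ U 0 ≡ toℕ u
        seen     : V.disc τ u ≢ 0
        D≡       : V.D τ u ≡ V.cur τ
        chain    : ∃[ b ] Chain (nats τ NEXT) (nats τ TO) b (nats τ P 0) l
        sourced  : Sourced q τ
        adjacent : ∀ v → v ∈ l → Adj u v
    budget : ℕ → ℕ → ℕ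
    budget d p = p ℕ.+ (d ℕ.* slot-cost ℕ.+ (scan-exit ℕ.+ k₀))
    Inv′ : ℕ → State R → Set _
    Inv′ k τ = ∃[ l ] k ≡ budget (List.length l) (potential (V.disc τ)) × At l τ
    exit : ∀ k τ → Inv′ k τ → evalᵇ R τ (lit 1 ≤ₙ var P) ≡ false →
      ∃[ k₁ ] scan-exit ℕ.+ k₁ ℕ.≤ k × k₁ ≡ potential (V.disc τ) ℕ.+ k₀ × Scanned q τ
    exit k τ (l , refl , at) e = done l refl (proj₂ (At.chain at)) at
      where
      done : ∀ {b p} l → p ≡ nats τ P 0 → Chain (nats τ NEXT) (nats τ TO) b p l → At l τ →
        ∃[ k₁ ] scan-exit ℕ.+ k₁ ℕ.≤ budget (List.length l) (potential (V.disc τ)) × k₁ ≡ potential (V.disc τ) ℕ.+ k₀ × Scanned q τ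
      done [] _ nil at = _ , ℕ.≤-reflexive (solve 3 (λ a p k → a :+ (p :+ k) := p :+ (a :+ k)) refl scan-exit (potential (V.disc τ)) k₀) , refl , record
        { live = record { static = Live.static (At.live at) ; excluded = Live.excluded (At.live at) ; tree = Live.tree (At.live at)
                        ; inv = Inv-nothing-pending (Live.inv (At.live at)) }
        ; sourced = At.sourced at }
      done (_ ∷ _) P≡ (link 1≤p _ _ _) at = contradiction (subst (1 ℕ.≤_) P≡ 1≤p) (ℕ.<⇒≱ (≤ᵇ-false {1} e))
    module Step (τ : State R) {v l b} (at : At (v ∷ l) τ) (to≡ : nats τ TO (nats τ P 0) ≡ toℕ v)
                (ch : Chain (nats τ NEXT) (nats τ TO) b (nats τ NEXT (nats τ P 0)) l) where
      fu : Found q (V.A τ u) (V.D τ u) (V.lab τ u) u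
      fu = discovered-D≡ (Live.inv (At.live at)) (At.seen at)
      live₁ : Live q u (v ∷ l) (exec next-vertex τ)
      live₁ = record { static = Static-frame next-vertex refl (⇓-frame (⇓seq ⇓set ⇓set)) (Live.static (At.live at))
                     ; excluded = Live.excluded (At.live at) ; tree = Live.tree (At.live at) ; inv = Live.inv (At.live at) }
      visited : ∀ {k} → Spends visit (exec next-vertex τ) (seen-time ℕ.+ (potential (V.disc τ) ℕ.+ k))
        (λ k′ υ → k′ ≡ potential (V.disc υ) ℕ.+ k × Visited q u (v ∷ l) v (exec next-vertex τ) υ)
      visited = Spends-visit {v = v} {r = u ∷ Found.route fu} {i = Found.terminal fu} live₁
        to≡ (trans (cong (nats τ LAB) (At.U≡ at)) (Found.lab≡ fu)) (Found.lab≢q fu)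
        (record { linked = Adj-sym (At.adjacent at v (here refl)) ∷ Walk.linked (Found.walk fu) ; ends = Walk.ends (Found.walk fu) })
        (trans (+-comm _ _) (trans (cong (_+ x u) (Found.A≡ fu)) (trans (sym (Found.D≡ fu)) (At.D≡ at))))
      module _ {υ} (vis : Visited q u (v ∷ l) v (exec next-vertex τ) υ) where
        live₂ = Visited.live vis
        moved : ∀ {next next′ to to′ : ℕ → ℕ} {b p p′ l} → next′ ≡ next → to′ ≡ to → p′ ≡ p →
                Chain {n} next to b (next p) l → Chain next′ to′ b (next′ p′) l
        moved refl refl refl ch = ch
        Du≡ : V.D υ u ≡ V.cur υ
        Du≡ = trans (proj₂ (Visited.persist vis u (At.seen at))) (trans (At.D≡ at) (sym (Visited.cur≡ vis)))
        A≤D′ : V.A υ v ≤ V.D υ u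
        A≤D′ = ≤-trans (proj₁ (discovered-A≤ (Live.inv live₂) (Visited.seen vis))) (≤-reflexive (sym Du≡))
        after : At l (exec next-slot υ)
        after = record
          { live = record { static = Static-frame next-slot refl (⇓-frame ⇓set) (Live.static live₂) ; excluded = Live.excluded live₂
                          ; tree = Live.tree live₂ ; inv = Inv-visited (Live.inv live₂) A≤D′ }
          ; U≡ = trans (cong-app (Visited.U≡ vis) 0) (At.U≡ at)
          ; seen = proj₁ (Visited.persist vis u (At.seen at))
          ; D≡ = Du≡
          ; chain = b , moved (Visited.NEXT≡ vis) (Visited.TO≡ vis) (cong-app (Visited.P≡ vis) 0) ch
          ; sourced = λ i i≢q → trans (proj₂ (Visited.persist vis (s i) (D≡0⇒discovered (At.live at) (At.sourced at i i≢q)))) (At.sourced at i i≢q)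
          ; adjacent = λ v p → At.adjacent at v (there p) }
    step : ∀ k τ → Inv′ k τ → evalᵇ R τ (lit 1 ≤ₙ var P) ≡ true →
      ∃[ k₁ ] scan-exit ℕ.+ k₁ ℕ.≤ k × Spends (next-vertex ⨾ visit ⨾ next-slot) τ k₁ Inv′
    step k τ (l , refl , at) e = go l refl (proj₂ (At.chain at)) at
      where
      go : ∀ {b p} l → p ≡ nats τ P 0 → Chain (nats τ NEXT) (nats τ TO) b p l → At l τ →
        ∃[ k₁ ] scan-exit ℕ.+ k₁ ℕ.≤ budget (List.length l) (potential (V.disc τ)) × Spends (next-vertex ⨾ visit ⨾ next-slot) τ k₁ Inv′
      go [] P≡ nil at = contradiction (subst (1 ℕ.≤_) (sym P≡) (≤ᵇ-true {1} e)) λ ()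
      go (v ∷ l) refl (link {v = v} _ _ to≡ ch) at =
        next-time ℕ.+ (seen-time ℕ.+ (potential (V.disc τ) ℕ.+ (slot-time ℕ.+ (d ℕ.+ (scan-exit ℕ.+ k₀))))) ,
        ℕ.≤-reflexive (solve 7 (λ s n o p t d k → s :+ (n :+ (o :+ (p :+ (t :+ (d :+ (s :+ k)))))) :=
                                               p :+ ((s :+ (n :+ (o :+ t)) :+ d) :+ (s :+ k))) refl
          scan-exit next-time seen-time (potential (V.disc τ)) slot-time d k₀) ,
        Spends-seq (Runs⇒Spends _ (Runs-next-vertex τ)) λ { _ _ (refl , refl) → Spends-seq (Step.visited τ at to≡ ch)
          λ { _ υ (refl , vis) → Spends-mono
            (ℕ.≤-reflexive (solve 5 (λ p t d e k → t :+ (p :+ (d :+ (e :+ k))) := p :+ (t :+ (d :+ (e :+ k)))) refl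
                (potential (V.disc υ)) slot-time d scan-exit k₀))
            (λ { _ _ (refl , refl) → l , refl , Step.after τ at to≡ ch vis })
            (Runs⇒Spends (budget (List.length l) (potential (V.disc υ))) (Runs-next-slot υ)) } }
        where d = List.length l ℕ.* slot-cost

  -- Settling u releases `vertex-cost` for the fixed work of the round and `degree u` slots for its
  -- scan. The initial potential therefore bounds the whole search, without a separate count of
  -- rounds.
  Spends-search : ∀ {q σ} → Scanned q σ →
    Spends search σ (potential (V.disc σ) ℕ.+ search-exit) (λ _ τ → Finished q τ)
  Spends-search {q} {σ} sc = Spends-while Inv′ search-exit search-exit< step exit _ (refl , sc)
    where
    Inv′ : ℕ → State R → Set _
    Inv′ k τ = k ≡ potential (V.disc τ) ℕ.+ search-exit × Scanned q τ
    exit : ∀ k τ → Inv′ k τ → evalᵇ R τ (notᵇ (varᵣ HALF ≤ᵣ getᵣ KEY (lit 1))) ≡ false →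
      ∃[ k₁ ] search-exit ℕ.+ k₁ ℕ.≤ k × Finished q τ
    exit k τ (refl , sc) e = _ , ℕ.≤-reflexive (ℕ.+-comm search-exit (potential (V.disc τ))) , record
      { live = Scanned.live sc ; sourced = Scanned.sourced sc
      ; far = ≤-resp₂ (Static.half (Live.static (Scanned.live sc))) refl
                (does-true (scalars τ HALF 0 ≤? key-of τ 1) (not-injective e)) }
    module Step (τ : State R) (sc : Scanned q τ) (e : evalᵇ R τ (notᵇ (varᵣ HALF ≤ᵣ getᵣ KEY (lit 1))) ≡ true) where
      live₀ = Scanned.live sc
      key<½ : ¬ ½ ≤ key-of τ 1
      key<½ p = does-false (scalars τ HALF 0 ≤? key-of τ 1) (not-injective e)
        (≤-resp₂ (sym (Static.half (Live.static live₀))) refl p)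
      root = Tree.root-leaf (Live.tree live₀) 1≤n
      u : Fin n
      u = fromℕ< (proj₁ root)
      u≡ : top-of τ 1 ≡ toℕ u
      u≡ = sym (Fin.toℕ-fromℕ< (proj₁ root))
      key≡ : key-of τ 1 ≡ V.key τ u
      key≡ = trans (sym (proj₂ root)) (cong (λ j → key-of τ (n ℕ.+ j)) u≡)
      u-queued : V.disc τ u ≡ 1
      u-queued = proj₁ (key<½⇒queued (Live.inv live₀) (λ p → key<½ (≤-resp₂ refl (sym key≡) p)))
      -- The budget of the round must be named before the round is run, so the discovery states
      -- after the removal of u are predicted here.
      disc′ : Fin n → ℕ
      disc′ v = if does (v Fin.≟ u) then 2 else V.disc τ v
      disc′-new : Updated (V.disc τ) disc′ u 2
      disc′-new = updated at off
        where
        at : disc′ u ≡ 2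
        at with u Fin.≟ u
        ... | yes _ = refl
        ... | no p  = contradiction refl p
        off : ∀ v → v ≢ u → disc′ v ≡ V.disc τ v
        off v p with v Fin.≟ u
        ... | yes q = contradiction q p
        ... | no _  = refl
      live₁ : Live q u-any [] (exec extract τ)
      live₁ = record { static = Static-frame extract refl (⇓-frame ⇓set) (Live.static live₀) ; excluded = Live.excluded live₀
                     ; tree = Live.tree live₀ ; inv = Live.inv live₀ }
      d = degree u ℕ.* slot-cost
      module _ {υ υ′} (ad : Advanced q u (exec extract τ) υ) (fr : Frame advance (exec extract τ) υ) (re : Removed q u υ υ′) where
        disc≡ : potential (V.disc υ′) ≡ potential disc′
        disc≡ = potential-cong {disc′} {V.disc υ′} λ v → pointwise v (v Fin.≟ u)
          where
          pointwise : ∀ v → Dec (v ≡ u) → V.disc υ′ v ≡ disc′ v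
          pointwise v (yes refl) = trans (Updated.new (Removed.disc-new re)) (sym (Updated.new disc′-new))
          pointwise v (no p) = trans (Updated.old (Removed.disc-new re) v p)
            (trans (cong-app (same-nats fr DISC refl) (toℕ v)) (sym (Updated.old disc′-new v p)))
        scanned : Spends scan υ′ (potential disc′ ℕ.+ (d ℕ.+ (scan-exit ℕ.+ search-exit))) Inv′
        scanned = subst (λ z → Spends scan υ′ (z ℕ.+ (d ℕ.+ (scan-exit ℕ.+ search-exit))) Inv′) disc≡
          (Spends-scan (Removed.live re) (Removed.U≡ re) (λ z → contradiction (trans (sym (Updated.new (Removed.disc-new re))) z) λ ())
            (Removed.D≡cur re) (Removed.chain re)
            (λ i i≢q → trans (Removed.D≡ re (s i)) (trans (cong-app (same-scalars fr D refl) (toℕ (s i))) (Scanned.sourced sc i i≢q))))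
    step : ∀ k τ → Inv′ k τ → evalᵇ R τ (notᵇ (varᵣ HALF ≤ᵣ getᵣ KEY (lit 1))) ≡ true →
      ∃[ k₁ ] search-exit ℕ.+ k₁ ℕ.≤ k × Spends (extract ⨾ advance ⨾ (settle ⨾ sift) ⨾ scan) τ k₁ Inv′
    step k τ (refl , sc) e =
      extract-time ℕ.+ (advance-time ℕ.+ (remove-time ℕ.+ (potential disc′ ℕ.+ (d ℕ.+ (scan-exit ℕ.+ search-exit))))) ,
      ℕ.≤-reflexive (trans
        (solve 7 (λ e x a r p d s → e :+ (x :+ (a :+ (r :+ (p :+ (d :+ (s :+ e)))))) := (e :+ (x :+ (a :+ (r :+ s))) :+ d) :+ p :+ e) refl
          search-exit extract-time advance-time remove-time (potential disc′) d scan-exit)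
        (cong (ℕ._+ search-exit) (sym (potential-settled {V.disc τ} {disc′} u-queued disc′-new)))) ,
      Spends-seq (Runs⇒Spends _ (Runs-extract τ)) λ { _ _ (refl , refl) →
      Spends-seq (Runs⇒Spends _ (Runs-frame (Runs-advance-time (Runs-advance live₁ key≡ key<½)))) λ { _ υ (refl , ad , fr) →
      Spends-seq (Runs⇒Spends _ (Runs-remove-time (Runs-remove (Advanced.live ad)
        (trans (cong-app (same-nats fr U refl) 0) u≡) (Advanced.key≡ ad)))) λ { _ υ′ (refl , re) →
      scanned ad fr re } } }
      where open Step τ sc e

  -- a complete pass

  sum-linear : ∀ {n a b} {f g : Fin n → ℕ} → (∀ i → f i ℕ.≤ a ℕ.+ g i ℕ.* b) → sum f ℕ.≤ n ℕ.* a ℕ.+ sum g ℕ.* b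
  sum-linear {zero} p = z≤n
  sum-linear {suc n} {a} {b} {f} {g} p = ℕ.≤-trans (ℕ.+-mono-≤ (p zero) (sum-linear (p ∘ suc)))
    (ℕ.≤-reflexive (solve 5 (λ a g b na r → a :+ g :* b :+ (na :+ r :* b) := a :+ na :+ (g :+ r) :* b) refl
      a (g zero) b (n ℕ.* a) (sum (g ∘ suc))))

  search-time : ℕ
  search-time = (n ℕ.* (enqueue-time ℕ.+ vertex-cost) ℕ.+ (m ℕ.+ m) ℕ.* slot-cost) ℕ.+ search-exit

  -- A vertex is worth most while it is undiscovered, and the degrees sum to 2m.
  potential≤ : ∀ d → potential d ℕ.+ search-exit ℕ.≤ search-time
  potential≤ d = ℕ.+-monoˡ-≤ search-exit (ℕ.≤-trans (sum-linear {g = degree} (λ v → φ≤ (d v) (degree v)))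
    (ℕ.≤-reflexive (cong (λ z → n ℕ.* (enqueue-time ℕ.+ vertex-cost) ℕ.+ z ℕ.* slot-cost) (neighbours-length edges))))
    where
    φ≤ : ∀ d g → φ d g ℕ.≤ (enqueue-time ℕ.+ vertex-cost) ℕ.+ g ℕ.* slot-cost
    φ≤ 0 g = ℕ.≤-reflexive (sym (ℕ.+-assoc enqueue-time vertex-cost (g ℕ.* slot-cost)))
    φ≤ 1 g = ℕ.+-monoˡ-≤ (g ℕ.* slot-cost) (ℕ.m≤n+m vertex-cost enqueue-time)
    φ≤ (suc (suc _)) g = z≤n

  record Passed (q : ℕ) (τ : State R) : Set (c ⊔ ℓ) where
    field
      static    : Static τ
      distances : Distances q (V.A τ) (V.D τ) (V.lab τ)
      0≤θ       : 0# ≤ V.θ τ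
      θ<½       : ¬ ½ ≤ V.θ τ
      good      : Distances.cutWeight distances (V.θ τ) * ½ ≤ ∑ (λ v → w v * Distances.length distances v)

  pass-time : ℕ
  pass-time = clear-time ℕ.+ (grow-time ℕ.+ (time reset ℕ.+ (sources-time ℕ.+ (search-time ℕ.+ time keep-best))))

  Runs-pass : ∀ {q σ} → Static σ → nats σ Q 0 ≡ q → Runs pass σ pass-time (Passed q)
  Runs-pass {q} {σ} st Q≡ =
    Runs-seq (Runs-frame (Runs-clear (Static.n≡ st))) λ σ₁ (cl , fr₁) →
    let st₁ = Static-frame clear refl fr₁ st in
    Runs-seq (Runs-frame (Runs-grow (Static.n≡ st₁) (λ v v<n → ClearedAt.top≡ (cl v v<n)))) λ σ₂ (gr , fr₂) →
    let st₂ = Static-frame grow refl fr₂ st₁ in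
    Runs-seq (Runs-frame (Runs-straight {Φ = λ τ → V.cur τ ≡ 0# × V.W τ ≡ 0#} reset refl (refl , refl))) λ σ₃ ((cur≡ , W≡) , fr₃) →
    Runs-seq (Runs-sources (initial σ₁ σ₂ σ₃ st₂ fr₁ cl gr fr₂ fr₃ cur≡ W≡)) λ σ₄ ((live , _) , src) →
    Runs-seq (Runs-mono (potential≤ (V.disc σ₄)) (λ _ → proj₂) (Spends⇒Runs (Spends-search (record { live = live ; sourced = src })))) λ σ₅ fin →
    Runs-mono ℕ.≤-refl (λ σ₆ (kb , fr) → final σ₅ σ₆ fin kb fr) (Runs-frame Runs-keep-best)
    where
    initial : ∀ σ₁ σ₂ σ₃ → Static σ₂ → Frame clear σ σ₁ → (∀ i → i ℕ.< n → ClearedAt σ₁ i) → Grown σ₁ σ₂ → Frame grow σ₁ σ₂ →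
      Frame reset σ₂ σ₃ → V.cur σ₃ ≡ 0# → V.W σ₃ ≡ 0# → Started q σ₃
    initial σ₁ σ₂ σ₃ st₂ fr₁ cl gr fr₂ fr₃ cur≡ W≡ = record
      { static = Static-frame reset refl fr₃ st₂
      ; excluded = trans (cong-app (trans (same-nats fr₃ Q refl) (trans (same-nats fr₂ Q refl) (same-nats fr₁ Q refl))) 0) Q≡
      ; tree = subst₂ (Tree n) (sym (same-scalars fr₃ KEY refl)) (sym (same-nats fr₃ TOP refl)) (Grown.tree gr)
      ; inv = record
          { 0≤cur = ≤-reflexive (sym cur≡)
          ; cur<½ = λ p → ½≰0 (≤-resp₂ refl cur≡ p)
          ; vertex = λ v → undiscovered (disc≡ v)
              (trans (cong-app (same-scalars fr₃ KEY refl) (n ℕ.+ toℕ v))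
                (trans (Grown.leaves gr _ (ℕ.m≤m+n n (toℕ v))) (ClearedAt.key≡ (at v))))
              (record
                { A≡1 = trans (cong-app (trans (same-scalars fr₃ A refl) (same-scalars fr₂ A refl)) (toℕ v)) (ClearedAt.A≡ (at v))
                ; D≡1 = trans (cong-app (trans (same-scalars fr₃ D refl) (same-scalars fr₂ D refl)) (toℕ v)) (ClearedAt.D≡ (at v))
                ; lab≡0 = trans (cong-app (trans (same-nats fr₃ LAB refl) (same-nats fr₂ LAB refl)) (toℕ v)) (ClearedAt.lab≡ (at v)) })
          ; W≡ = trans W≡ (sym (trans (∑-cong λ v → cong (λ d → if d ≡ᵇ 1 then w v else 0#) (disc≡ v)) (∑-zero n)))
          ; record-best = inj₁ (≤-reflexive cur≡) } } , cur≡
      where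
      at = λ v → cl (toℕ v) (Fin.toℕ<n v)
      disc≡ : ∀ v → V.disc σ₃ v ≡ 0
      disc≡ v = trans (cong-app (trans (same-nats fr₃ DISC refl) (same-nats fr₂ DISC refl)) (toℕ v)) (ClearedAt.disc≡ (at v))
    final : ∀ σ₅ σ₆ → Finished q σ₅ → KeptBest (view σ₅) (V.best σ₆) (V.θ σ₆) → Frame keep-best σ₅ σ₆ → Passed q σ₆
    final σ₅ σ₆ fin kb fr = record
      { static = Static-frame keep-best refl fr (Live.static live)
      ; distances = distances′
      ; 0≤θ = Best.0≤θ best
      ; θ<½ = Best.θ<t best
      ; good = ≤-trans (≤-reflexive (cong (_* ½) (sym (Best.best≡ best)))) (Best.average best) }
      where
      live = Finished.live fin
      keys : ∀ v → ½ ≤ V.key σ₅ v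
      keys v = ≤-trans (Finished.far fin) (Tree.root-min (Live.tree live) (n ℕ.+ toℕ v) (ℕ.≤-trans 1≤n (ℕ.m≤m+n n _))
        (ℕ.+-monoʳ-< n (Fin.toℕ<n v)))
      κ-min : ∀ v → V.disc σ₅ v ≡ 1 → ½ ≤ V.D σ₅ v
      κ-min v e with Inv.vertex (Live.inv live) v
      ... | undiscovered e′ _ _   = contradiction (trans (sym e) e′) λ ()
      ... | queued _ k _ _ _      = ≤-resp₂ refl k (keys v)
      ... | settled e′ _ _ _ _    = contradiction (trans (sym e) e′) λ ()
      arrays≡ : ∀ {y} (Pr : (a d : ℕ → Carrier) (l : ℕ → ℕ) → Set y) →
        Pr (scalars σ₅ A) (scalars σ₅ D) (nats σ₅ LAB) → Pr (scalars σ₆ A) (scalars σ₆ D) (nats σ₆ LAB)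
      arrays≡ Pr = go (same-scalars fr A refl) (same-scalars fr D refl) (same-nats fr LAB refl)
        where
        go : ∀ {a d l a′ d′ l′} → a′ ≡ a → d′ ≡ d → l′ ≡ l → Pr a d l → Pr a′ d′ l′
        go refl refl refl p = p
      distances′ = arrays≡ (λ a d l → Distances q (a ∘ toℕ) (d ∘ toℕ) (l ∘ toℕ)) (Inv-final (Live.inv live) keys (Finished.sourced fin))
      -- The last interval ends at ½ instead of at a key. Taking κ = ½ completes the sweep, so that
      -- the average extends over all of [0 , ½).
      best = arrays≡ (λ a d l → Best (a ∘ toℕ) (d ∘ toℕ) (V.best σ₆) (V.θ σ₆) ½)
        (best-advance (Live.inv live) (Inv.cur<½ (Live.inv live)) ≤-refl κ-min kb)

-- The choice of the excluded terminal and the output.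

module Correctness {c ℓ} (R : OrderedField c ℓ) (ins : NodeMC R) (x : Fin (NodeMC.n ins) → OrderedField.Carrier R)
              (feasible : NodeMC.Feasible ins x) where
  open FieldProperties R hiding (solve; _:=_; _:+_; _:*_; _:-_; :-_; con; Polynomial)
  open NodeMC ins
  open Rounding R ins x feasible
  open Dijkstra R ins x feasible using (inCutᵇ)
  open Hoare R
  open Program
  open Verification R ins x feasible
  open Passes R ins x feasible

  -- choosing the excluded terminal

  Runs-truncate : ∀ y z {σ} → Runs (truncate y z) σ (time (truncate y z))
    (λ τ → scalars τ y 0 ≡ scalars σ z (nats σ J 0) ⊓ scalars σ HALF 0)
  Runs-truncate y z {σ} = Runs-if
    (λ e → Runs-straight (y ≔ᵣ getᵣ z (var J)) refl
      (trans same (sym (x≤y⇒x⊓y≈x (does-true (scalars σ z (nats σ J 0) ≤? scalars σ HALF 0) e)))))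
    (λ e → Runs-straight (y ≔ᵣ varᵣ HALF) refl
      (trans same (sym (x≤y⇒y⊓x≈x (≰⇒≥ (does-false (scalars σ z (nats σ J 0) ≤? scalars σ HALF 0) e))))))
    where
    same : ∀ {a b : Carrier} → (if (y ≡ᵇ y) ∧ true then a else b) ≡ a
    same {a} {b} = cong (λ t → if t ∧ true then a else b) (true-≡ᵇ {y} refl)

  add-profit : Cmd
  add-profit =
    setᵣ PROFIT (get LAB (var J))
      (getᵣ PROFIT (get LAB (var J)) ⊕ᵣ
        (getᵣ WT (var J) ⊗ᵣ (((varᵣ TMP₂ ⊖ᵣ varᵣ TMP₁) ⊕ᵣ (varᵣ TMP₂ ⊖ᵣ varᵣ TMP₁)) ⊖ᵣ getᵣ X (var J)))) ⨾
    J ≔ var J ⊕ lit 1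

  profit-time profits-time : ℕ
  profit-time = time (truncate TMP₁ A) ℕ.+ (time (truncate TMP₂ D) ℕ.+ time add-profit)
  profits-time = time (J ≔ lit 0) ℕ.+ (n ℕ.* suc (costᵇ (var J <ₙ N) ℕ.+ profit-time) ℕ.+ suc (costᵇ (var J <ₙ N)))

  module _ {σ} (st : Static σ) (all : Distances k (V.A σ) (V.D σ) (V.lab σ)) (zeros : ∀ i → scalars σ PROFIT i ≡ 0#) where
    open Averaging all

    partial : ℕ → ℕ → Carrier
    partial j i = ∑ λ v → if (suc (toℕ v) ≤ᵇ j) ∧ labelled i v then gain v else 0#

    private
      record At (j : ℕ) (τ : State R) : Set c where
        field
          J≡      : nats τ J 0 ≡ j
          static  : Static τ
          A≡      : scalars τ A ≡ scalars σ A
          D≡      : scalars τ D ≡ scalars σ D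
          LAB≡    : nats τ LAB ≡ nats σ LAB
          profit≡ : ∀ i → scalars τ PROFIT i ≡ partial j i

      partial-suc : ∀ v i → partial (suc (toℕ v)) i ≡ partial (toℕ v) i + (if labelled i v then gain v else 0#)
      partial-suc v i = ∑-update v at off
        where
        at : (if (suc (toℕ v) ≤ᵇ suc (toℕ v)) ∧ labelled i v then gain v else 0#) ≡
             (if (suc (toℕ v) ≤ᵇ toℕ v) ∧ labelled i v then gain v else 0#) + (if labelled i v then gain v else 0#)
        at rewrite true-≤ᵇ (ℕ.≤-refl {suc (toℕ v)}) | false-≤ᵇ (ℕ.n<1+n (toℕ v)) = sym (+-identityˡ _)
        off : ∀ u → u ≢ v → (if (suc (toℕ u) ≤ᵇ suc (toℕ v)) ∧ labelled i u then gain u else 0#) ≡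
                            (if (suc (toℕ u) ≤ᵇ toℕ v) ∧ labelled i u then gain u else 0#)
        off u u≢v with ℕ.<-cmp (toℕ u) (toℕ v)
        ... | tri< u<v _ _ rewrite true-≤ᵇ u<v | true-≤ᵇ (ℕ.m≤n⇒m≤1+n u<v) = refl
        ... | tri≈ _ e _ = contradiction (Fin.toℕ-injective e) u≢v
        ... | tri> _ _ v<u rewrite false-≤ᵇ {suc (toℕ u)} {toℕ v} (ℕ.m≤n⇒m≤1+n v<u)
                                       | false-≤ᵇ {suc (toℕ u)} {suc (toℕ v)} (s≤s v<u) = refl

      step : ∀ j τ → j ℕ.< n → At j τ → evalᵇ R τ (var J <ₙ N) ≡ true ×
        Runs (truncate TMP₁ A ⨾ truncate TMP₂ D ⨾ add-profit) τ profit-time (At (suc j))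
      step j τ j<n at = <false⇒≡true (subst₂ ℕ._<_ (sym (At.J≡ at)) (sym (Static.n≡ (At.static at))) j<n) ,
        Runs-seq (Runs-frame (Runs-truncate TMP₁ A)) λ τ₁ (t₁ , fr₁) →
        let st₁ = Static-frame (truncate TMP₁ A) refl fr₁ (At.static at) in
        Runs-seq (Runs-frame (Runs-truncate TMP₂ D)) λ τ₂ (t₂ , fr₂) →
        let st₂ = Static-frame (truncate TMP₂ D) refl fr₂ st₁
            J₁ : nats τ₁ J 0 ≡ toℕ v
            J₁ = trans (cong-app (same-nats fr₁ J refl) 0) (trans (At.J≡ at) (sym toℕ-v))
            J₂ : nats τ₂ J 0 ≡ toℕ v
            J₂ = trans (cong-app (same-nats fr₂ J refl) 0) J₁
        in Runs-mono ℕ.≤-refl (λ τ₃ ((J≡ , p) , fr) → record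
          { J≡ = trans J≡ (trans (cong (ℕ._+ 1) (trans J₂ toℕ-v)) (ℕ.+-comm j 1))
          ; static = Static-frame add-profit refl fr st₂
          ; A≡ = trans (same-scalars fr A refl) (trans (same-scalars fr₂ A refl) (trans (same-scalars fr₁ A refl) (At.A≡ at)))
          ; D≡ = trans (same-scalars fr D refl) (trans (same-scalars fr₂ D refl) (trans (same-scalars fr₁ D refl) (At.D≡ at)))
          ; LAB≡ = trans (same-nats fr LAB refl) (trans (same-nats fr₂ LAB refl) (trans (same-nats fr₁ LAB refl) (At.LAB≡ at)))
          ; profit≡ = λ i → trans (p i) (update i
              (trans (cong₂ (λ f j → f j) (trans (same-nats fr₂ LAB refl) (trans (same-nats fr₁ LAB refl) (At.LAB≡ at))) J₂) refl)
              (λ i → trans (cong-app (trans (same-scalars fr₂ PROFIT refl) (same-scalars fr₁ PROFIT refl)) i)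
                       (trans (At.profit≡ at i) (cong (λ z → partial z i) (sym toℕ-v))))
              (cong₂ _*_ (trans (cong (scalars τ₂ WT) J₂) (Static.w≡ st₂ v))
                (cong₂ _-_ (cong (λ z → z + z) (cong₂ _-_
                    (trans t₂ (cong₂ _⊓_ (trans (cong (scalars τ₁ D) J₁) (cong-app (trans (same-scalars fr₁ D refl) (At.D≡ at)) (toℕ v))) (Static.half st₁)))
                    (trans (cong-app (same-scalars fr₂ TMP₁ refl) 0) (trans t₁
                      (cong₂ _⊓_ (trans (cong (scalars τ A) (trans (At.J≡ at) (sym toℕ-v))) (cong-app (At.A≡ at) (toℕ v))) (Static.half (At.static at)))))))
                  (trans (cong (scalars τ₂ X) J₂) (Static.x≡ st₂ v))))) })
          (Runs-frame (Runs-straight {Φ = λ τ₃ → nats τ₃ J 0 ≡ nats τ₂ J 0 ℕ.+ 1 × (∀ i → scalars τ₃ PROFIT i ≡ _)}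
            add-profit refl (refl , λ _ → refl)))
        where
        v = fromℕ< j<n
        toℕ-v : toℕ v ≡ j
        toℕ-v = Fin.toℕ-fromℕ< j<n
        update : ∀ {lab p g} i → lab ≡ V.lab σ v → (∀ i → p i ≡ partial (toℕ v) i) → g ≡ gain v →
                 (if lab ≡ᵇ i then p lab + g else p i) ≡ partial (suc j) i
        update {p = p} i refl ps refl = trans by-label
          (trans (sym (partial-suc v i)) (cong (λ z → partial (suc z) i) toℕ-v))
          where
          by-label : (if V.lab σ v ≡ᵇ i then p (V.lab σ v) + gain v else p i) ≡
                     partial (toℕ v) i + (if labelled i v then gain v else 0#)
          by-label with V.lab σ v ≡ᵇ i in e
          ... | true  = cong (_+ gain v) (trans (cong p (≡ᵇ-true e)) (ps i))
          ... | false = trans (ps i) (sym (+-identityʳ _))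

    Runs-profits : Runs profits σ profits-time (λ τ → ∀ i → scalars τ PROFIT i ≡ profit i)
    Runs-profits = Runs-seq {Φ = At 0}
      (Runs-straight (J ≔ lit 0) refl record
        { J≡ = refl ; static = Static-frame (J ≔ lit 0) refl (⇓-frame ⇓set) st ; A≡ = refl ; D≡ = refl ; LAB≡ = refl
        ; profit≡ = λ i → trans (zeros i) (sym (∑-zero n)) })
      λ τ i₀ → Runs-mono ℕ.≤-refl (λ τ at i → trans (At.profit≡ at i) (∑-cong λ v →
          cong (λ b → if b ∧ labelled i v then gain v else 0#) (true-≤ᵇ (Fin.toℕ<n v))))
        (Runs-for At n profit-time step (λ τ at → <-stop (trans (At.J≡ at) (sym (Static.n≡ (At.static at))))) i₀)

  argmax-body : Cmd
  argmax-body = (ifᶜ getᵣ PROFIT (var Q) ≤ᵣ getᵣ PROFIT (var J) then (Q ≔ var J) else skip) ⨾ J ≔ var J ⊕ lit 1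

  argmax-time : ℕ
  argmax-time = time (Q ≔ lit 0 ⨾ J ≔ lit 0) ℕ.+ loop-time k (var J <ₙ K) argmax-body

  Runs-argmax : ∀ {σ} → nats σ 0 2 ≡ k →
    Runs argmax σ argmax-time (λ τ → ∀ (i : Fin k) → scalars σ PROFIT (toℕ i) ≤ scalars σ PROFIT (nats τ Q 0))
  Runs-argmax {σ} k≡ = Runs-seq {Φ = Inv′ 0}
    (Runs-straight (Q ≔ lit 0 ⨾ J ≔ lit 0) refl (refl , k≡ , refl , λ _ ()))
    λ τ i₀ → Runs-mono ℕ.≤-refl (λ _ (_ , _ , _ , p) i → p (toℕ i) (Fin.toℕ<n i))
      (Runs-for Inv′ k (time argmax-body) step (λ τ (J≡ , k≡ , _) → <-stop (trans J≡ (sym k≡))) i₀)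
    where
    Inv′ Next : ℕ → State R → Set _
    Inv′ j τ = nats τ J 0 ≡ j × nats τ 0 2 ≡ k × scalars τ PROFIT ≡ scalars σ PROFIT ×
      (∀ i → i ℕ.< j → scalars σ PROFIT i ≤ scalars σ PROFIT (nats τ Q 0))
    Next j τ = nats τ J 0 ≡ j × nats τ 0 2 ≡ k × scalars τ PROFIT ≡ scalars σ PROFIT ×
      (∀ i → i ℕ.< suc j → scalars σ PROFIT i ≤ scalars σ PROFIT (nats τ Q 0))
    step : ∀ j τ → j ℕ.< k → Inv′ j τ → evalᵇ R τ (var J <ₙ K) ≡ true × Runs argmax-body τ (time argmax-body) (Inv′ (suc j))
    step j τ j<k (refl , k≡ , P≡ , max) = <false⇒≡true (ℕ.≤-trans j<k (ℕ.≤-reflexive (sym k≡))) ,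
      Runs-seq {Φ = Next j} (Runs-if
        (λ e → Runs-straight (Q ≔ var J) refl (refl , k≡ , P≡ , λ i i<1+j → better (does-true (_ ≤? _) e) i (i ℕ.≟ j) i<1+j))
        (λ e → Runs-straight skip refl (refl , k≡ , P≡ , λ i i<1+j → worse (≰⇒≥ (does-false (_ ≤? _) e)) i (i ℕ.≟ j) i<1+j)))
      λ υ (J≡ , k≡ , P≡ , p) → Runs-straight (J ≔ var J ⊕ lit 1) refl (trans (cong (ℕ._+ 1) J≡) (ℕ.+-comm j 1) , k≡ , P≡ , p)
      where
      q = nats τ Q 0
      p = scalars σ PROFIT
      better : scalars τ PROFIT q ≤ scalars τ PROFIT j → ∀ i → Dec (i ≡ j) → i ℕ.< suc j → p i ≤ p j
      better le i (yes refl) _ = ≤-refl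
      better le i (no i≢j) i<1+j = ≤-trans (max i (ℕ.≤∧≢⇒< (ℕ.≤-pred i<1+j) i≢j)) (subst (λ f → f q ≤ f j) P≡ le)
      worse : scalars τ PROFIT j ≤ scalars τ PROFIT q → ∀ i → Dec (i ≡ j) → i ℕ.< suc j → p i ≤ p q
      worse le i (yes refl) _ = subst (λ f → f j ≤ f q) P≡ le
      worse le i (no i≢j) i<1+j = max i (ℕ.≤∧≢⇒< (ℕ.≤-pred i<1+j) i≢j)

  output-body : Cmd
  output-body = (ifᶜ (getᵣ A (var J) ≤ᵣ varᵣ THETA) andᵇ notᵇ (getᵣ D (var J) ≤ᵣ varᵣ THETA)
          then set OUT (var J) (lit 1) else skip) ⨾ J ≔ var J ⊕ lit 1

  output-time : ℕ
  output-time = time (J ≔ lit 0) ℕ.+ loop-time n (var J <ₙ N) output-body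

  Runs-output : ∀ {σ} → nats σ 0 0 ≡ n → (∀ i → nats σ OUT i ≡ 0) →
    Runs output σ output-time (λ τ → ∀ v → not (nats τ OUT (toℕ v) ≡ᵇ 0) ≡ inCutᵇ (V.A σ) (V.D σ) (V.θ σ) v)
  Runs-output {σ} n-σ zeros = Runs-seq {Φ = At 0}
    (Runs-straight (J ≔ lit 0) refl record
      { J≡ = refl ; n≡ = n-σ ; same = refl ; done = λ _ () ; todo = λ i _ → zeros i })
    λ τ i₀ → Runs-mono ℕ.≤-refl (λ τ at v → At.done at (toℕ v) (Fin.toℕ<n v))
      (Runs-for At n (time output-body) step (λ τ at → <-stop (trans (At.J≡ at) (sym (At.n≡ at)))) i₀)
    where
    chosen : ℕ → Bool
    chosen i = does (scalars σ A i ≤? scalars σ THETA 0) ∧ not (does (scalars σ D i ≤? scalars σ THETA 0))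
    record At (j : ℕ) (τ : State R) : Set c where
      field
        J≡    : nats τ J 0 ≡ j
        n≡    : nats τ 0 0 ≡ n
        same  : scalars τ ≡ scalars σ
        done  : ∀ i → i ℕ.< j → not (nats τ OUT i ≡ᵇ 0) ≡ chosen i
        todo  : ∀ i → j ℕ.≤ i → nats τ OUT i ≡ 0
    chosen-now : ∀ {f : ArrayName → ℕ → Carrier} {j i} → f ≡ scalars σ → i ≡ j →
      (does (f A i ≤? f THETA 0) ∧ not (does (f D i ≤? f THETA 0))) ≡ chosen j
    chosen-now refl refl = refl
    step : ∀ j τ → j ℕ.< n → At j τ → evalᵇ R τ (var J <ₙ N) ≡ true × Runs output-body τ (time output-body) (At (suc j))
    step j τ j<n at = <false⇒≡true (subst₂ ℕ._<_ (sym (At.J≡ at)) (sym (At.n≡ at)) j<n) ,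
      Runs-seq {Φ = λ υ → At (suc j) (exec (J ≔ var J ⊕ lit 1) υ)} (Runs-if
        (λ e → Runs-straight (set OUT (var J) (lit 1)) refl record
          { J≡ = J′ ; n≡ = At.n≡ at ; same = At.same at
          ; done = λ i i<1+j → written (trans (sym (chosen-now (At.same at) (At.J≡ at))) e) i (i ℕ.≟ j) i<1+j
          ; todo = λ i j<i → trans (at-other (ℕ.<⇒≢ (subst (ℕ._< i) (sym (At.J≡ at)) j<i))) (At.todo at i (ℕ.<⇒≤ j<i)) })
        (λ e → Runs-straight skip refl record
          { J≡ = J′ ; n≡ = At.n≡ at ; same = At.same at
          ; done = λ i i<1+j → unwritten (trans (sym (chosen-now (At.same at) (At.J≡ at))) e) i (i ℕ.≟ j) i<1+j
          ; todo = λ i j<i → At.todo at i (ℕ.<⇒≤ j<i) }))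
      λ υ a → Runs-straight (J ≔ var J ⊕ lit 1) refl a
      where
      J′ : nats τ J 0 ℕ.+ 1 ≡ suc j
      J′ = trans (ℕ.+-comm _ 1) (cong suc (At.J≡ at))
      written : chosen j ≡ true → ∀ i → Dec (i ≡ j) → i ℕ.< suc j →
        not ((if nats τ J 0 ≡ᵇ i then 1 else nats τ OUT i) ≡ᵇ 0) ≡ chosen i
      written e i (yes refl) _ = trans (cong (λ z → not (z ≡ᵇ 0)) (trans (cong (λ z → if z ≡ᵇ i then 1 else nats τ OUT i) (At.J≡ at)) (at-same i))) (sym e)
      written e i (no i≢j) i<1+j = trans (cong (λ z → not (z ≡ᵇ 0)) (at-other (λ eq → i≢j (trans (sym eq) (At.J≡ at)))))
        (At.done at i (ℕ.≤∧≢⇒< (ℕ.≤-pred i<1+j) i≢j))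
      unwritten : chosen j ≡ false → ∀ i → Dec (i ≡ j) → i ℕ.< suc j → not (nats τ OUT i ≡ᵇ 0) ≡ chosen i
      unwritten e i (yes refl) _ = trans (cong (λ z → not (z ≡ᵇ 0)) (At.todo at i ℕ.≤-refl)) (sym e)
      unwritten e i (no i≢j) i<1+j = At.done at i (ℕ.≤∧≢⇒< (ℕ.≤-pred i<1+j) i≢j)

-- The running time and the complete program.

opaque
  -- A round number above the coefficient that `total≤` accumulates; the comparison is by
  -- evaluation. Opacity keeps products with it from being unfolded.
  time-factor : ℕ
  time-factor = 20000

  ≤time-factor : ∀ {a} → (a ≤ᵇ 20000) ≡ true → a ℕ.≤ time-factor
  ≤time-factor {a} = ≤ᵇ-true {a}

-- A record, so that the coefficient is an index that unification can infer; from a product it could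
-- not be recovered. Bounds can then leave it as `_`, to be evaluated once at the end.
record Within (X a t : ℕ) : Set where
  constructor within
  field bound : t ℕ.≤ a ℕ.* X

open Within

bounded-const : ∀ {X} a → 1 ℕ.≤ X → Within X a a
bounded-const a 1≤X = within (ℕ.≤-trans (ℕ.≤-reflexive (sym (ℕ.*-identityʳ a))) (ℕ.*-monoʳ-≤ a 1≤X))

bounded-+ : ∀ {X a b s t} → Within X a s → Within X b t → Within X (a ℕ.+ b) (s ℕ.+ t)
bounded-+ {X} {a} {b} (within p) (within q) =
  within (ℕ.≤-trans (ℕ.+-mono-≤ p q) (ℕ.≤-reflexive (sym (ℕ.*-distribʳ-+ X a b))))

bounded-≤ : ∀ {X a s t} → s ℕ.≤ t → Within X a t → Within X a s
bounded-≤ s≤t (within p) = within (ℕ.≤-trans s≤t p)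

relax : ∀ {X a b t} → a ℕ.≤ b → Within X a t → Within X b t
relax {X} a≤b (within p) = within (ℕ.≤-trans p (ℕ.*-monoˡ-≤ X a≤b))

module Theorem {c ℓ} (R : OrderedField c ℓ) (ins : NodeMC R) (x : Fin (NodeMC.n ins) → OrderedField.Carrier R)
              (feasible : NodeMC.Feasible ins x) where
  open FieldProperties R hiding (solve; _:=_; _:+_; _:*_; _:-_; :-_; con; Polynomial)
  open NodeMC ins
  open Rounding R ins x feasible
  open Hoare R
  open Tournament R using (sift-time; sift-step; Parents)
  open Program
  open Verification R ins x feasible
  open Passes R ins x feasible
  open Search R ins x feasible
  open Correctness R ins x feasible

  size : ℕ
  size = m ℕ.+ n ℕ.* L

  1≤L : 1 ℕ.≤ L
  1≤L = ℕ.≤-trans (ℕ.≤-reflexive (sym (⌊log₂[2^n]⌋≡n 1))) (⌊log₂⌋-mono-≤ n≥2)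

  n≤size : n ℕ.≤ size
  n≤size = ℕ.≤-trans (ℕ.≤-trans (ℕ.≤-reflexive (sym (ℕ.*-identityʳ n))) (ℕ.*-monoʳ-≤ n 1≤L)) (ℕ.m≤n+m (n ℕ.* L) m)

  1≤size : 1 ℕ.≤ size
  1≤size = ℕ.≤-trans 1≤n n≤size

  k≤n : k ℕ.≤ n
  k≤n = Fin.injective⇒≤ s-injective

  -- A cost of a (1 + L) per vertex sums to a (n + n L). Since n ≥ 2 gives L ≥ 1, both n and n L are
  -- at most `size`, hence the doubled coefficient.
  times-n : ∀ {N T a} → N ℕ.≤ n → Within (suc L) a T → Within size (a ℕ.+ a) (N ℕ.* T)
  times-n {N} {T} {a} N≤n (within T≤) = within (begin
    N ℕ.* T                     ≤⟨ ℕ.*-mono-≤ N≤n T≤ ⟩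
    n ℕ.* (a ℕ.* suc L)         ≡⟨ solve 3 (λ n a l → n :* (a :* (con 1 :+ l)) := a :* (n :+ n :* l)) refl n a L ⟩
    a ℕ.* (n ℕ.+ n ℕ.* L)       ≤⟨ ℕ.*-monoʳ-≤ a (ℕ.+-mono-≤ n≤size (ℕ.m≤n+m (n ℕ.* L) m)) ⟩
    a ℕ.* (size ℕ.+ size)       ≡⟨ solve 2 (λ a s → a :* (s :+ s) := (a :+ a) :* s) refl a size ⟩
    (a ℕ.+ a) ℕ.* size          ∎)
    where
    open ℕ.≤-Reasoning
    open +-*-Solver

  private
    const : ∀ a → Within size a a
    const a = bounded-const a 1≤size

    const-log : ∀ a → Within (suc L) a a
    const-log a = bounded-const a (s≤s z≤n)

    loop≤ : ∀ {N} b C → N ℕ.≤ n → let e = suc (costᵇ b ℕ.+ time C) in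
            Within size ((e ℕ.+ e) ℕ.+ suc (costᵇ b)) (loop-time N b C)
    loop≤ b C N≤n = bounded-+ (times-n N≤n (const-log (suc (costᵇ b ℕ.+ time C)))) (const (suc (costᵇ b)))

    sift≤ : Within (suc L) _ (sift-time L)
    sift≤ = bounded-+ (const-log (time (I ≔ get PAR (N ⊕ var V))))
      (bounded-+ (within {a = sift-step} (ℕ.≤-reflexive (ℕ.*-comm (suc L) sift-step))) (const-log (suc (costᵇ (lit 1 ≤ₙ var I)))))

    new≤ : Within (suc L) _ new-cost
    new≤ = bounded-+ (const-log (time enqueue)) sift≤

    visit≤ : Within (suc L) _ visit-time
    visit≤ = bounded-+ (const-log (suc (costᵇ (get DISC (var V) =ₙ lit 0)))) new≤

    source≤ : Within (suc L) _ source-time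
    source≤ = bounded-+
      (bounded-+ (const-log (suc (costᵇ (var J =ₙ var Q))))
        (bounded-≤ (ℕ.m⊔n≤m+n 1 _) (bounded-+ (const-log 1)
          (bounded-+ (const-log (time (V ≔ get 1 (var J)))) (bounded-+ (const-log (time (LABEL ≔ var J))) visit≤)))))
      (const-log (time (J ≔ var J ⊕ lit 1)))

    sources≤ : Within size _ sources-time
    sources≤ = bounded-+ (const (time (J ≔ lit 0)))
      (bounded-+ (times-n k≤n (bounded-+ (const-log (suc (costᵇ (var J <ₙ K)))) source≤)) (const (suc (costᵇ (var J <ₙ K)))))

    opaque
      unfolding scan-exit

      settle≤ : Within (suc L) 1000 (enqueue-time ℕ.+ vertex-cost)
      settle≤ = relax (ℕ.≤ᵇ⇒≤ _ 1000 _) (bounded-+ new≤ (bounded-+ (const-log search-exit) (bounded-+ (const-log extract-time)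
          (bounded-+ (const-log advance-time) (bounded-+ (bounded-+ (const-log (time settle)) sift≤) (const-log scan-exit))))))

      slot≤ : slot-cost ℕ.≤ 100
      slot≤ = ℕ.≤ᵇ⇒≤ _ 100 _

      exit≤ : search-exit ℕ.≤ 100
      exit≤ = ℕ.≤ᵇ⇒≤ _ 100 _

    times-2m : ∀ {T} a → T ℕ.≤ a → Within size (a ℕ.+ a) ((m ℕ.+ m) ℕ.* T)
    times-2m a T≤a = within (ℕ.≤-trans (ℕ.*-mono-≤ (ℕ.+-mono-≤ m≤size m≤size) T≤a)
      (ℕ.≤-reflexive (solve 2 (λ s a → (s :+ s) :* a := (a :+ a) :* s) refl size a)))
      where
      open +-*-Solver
      m≤size : m ℕ.≤ size
      m≤size = ℕ.m≤m+n m (n ℕ.* L)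

    search≤ : Within size _ search-time
    search≤ = bounded-+ (bounded-+ (times-n {a = 1000} ℕ.≤-refl settle≤) (times-2m 100 slot≤))
      (bounded-≤ exit≤ (const 100))

    pass≤ : Within size _ pass-time
    pass≤ = bounded-+ (bounded-+ (const (time (J ≔ lit 0))) (loop≤ (var J <ₙ N) clear-body ℕ.≤-refl))
      (bounded-+ (bounded-+ (const (time (I ≔ N ⊖ lit 1))) (loop≤ (lit 1 ≤ₙ var I) (pull ⨾ I ≔ var I ⊖ lit 1) (ℕ.m∸n≤m n 1)))
      (bounded-+ (const (time reset)) (bounded-+ sources≤ (bounded-+ search≤ (const (time keep-best))))))

  parents-time adjacency-time total-time : ℕ
  parents-time = time (I ≔ lit 0) ℕ.+ loop-time n (var I <ₙ N) parents-body
  adjacency-time = time (J ≔ M) ℕ.+ loop-time m (lit 1 ≤ₙ var J) adjacency-body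
  total-time = time halved ℕ.+ (parents-time ℕ.+ (adjacency-time ℕ.+ (time (Q ≔ K) ℕ.+
    (pass-time ℕ.+ (profits-time ℕ.+ (argmax-time ℕ.+ (pass-time ℕ.+ output-time)))))))

  total≤ : total-time ℕ.≤ time-factor ℕ.* size
  total≤ = bound (relax (≤time-factor refl) (bounded-+ (const (time halved))
    (bounded-+ (bounded-+ (const (time (I ≔ lit 0))) (loop≤ (var I <ₙ N) parents-body ℕ.≤-refl))
    (bounded-+ adjacency≤
    (bounded-+ (const (time (Q ≔ K))) (bounded-+ pass≤ (bounded-+ profits≤ (bounded-+ argmax≤ (bounded-+ pass≤ output≤)))))))))
    where
    slots = suc (costᵇ (lit 1 ≤ₙ var J) ℕ.+ time adjacency-body)
    adjacency≤ : Within size (time (J ≔ M) ℕ.+ (slots ℕ.+ suc (costᵇ (lit 1 ≤ₙ var J)))) adjacency-time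
    adjacency≤ = bounded-+ (const (time (J ≔ M))) (bounded-+
      (within {a = slots} (ℕ.≤-trans (ℕ.*-monoˡ-≤ slots (ℕ.m≤m+n m (n ℕ.* L))) (ℕ.≤-reflexive (ℕ.*-comm size slots)))) (const (suc (costᵇ (lit 1 ≤ₙ var J)))))
    round = suc (costᵇ (var J <ₙ N) ℕ.+ profit-time)
    profits≤ : Within size (time (J ≔ lit 0) ℕ.+ ((round ℕ.+ round) ℕ.+ suc (costᵇ (var J <ₙ N)))) profits-time
    profits≤ = bounded-+ (const (time (J ≔ lit 0)))
      (bounded-+ (times-n {a = round} ℕ.≤-refl (const-log round)) (const (suc (costᵇ (var J <ₙ N)))))
    argmax≤ : Within size _ argmax-time
    argmax≤ = bounded-+ (const (time (Q ≔ lit 0 ⨾ J ≔ lit 0))) (loop≤ (var J <ₙ K) argmax-body k≤n)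
    output≤ : Within size _ output-time
    output≤ = bounded-+ (const (time (J ≔ lit 0))) (loop≤ (var J <ₙ N) output-body ℕ.≤-refl)

  -- the complete program

  array-at : ∀ {a} {B : Set a} {q} (z : B) (f : Fin q → B) i → array R z f (toℕ i) ≡ f i
  array-at {q = q} z f i with toℕ i ℕ.<? q
  ... | yes p = cong f (Fin.fromℕ<-toℕ i p)
  ... | no p  = contradiction (Fin.toℕ<n i) p

  Answer : State R → Set ℓ
  Answer τ = ∃[ C ] IsMultiwayCut C × result R τ ≡ C × weight C ≤ (2[1-1/k]· objective x)

  answer : ∀ {q σ₁ σ₃ τ} (p₁ : Passed k σ₁) (p₂ : Passed q σ₃) → let open Averaging (Passed.distances p₁) in
    (∀ (i : Fin k) → profit (toℕ i) ≤ profit q) →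
    (∀ v → not (nats τ OUT (toℕ v) ≡ᵇ 0) ≡ Distances.inCut (Passed.distances p₂) (V.θ σ₃) v) → Answer τ
  answer {σ₃ = σ₃} p₁ p₂ max out = Two.cut (V.θ σ₃) ,
    Two.cut-isMultiwayCut (Passed.0≤θ p₂) (Passed.θ<½ p₂) , Vec.tabulate-cong out ,
    One.cut-bound (Passed.distances p₂) {V.θ σ₃} (Passed.good p₂) (One.max-profit max)
    where
    module One = Averaging (Passed.distances p₁)
    module Two = Distances (Passed.distances p₂)

  Runs-multiwayCut : Runs multiwayCut (load R ins x []) (time-factor ℕ.* size) Answer
  Runs-multiwayCut = Runs-mono total≤ (λ _ a → a)
    (Runs-seq (Runs-frame (Runs-straight {Φ = λ τ → scalars τ HALF 0 ≡ ½} halved refl refl)) λ σ₁ (half , fr₁) →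
     Runs-seq (Runs-frame (Runs-parents (cong-app (same-nats fr₁ 0 refl) 0))) λ σ₂ (par , fr₂) →
     Runs-seq (Runs-frame (Runs-adjacency (cong-app (trans (same-nats fr₂ 0 refl) (same-nats fr₁ 0 refl)) 1)
       (λ j → cong-app (trans (same-nats fr₂ HEAD refl) (same-nats fr₁ HEAD refl)) j)
       (λ e → trans (cong-app (trans (same-nats fr₂ 2 refl) (same-nats fr₁ 2 refl)) (toℕ e)) (array-at 0 _ e))
       (λ e → trans (cong-app (trans (same-nats fr₂ 3 refl) (same-nats fr₁ 3 refl)) (toℕ e)) (array-at 0 _ e)))) λ σ₃ (ch , fr₃) →
     Runs-seq (Runs-frame (Runs-straight {Φ = λ τ → nats τ Q 0 ≡ nats σ₃ 0 2} (Q ≔ K) refl refl)) λ σ₄ (Q≡ , fr₄) →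
     let st₃ = static σ₁ σ₂ σ₃ half fr₁ par fr₂ ch fr₃
         st₄ = Static-frame (Q ≔ K) refl fr₄ st₃ in
     Runs-seq (Runs-frame (Runs-pass st₄ (trans Q≡ (Static.k≡ st₃)))) λ σ₅ (p₁ , fr₅) →
     let st₅ = Passed.static p₁ in
     Runs-seq (Runs-frame (Runs-profits st₅ (Passed.distances p₁) (λ i → cong (λ f → f i)
       (trans (same-scalars fr₅ PROFIT refl) (trans (same-scalars fr₄ PROFIT refl) (trans (same-scalars fr₃ PROFIT refl)
         (trans (same-scalars fr₂ PROFIT refl) (same-scalars fr₁ PROFIT refl)))))))) λ σ₆ (pr , fr₆) →
     let st₆ = Static-frame profits refl fr₆ st₅ in
     Runs-seq (Runs-frame (Runs-argmax (Static.k≡ st₆))) λ σ₇ (mx , fr₇) →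
     Runs-seq (Runs-frame (Runs-pass (Static-frame argmax refl fr₇ st₆) refl)) λ σ₈ (p₂ , fr₈) →
     Runs-mono ℕ.≤-refl (λ τ out → answer {q = nats σ₇ Q 0} {τ = τ} p₁ p₂ (λ i → ≤-resp₂ (pr (toℕ i)) (pr (nats σ₇ Q 0)) (mx i)) out)
       (Runs-output (Static.n≡ (Passed.static p₂)) (λ i → cong (λ f → f i)
         (trans (same-nats fr₈ OUT refl) (trans (same-nats fr₇ OUT refl) (trans (same-nats fr₆ OUT refl) (trans (same-nats fr₅ OUT refl)
           (trans (same-nats fr₄ OUT refl) (trans (same-nats fr₃ OUT refl) (trans (same-nats fr₂ OUT refl) (same-nats fr₁ OUT refl)))))))))))
    where
    σ₀ = load R ins x []
    static : ∀ σ₁ σ₂ σ₃ → scalars σ₁ HALF 0 ≡ ½ → Frame halved σ₀ σ₁ → Parents n (nats σ₂ PAR) → Frame parents σ₁ σ₂ →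
             Chains σ₃ nbrs → Frame adjacency σ₂ σ₃ → Static σ₃
    static σ₁ σ₂ σ₃ half fr₁ par fr₂ ch fr₃ = record
      { n≡ = cong-app (kept 0 refl refl refl) 0
      ; k≡ = cong-app (kept 0 refl refl refl) 2
      ; terminal = λ i → trans (cong-app (kept 1 refl refl refl) (toℕ i)) (array-at 0 _ i)
      ; w≡ = λ v → trans (cong-app (keptᵣ WT refl refl refl) (toℕ v)) (array-at 0# w v)
      ; x≡ = λ v → trans (cong-app (keptᵣ X refl refl refl) (toℕ v)) (array-at 0# x v)
      ; half = trans (cong-app (trans (same-scalars fr₃ HALF refl) (same-scalars fr₂ HALF refl)) 0) half
      ; parent = λ i p → trans (cong-app (same-nats fr₃ PAR refl) i) (par i p)
      ; chains = ch }
      where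
      kept : ∀ y → writesₙ adjacency y ≡ false → writesₙ parents y ≡ false → writesₙ halved y ≡ false → nats σ₃ y ≡ nats σ₀ y
      kept y a b c = trans (same-nats fr₃ y a) (trans (same-nats fr₂ y b) (same-nats fr₁ y c))
      keptᵣ : ∀ y → writesᵣ adjacency y ≡ false → writesᵣ parents y ≡ false → writesᵣ halved y ≡ false → scalars σ₃ y ≡ scalars σ₀ y
      keptᵣ y a b c = trans (same-scalars fr₃ y a) (trans (same-scalars fr₂ y b) (same-scalars fr₁ y c))

-- Both claims from the same run.

open import Data.Nat using (_+_; _*_)

mainTheorem8 : ∀ {c ℓ} (R : OrderedField c ℓ) →
    let open OrderedField R using (_≤_) in
    let open NodeMC in
    (∃[ P ] ∃[ K ]
    ∀ (I : NodeMC R) x → Feasible I x →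
    ∃[ d ] Σ[ C ∈ (Vec (OrderedField.Carrier R) d → Subset (n I)) ]
    (∀ ω → All (InUnit R) ω →
    IsMultiwayCut I (C ω) ×
    Returns R P I x (toList ω) (K * (m I + n I * ⌊log₂ n I ⌋)) (C ω)) ×
    (∃[ e ] IsExpectation R (λ ω → weight I (C ω)) e ×
    e ≤ (2[1-1/k]· I) (objective I x)))
    ×
    (∃[ P ] ∃[ K ]
    ∀ (I : NodeMC R) x → Feasible I x →
    ∃[ C ]
    IsMultiwayCut I C ×
    Returns R P I x [] (K * (k I * n I + m I + n I * ⌊log₂ n I ⌋)) C ×
    weight I C ≤ (2[1-1/k]· I) (objective I x))
mainTheorem8 R =
  (Program.multiwayCut , time-factor , λ I x f → randomized {f = f} (Theorem.Runs-multiwayCut R I x f)) ,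
  (Program.multiwayCut , time-factor , λ I x f → deterministic {f = f} (Theorem.Runs-multiwayCut R I x f))
  where
  open NodeMC
  open OrderedField R using (_≤_)
  module _ {I : NodeMC R} {x} {f : Feasible I x} where
    randomized : Hoare.Runs R Program.multiwayCut (load R I x []) (time-factor * (m I + n I * ⌊log₂ n I ⌋)) (Theorem.Answer R I x f) →
      ∃[ d ] Σ[ C ∈ (Vec (OrderedField.Carrier R) d → Subset (n I)) ]
      (∀ ω → All (InUnit R) ω → IsMultiwayCut I (C ω) ×
        Returns R Program.multiwayCut I x (toList ω) (time-factor * (m I + n I * ⌊log₂ n I ⌋)) (C ω)) ×
      (∃[ e ] IsExpectation R (λ ω → weight I (C ω)) e × e ≤ (2[1-1/k]· I) (objective I x))
    randomized (t , τ , r , t≤ , C , isCut , res , bound) =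
      -- The only vector of samples is `[]`, so the expectation is the weight of the returned cut
      -- itself.
      0 , (λ _ → C) , (λ { [] _ → isCut , t , τ , r , t≤ , res }) , weight I C , lift refl , bound
    deterministic : Hoare.Runs R Program.multiwayCut (load R I x []) (time-factor * (m I + n I * ⌊log₂ n I ⌋)) (Theorem.Answer R I x f) →
      ∃[ C ] IsMultiwayCut I C ×
      Returns R Program.multiwayCut I x [] (time-factor * (k I * n I + m I + n I * ⌊log₂ n I ⌋)) C ×
      weight I C ≤ (2[1-1/k]· I) (objective I x)
    deterministic (t , τ , r , t≤ , C , isCut , res , bound) =
      C , isCut , (t , τ , r , ℕ.≤-trans t≤ (ℕ.*-monoʳ-≤ time-factor (ℕ.+-monoˡ-≤ _ (ℕ.m≤n+m (m I) (k I * n I)))) , res) , bound
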